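{- There exist a free $W(k\llbracket t\rrbracket)$-module $M$ of rank $2$, an isogeny $F:\sigma^*M\to M$, and an element $\mathbf{v}$ of $(M\otimes_{W(k\llbracket t\rrbracket)} W(k((t))))\setminus M$ such that $F\mathbf{v}=\mathbf{v}$.
   Context: Let $k$ be an algebraically closed field of characteristic $p>0$. For a ring $A$ of characteristic $p$, $W(A)$ denotes the ring of $p$-typical Witt vectors over $A$, and $\sigma$ denotes the Witt vector Frobenius on $W(A)$ (induced by the $p$-power map on $A$). Here $\sigma^*M = M\otimes_{W(k\llbracket t\rrbracket),\sigma}W(k\llbracket t\rrbracket)$, and an isogeny is a morphism of modules whose kernel and cokernel are killed by some power of $p$. The isogeny $F$ induces a $\sigma$-linear map $M\to M$, and by $\sigma$-linear extension a map on $M\otimes W(k((t)))$, both again denoted $F$. As $M$ is free, it is regarded as a submodule of $M\otimes W(k((t)))$. -}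

module Defs where

open import Level using (Level; _⊔_; 0ℓ)
open import Algebra.Bundles using (AbelianGroup; CommutativeRing; RawRing)
open import Algebra.Module.Bundles using (Module)
open import Algebra.Module.Morphism.Structures using (module ModuleMorphisms)
open import Algebra.Module.Structures using (IsLeftModule)
open import Algebra.Module.Structures.Biased using (IsModuleFromLeft)
open import Algebra.Morphism.Bundles using (RingHomomorphism)
import Algebra.Properties.AbelianGroup as AbelianGroupProps
import Algebra.Properties.CommutativeMonoid.Sum as MonoidSum
import Algebra.Properties.CommutativeSemigroup as CommSemigroup
import Algebra.Properties.CommutativeSemiring.Binomial as Binomial
import Algebra.Properties.CommutativeSemiring.Exp as CommExp
import Algebra.Properties.Monoid.Mult as MonoidMult
import Algebra.Properties.Ring as RingProps
import Algebra.Properties.Semiring.Exp as Exp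
import Algebra.Properties.Semiring.Mult as Mult
import Algebra.Properties.Semiring.Sum as Sum
import Algebra.Solver.Ring.NaturalCoefficients.Default as Solver
open import Data.Fin.Base as Fin using (Fin; zero; suc; toℕ)
import Data.Fin.Properties as Finₚ
open import Data.Integer.Base as ℤ using (ℤ; +_)
import Data.Integer.Properties as ℤₚ
open import Data.List.Base using (List; []; _∷_; map)
open import Data.Nat.Base as ℕ using (ℕ; zero; suc; s≤s; z≤n; _!)
open import Data.Nat.Combinatorics using (_C_; nCn≡1; nCk≡n!/k![n-k]!; k![n∸k]!∣n!)
open import Data.Nat.Divisibility using (_∣_; divides; ∣⇒≤; m∣m*n)
import Data.Nat.DivMod as DivMod
open import Data.Nat.Primality using (Prime; euclidsLemma; prime⇒nonTrivial; prime⇒nonZero)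
import Data.Nat.Properties as ℕₚ
open import Data.Product.Base using (∃; _,_; proj₁; proj₂) renaming (_×_ to _∧_)
open import Data.Sum.Base using (_⊎_; inj₁; inj₂; [_,_]′)
open import Relation.Binary.PropositionalEquality.Core as ≡ using (_≡_)
import Relation.Binary.Reasoning.Setoid as SetoidReasoning
open import Relation.Binary.Structures using (IsEquivalence)
open import Relation.Nullary.Decidable.Core using (yes; no)
open import Relation.Nullary.Negation.Core using (¬_; contradiction)

private
  variable
    c ℓ c′ ℓ′ m ℓm m′ ℓm′ : Level


infix 4 _⟶_

_⟶_ : CommutativeRing c ℓ → CommutativeRing c′ ℓ′ → Set (c ⊔ ℓ ⊔ c′ ⊔ ℓ′)
R ⟶ S = RingHomomorphism (CommutativeRing.rawRing R) (CommutativeRing.rawRing S)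

module Hom {R : CommutativeRing c ℓ} {S : CommutativeRing c′ ℓ′} (f : R ⟶ S) where
  private
    module R = CommutativeRing R
    module S = CommutativeRing S
  open RingHomomorphism f public using (⟦_⟧; ⟦⟧-cong; +-homo; *-homo; 0#-homo; 1#-homo; -‿homo)
  open Exp R.semiring using () renaming (_^_ to _^ᴿ_)
  open Exp S.semiring using () renaming (_^_ to _^ˢ_)
  open Mult R.semiring using () renaming (_×_ to _×ᴿ_)
  open Mult S.semiring using () renaming (_×_ to _×ˢ_)

  ^-homo : ∀ x n → ⟦ x ^ᴿ n ⟧ S.≈ ⟦ x ⟧ ^ˢ n
  ^-homo x zero    = 1#-homo
  ^-homo x (suc n) = S.trans (*-homo x (x ^ᴿ n)) (S.*-cong S.refl (^-homo x n))

  ×-homo : ∀ n x → ⟦ n ×ᴿ x ⟧ S.≈ n ×ˢ ⟦ x ⟧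
  ×-homo zero    x = 0#-homo
  ×-homo (suc n) x = S.trans (+-homo x (n ×ᴿ x)) (S.+-cong S.refl (×-homo n x))

record CommutativeRingLaws (R : RawRing c ℓ) : Set (c ⊔ ℓ) where
  open RawRing R
  field
    isEquivalence : IsEquivalence _≈_
    +-cong : ∀ {x x′ y y′} → x ≈ x′ → y ≈ y′ → x + y ≈ x′ + y′
    *-cong : ∀ {x x′ y y′} → x ≈ x′ → y ≈ y′ → x * y ≈ x′ * y′
    -‿cong : ∀ {x x′} → x ≈ x′ → - x ≈ - x′
    +-assoc : ∀ x y z → (x + y) + z ≈ x + (y + z)
    +-comm : ∀ x y → x + y ≈ y + x
    +-identityˡ : ∀ x → 0# + x ≈ x
    -‿inverseˡ : ∀ x → - x + x ≈ 0#
    *-assoc : ∀ x y z → (x * y) * z ≈ x * (y * z)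
    *-comm : ∀ x y → x * y ≈ y * x
    *-identityˡ : ∀ x → 1# * x ≈ x
    distribʳ : ∀ x y z → (y + z) * x ≈ y * x + z * x

  open IsEquivalence isEquivalence using (trans)

  commutativeRing : CommutativeRing c ℓ
  commutativeRing = record
    { RawRing R
    ; isCommutativeRing = record
      { isRing = record
        { +-isAbelianGroup = record
          { isGroup = record
            { isMonoid = record
              { isSemigroup = record
                { isMagma = record { isEquivalence = isEquivalence ; ∙-cong = +-cong }
                ; assoc = +-assoc }
              ; identity = +-identityˡ , λ x → trans (+-comm x 0#) (+-identityˡ x) }
            ; inverse = -‿inverseˡ , λ x → trans (+-comm x (- x)) (-‿inverseˡ x)
            ; ⁻¹-cong = -‿cong }
          ; comm = +-comm }
        ; *-cong = *-cong
        ; *-assoc = *-assoc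
        ; *-identity = *-identityˡ , λ x → trans (*-comm x 1#) (*-identityˡ x)
        ; distrib = (λ x y z → trans (*-comm x (y + z))
                       (trans (distribʳ x y z) (+-cong (*-comm y x) (*-comm z x))))
                  , distribʳ
        }
      ; *-comm = *-comm
      }
    }

-- ℤ[ V ] is the free commutative ring on V, presented by terms modulo the ring axioms.

module Polynomial where

  infixl 6 _⊕_
  infixl 7 _⊗_
  infix 4 _~_

  data Expr (V : Set) : Set where
    var     : V → Expr V
    𝟘 𝟙     : Expr V
    _⊕_ _⊗_ : Expr V → Expr V → Expr V
    ⊖_      : Expr V → Expr V

  data _~_ {V : Set} : Expr V → Expr V → Set where
    ~refl  : ∀ {x} → x ~ x
    ~sym   : ∀ {x y} → x ~ y → y ~ x
    ~trans : ∀ {x y z} → x ~ y → y ~ z → x ~ z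
    ⊕-cong : ∀ {x x′ y y′} → x ~ x′ → y ~ y′ → x ⊕ y ~ x′ ⊕ y′
    ⊗-cong : ∀ {x x′ y y′} → x ~ x′ → y ~ y′ → x ⊗ y ~ x′ ⊗ y′
    ⊖-cong : ∀ {x x′} → x ~ x′ → ⊖ x ~ ⊖ x′
    ⊕-assoc : ∀ x y z → (x ⊕ y) ⊕ z ~ x ⊕ (y ⊕ z)
    ⊕-comm  : ∀ x y → x ⊕ y ~ y ⊕ x
    ⊕-identityˡ : ∀ x → 𝟘 ⊕ x ~ x
    ⊖-inverseˡ : ∀ x → ⊖ x ⊕ x ~ 𝟘
    ⊗-assoc : ∀ x y z → (x ⊗ y) ⊗ z ~ x ⊗ (y ⊗ z)
    ⊗-comm  : ∀ x y → x ⊗ y ~ y ⊗ x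
    ⊗-identityˡ : ∀ x → 𝟙 ⊗ x ~ x
    ⊗-distribʳ : ∀ x y z → (y ⊕ z) ⊗ x ~ y ⊗ x ⊕ z ⊗ x

  ℤ[_] : Set → CommutativeRing 0ℓ 0ℓ
  ℤ[ V ] = CommutativeRingLaws.commutativeRing laws
    where
    raw : RawRing 0ℓ 0ℓ
    raw = record { Carrier = Expr V ; _≈_ = _~_ ; _+_ = _⊕_ ; _*_ = _⊗_ ; -_ = ⊖_ ; 0# = 𝟘 ; 1# = 𝟙 }
    laws : CommutativeRingLaws raw
    laws = record
      { isEquivalence = record { refl = ~refl ; sym = ~sym ; trans = ~trans }
      ; +-cong = ⊕-cong ; *-cong = ⊗-cong ; -‿cong = ⊖-cong
      ; +-assoc = ⊕-assoc ; +-comm = ⊕-comm ; +-identityˡ = ⊕-identityˡ ; -‿inverseˡ = ⊖-inverseˡ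
      ; *-assoc = ⊗-assoc ; *-comm = ⊗-comm ; *-identityˡ = ⊗-identityˡ ; distribʳ = ⊗-distribʳ
      }

  evalRaw : (A : RawRing c ℓ) → ∀ {V} → (V → RawRing.Carrier A) → Expr V → RawRing.Carrier A
  evalRaw A ρ (var v) = ρ v
  evalRaw A ρ 𝟘       = RawRing.0# A
  evalRaw A ρ 𝟙       = RawRing.1# A
  evalRaw A ρ (x ⊕ y) = RawRing._+_ A (evalRaw A ρ x) (evalRaw A ρ y)
  evalRaw A ρ (x ⊗ y) = RawRing._*_ A (evalRaw A ρ x) (evalRaw A ρ y)
  evalRaw A ρ (⊖ x)   = RawRing.-_ A (evalRaw A ρ x)

  module _ (A : CommutativeRing c ℓ) where
    open CommutativeRing A

    evalAt : ∀ {V} → (V → Carrier) → Expr V → Carrier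
    evalAt = evalRaw rawRing

    evalAt-~ : ∀ {V} (ρ : V → Carrier) {x y} → x ~ y → evalAt ρ x ≈ evalAt ρ y
    evalAt-~ ρ ~refl              = refl
    evalAt-~ ρ (~sym r)           = sym (evalAt-~ ρ r)
    evalAt-~ ρ (~trans r s)       = trans (evalAt-~ ρ r) (evalAt-~ ρ s)
    evalAt-~ ρ (⊕-cong r s)       = +-cong (evalAt-~ ρ r) (evalAt-~ ρ s)
    evalAt-~ ρ (⊗-cong r s)       = *-cong (evalAt-~ ρ r) (evalAt-~ ρ s)
    evalAt-~ ρ (⊖-cong r)         = -‿cong (evalAt-~ ρ r)
    evalAt-~ ρ (⊕-assoc x y z)    = +-assoc _ _ _
    evalAt-~ ρ (⊕-comm x y)       = +-comm _ _
    evalAt-~ ρ (⊕-identityˡ x)    = +-identityˡ _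
    evalAt-~ ρ (⊖-inverseˡ x)     = -‿inverseˡ _
    evalAt-~ ρ (⊗-assoc x y z)    = *-assoc _ _ _
    evalAt-~ ρ (⊗-comm x y)       = *-comm _ _
    evalAt-~ ρ (⊗-identityˡ x)    = *-identityˡ _
    evalAt-~ ρ (⊗-distribʳ x y z) = distribʳ _ _ _

    evalAt-cong : ∀ {V} {ρ ρ′ : V → Carrier} → (∀ v → ρ v ≈ ρ′ v) →
                  ∀ x → evalAt ρ x ≈ evalAt ρ′ x
    evalAt-cong h (var v) = h v
    evalAt-cong h 𝟘       = refl
    evalAt-cong h 𝟙       = refl
    evalAt-cong h (x ⊕ y) = +-cong (evalAt-cong h x) (evalAt-cong h y)
    evalAt-cong h (x ⊗ y) = *-cong (evalAt-cong h x) (evalAt-cong h y)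
    evalAt-cong h (⊖ x)   = -‿cong (evalAt-cong h x)

    eval : ∀ {V} → (V → Carrier) → ℤ[ V ] ⟶ A
    eval ρ = record
      { ⟦_⟧ = evalAt ρ
      ; isRingHomomorphism = record
        { isSemiringHomomorphism = record
          { isNearSemiringHomomorphism = record
            { +-isMonoidHomomorphism = record
              { isMagmaHomomorphism = record
                { isRelHomomorphism = record { cong = evalAt-~ ρ }
                ; homo = λ _ _ → refl }
              ; ε-homo = refl }
            ; *-homo = λ _ _ → refl }
          ; 1#-homo = refl }
        ; -‿homo = λ _ → refl }
      }

  hom-eval : ∀ {A : CommutativeRing c ℓ} {B : CommutativeRing c′ ℓ′} (f : A ⟶ B)
             {V} (ρ : V → CommutativeRing.Carrier A) x →
             let open CommutativeRing B using (_≈_) in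
             RingHomomorphism.⟦_⟧ f (evalAt A ρ x) ≈ evalAt B (λ v → RingHomomorphism.⟦_⟧ f (ρ v)) x
  hom-eval {A = A} {B} f ρ = go
    where
    open CommutativeRing B
    open Hom {R = A} {S = B} f
    go : ∀ x → ⟦ evalAt A ρ x ⟧ ≈ evalAt B (λ v → ⟦ ρ v ⟧) x
    go (var v) = refl
    go 𝟘       = 0#-homo
    go 𝟙       = 1#-homo
    go (x ⊕ y) = trans (+-homo _ _) (+-cong (go x) (go y))
    go (x ⊗ y) = trans (*-homo _ _) (*-cong (go x) (go y))
    go (⊖ x)   = trans (-‿homo _) (-‿cong (go x))

module Series (R : CommutativeRing c ℓ) where
  open CommutativeRing R
  open SetoidReasoning setoid
  import Algebra.Properties.CommutativeSemigroup +-commutativeSemigroup as CSG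

  Ser : Set c
  Ser = ℕ → Carrier

  _≋_ : Ser → Ser → Set ℓ
  f ≋ g = ∀ n → f n ≈ g n

  tail : Ser → Ser
  tail f n = f (suc n)

  _+ₛ_ : Ser → Ser → Ser
  (f +ₛ g) n = f n + g n

  _·_ : Carrier → Ser → Ser
  (a · f) n = a * f n

  0ₛ 1ₛ : Ser
  0ₛ n = 0#
  1ₛ zero    = 1#
  1ₛ (suc n) = 0#

  -ₛ_ : Ser → Ser
  (-ₛ f) n = - f n

  -- Cauchy product, f g = f₀ g + t (tail f) g
  _*ₛ_ : Ser → Ser → Ser
  (f *ₛ g) zero    = f 0 * g 0
  (f *ₛ g) (suc n) = f 0 * g (suc n) + (tail f *ₛ g) n

  *ₛ-cong : ∀ {f f′ g g′} → f ≋ f′ → g ≋ g′ → (f *ₛ g) ≋ (f′ *ₛ g′)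
  *ₛ-cong p q zero    = *-cong (p 0) (q 0)
  *ₛ-cong p q (suc n) = +-cong (*-cong (p 0) (q (suc n))) (*ₛ-cong (λ i → p (suc i)) q n)

  ·-* : ∀ a f g → ((a · f) *ₛ g) ≋ (a · (f *ₛ g))
  ·-* a f g zero    = *-assoc _ _ _
  ·-* a f g (suc n) = trans (+-cong (*-assoc _ _ _) (·-* a (tail f) g n)) (sym (distribˡ _ _ _))

  distribʳₛ : ∀ h f g → ((f +ₛ g) *ₛ h) ≋ ((f *ₛ h) +ₛ (g *ₛ h))
  distribʳₛ h f g zero    = distribʳ _ _ _
  distribʳₛ h f g (suc n) = trans (+-cong (distribʳ _ _ _) (distribʳₛ h (tail f) (tail g) n))
    (CSG.interchange _ _ _ _)

  0*ₛ : ∀ f → (0ₛ *ₛ f) ≋ 0ₛ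
  0*ₛ f zero    = zeroˡ _
  0*ₛ f (suc n) = trans (+-cong (zeroˡ _) (0*ₛ f n)) (+-identityˡ _)

  1*ₛ : ∀ f → (1ₛ *ₛ f) ≋ f
  1*ₛ f zero    = *-identityˡ _
  1*ₛ f (suc n) = trans (+-cong (*-identityˡ _) (0*ₛ f n)) (+-identityʳ _)

  *ₛ-sucʳ : ∀ f g n → (f *ₛ g) (suc n) ≈ (f *ₛ tail g) n + f (suc n) * g 0
  *ₛ-sucʳ f g zero    = refl
  *ₛ-sucʳ f g (suc n) = trans (+-congˡ (*ₛ-sucʳ (tail f) g n)) (sym (+-assoc _ _ _))

  *ₛ-comm : ∀ f g → (f *ₛ g) ≋ (g *ₛ f)
  *ₛ-comm f g zero    = *-comm _ _
  *ₛ-comm f g (suc n) = begin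
    f 0 * g (suc n) + (tail f *ₛ g) n ≈⟨ +-cong (*-comm _ _) (*ₛ-comm (tail f) g n) ⟩
    g (suc n) * f 0 + (g *ₛ tail f) n ≈⟨ +-comm _ _ ⟩
    (g *ₛ tail f) n + g (suc n) * f 0 ≈⟨ sym (*ₛ-sucʳ g f n) ⟩
    (g *ₛ f) (suc n) ∎

  *ₛ-assoc : ∀ f g h → ((f *ₛ g) *ₛ h) ≋ (f *ₛ (g *ₛ h))
  *ₛ-assoc f g h zero    = *-assoc _ _ _
  *ₛ-assoc f g h (suc n) = begin
    f 0 * g 0 * h (suc n) + (((f 0 · tail g) +ₛ (tail f *ₛ g)) *ₛ h) n
      ≈⟨ +-cong (*-assoc _ _ _) (distribʳₛ h (f 0 · tail g) (tail f *ₛ g) n) ⟩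
    f 0 * (g 0 * h (suc n)) + (((f 0 · tail g) *ₛ h) n + ((tail f *ₛ g) *ₛ h) n)
      ≈⟨ +-congˡ (+-cong (·-* (f 0) (tail g) h n) (*ₛ-assoc (tail f) g h n)) ⟩
    f 0 * (g 0 * h (suc n)) + (f 0 * (tail g *ₛ h) n + (tail f *ₛ (g *ₛ h)) n)
      ≈⟨ sym (+-assoc _ _ _) ⟩
    f 0 * (g 0 * h (suc n)) + f 0 * (tail g *ₛ h) n + (tail f *ₛ (g *ₛ h)) n
      ≈⟨ +-congʳ (sym (distribˡ _ _ _)) ⟩
    f 0 * (g *ₛ h) (suc n) + (tail f *ₛ (g *ₛ h)) n ∎

  powerSeries : CommutativeRing c ℓ
  powerSeries = CommutativeRingLaws.commutativeRing laws
    where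
    raw : RawRing c ℓ
    raw = record { Carrier = Ser ; _≈_ = _≋_ ; _+_ = _+ₛ_ ; _*_ = _*ₛ_ ; -_ = -ₛ_ ; 0# = 0ₛ ; 1# = 1ₛ }
    laws : CommutativeRingLaws raw
    laws = record
      { isEquivalence = record
        { refl = λ _ → refl ; sym = λ p n → sym (p n) ; trans = λ p q n → trans (p n) (q n) }
      ; +-cong = λ p q n → +-cong (p n) (q n) ; *-cong = *ₛ-cong ; -‿cong = λ p n → -‿cong (p n)
      ; +-assoc = λ _ _ _ _ → +-assoc _ _ _ ; +-comm = λ _ _ _ → +-comm _ _
      ; +-identityˡ = λ _ _ → +-identityˡ _ ; -‿inverseˡ = λ _ _ → -‿inverseˡ _
      ; *-assoc = *ₛ-assoc ; *-comm = *ₛ-comm ; *-identityˡ = 1*ₛ ; distribʳ = distribʳₛ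
      }


module TorsionFree where
  open Polynomial

  _TorsionFree_ : ℕ → CommutativeRing c ℓ → Set (c ⊔ ℓ)
  n TorsionFree R = ∀ x → n × x ≈ 0# → x ≈ 0#
    where
    open CommutativeRing R
    open Mult semiring using () renaming (_×_ to infixr 8 _×_)

  pos neg : Expr (Fin 0) → ℕ
  pos 𝟘       = 0
  pos 𝟙       = 1
  pos (x ⊕ y) = pos x ℕ.+ pos y
  pos (x ⊗ y) = pos x ℕ.* pos y ℕ.+ neg x ℕ.* neg y
  pos (⊖ x)   = neg x
  neg 𝟘       = 0
  neg 𝟙       = 0
  neg (x ⊕ y) = neg x ℕ.+ neg y
  neg (x ⊗ y) = pos x ℕ.* neg y ℕ.+ neg x ℕ.* pos y
  neg (⊖ x)   = pos x

  module Constants (A : CommutativeRing c ℓ) where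
    open CommutativeRing A
    open Mult semiring using (×-homo-+; ×1-homo-*) renaming (_×_ to infixr 8 _×_)
    open SetoidReasoning setoid
    open Solver commutativeSemiring using (solve; _:=_; _:+_; _:*_)

    pos-neg : (ρ : Fin 0 → Carrier) → ∀ x → evalAt A ρ x + neg x × 1# ≈ pos x × 1#
    pos-neg ρ 𝟘 = +-identityˡ _
    pos-neg ρ 𝟙 = refl
    pos-neg ρ (x ⊕ y) = begin
      evalAt A ρ x + evalAt A ρ y + (neg x ℕ.+ neg y) × 1#
        ≈⟨ +-congˡ (×-homo-+ 1# (neg x) (neg y)) ⟩
      evalAt A ρ x + evalAt A ρ y + (neg x × 1# + neg y × 1#)
        ≈⟨ solve 4 (λ a b c d → (a :+ b) :+ (c :+ d) := (a :+ c) :+ (b :+ d)) refl _ _ _ _ ⟩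
      (evalAt A ρ x + neg x × 1#) + (evalAt A ρ y + neg y × 1#)
        ≈⟨ +-cong (pos-neg ρ x) (pos-neg ρ y) ⟩
      pos x × 1# + pos y × 1# ≈⟨ sym (×-homo-+ 1# (pos x) (pos y)) ⟩
      (pos x ℕ.+ pos y) × 1# ∎
    pos-neg ρ (x ⊗ y) = begin
      e * e′ + (pos x ℕ.* neg y ℕ.+ neg x ℕ.* pos y) × 1#
        ≈⟨ +-congˡ (trans (×-homo-+ 1# (pos x ℕ.* neg y) _) (+-cong (×1-homo-* (pos x) _) (×1-homo-* (neg x) _))) ⟩
      e * e′ + (a * b′ + b * a′)
        ≈⟨ +-congˡ (+-cong (*-congʳ (sym (pos-neg ρ x))) (*-congˡ (sym (pos-neg ρ y)))) ⟩
      e * e′ + ((e + b) * b′ + b * (e′ + b′))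
        ≈⟨ solve 4 (λ e b e′ b′ → e :* e′ :+ ((e :+ b) :* b′ :+ b :* (e′ :+ b′)) := (e :+ b) :* (e′ :+ b′) :+ b :* b′)
             refl _ _ _ _ ⟩
      (e + b) * (e′ + b′) + b * b′
        ≈⟨ +-congʳ (*-cong (pos-neg ρ x) (pos-neg ρ y)) ⟩
      a * a′ + b * b′
        ≈⟨ sym (trans (×-homo-+ 1# (pos x ℕ.* pos y) _) (+-cong (×1-homo-* (pos x) _) (×1-homo-* (neg x) _))) ⟩
      (pos x ℕ.* pos y ℕ.+ neg x ℕ.* neg y) × 1# ∎
      where
      e = evalAt A ρ x
      e′ = evalAt A ρ y
      a = pos x × 1#
      b = neg x × 1#
      a′ = pos y × 1#
      b′ = neg y × 1#
    pos-neg ρ (⊖ x) = begin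
      - e + pos x × 1#       ≈⟨ +-congˡ (sym (pos-neg ρ x)) ⟩
      - e + (e + neg x × 1#) ≈⟨ sym (+-assoc _ _ _) ⟩
      - e + e + neg x × 1#   ≈⟨ +-congʳ (-‿inverseˡ e) ⟩
      0# + neg x × 1#        ≈⟨ +-identityˡ _ ⟩
      neg x × 1#             ∎
      where e = evalAt A ρ x

  evalAt-var : ∀ {V} (x : Expr V) → evalAt ℤ[ V ] var x ≡ x
  evalAt-var (var v) = ≡.refl
  evalAt-var 𝟘       = ≡.refl
  evalAt-var 𝟙       = ≡.refl
  evalAt-var (x ⊕ y) = ≡.cong₂ _⊕_ (evalAt-var x) (evalAt-var y)
  evalAt-var (x ⊗ y) = ≡.cong₂ _⊗_ (evalAt-var x) (evalAt-var y)
  evalAt-var (⊖ x)   = ≡.cong ⊖_ (evalAt-var x)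

  private
    ℤ-ring : CommutativeRing 0ℓ 0ℓ
    ℤ-ring = ℤₚ.+-*-commutativeRing

    open Mult (CommutativeRing.semiring ℤ-ring) using () renaming (_×_ to infixr 8 _×ᶻ_)

    ×ᶻ1 : ∀ n → n ×ᶻ ℤ.1ℤ ≡ + n
    ×ᶻ1 zero    = ≡.refl
    ×ᶻ1 (suc n) = ≡.cong (λ i → ℤ.1ℤ ℤ.+ i) (×ᶻ1 n)

    ×ᶻ-* : ∀ n i → n ×ᶻ i ≡ + n ℤ.* i
    ×ᶻ-* zero    i = ≡.refl
    ×ᶻ-* (suc n) i = ≡.trans (≡.cong (λ j → i ℤ.+ j) (×ᶻ-* n i)) (≡.sym (ℤₚ.suc-* (+ n) i))

  torsionFree-0 : ∀ n → suc n TorsionFree ℤ[ Fin 0 ]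
  torsionFree-0 n x nx~0 = begin
    x                              ≈⟨ sym (+-identityʳ x) ⟩
    x + 0#                         ≈⟨ +-congˡ (sym (-‿inverseʳ b)) ⟩
    x + (b + - b)                  ≈⟨ sym (+-assoc _ _ _) ⟩
    (x + b) + - b                  ≈⟨ +-congʳ x+b~b ⟩
    b + - b                        ≈⟨ -‿inverseʳ b ⟩
    0# ∎
    where
    open CommutativeRing ℤ[ Fin 0 ]
    open SetoidReasoning setoid
    open Mult semiring using () renaming (_×_ to infixr 8 _×_)
    ρ : Fin 0 → ℤ
    ρ ()
    f = eval ℤ-ring ρ
    E = evalAt ℤ-ring ρ x
    b = neg x × 1#
    E≡0 : E ≡ ℤ.0ℤ
    E≡0 with ℤₚ.i*j≡0⇒i≡0∨j≡0 (+ suc n) {E}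
               (≡.trans (≡.sym (×ᶻ-* (suc n) E))
                 (≡.trans (≡.sym (Hom.×-homo {R = ℤ[ Fin 0 ]} {S = ℤ-ring} f (suc n) x))
                   (evalAt-~ ℤ-ring ρ nx~0)))
    ... | inj₂ q = q
    pos≡neg : pos x ≡ neg x
    pos≡neg = ℤₚ.+-injective
      (≡.trans (≡.sym (×ᶻ1 (pos x)))
      (≡.trans (≡.sym (Constants.pos-neg ℤ-ring ρ x))
      (≡.trans (≡.cong (λ i → i ℤ.+ neg x ×ᶻ ℤ.1ℤ) E≡0)
      (≡.trans (ℤₚ.+-identityˡ _) (×ᶻ1 (neg x))))))
    x+b~b : x + b ~ b
    x+b~b = begin
      x + neg x × 1#                       ≡⟨ ≡.cong (λ y → y + neg x × 1#) (≡.sym (evalAt-var x)) ⟩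
      evalAt ℤ[ Fin 0 ] var x + neg x × 1# ≈⟨ Constants.pos-neg ℤ[ Fin 0 ] var x ⟩
      pos x × 1#                           ≡⟨ ≡.cong (λ n → n × 1#) pos≡neg ⟩
      neg x × 1# ∎

  -- Multivariate integer polynomials are torsion-free, by induction on the number of
  -- variables: a polynomial in one more variable is determined by its coefficient list.

  module Lists (R : CommutativeRing c ℓ) where
    open CommutativeRing R
    open Series R
    open CommSemigroup +-commutativeSemigroup using (interchange)

    addᴸ : List Carrier → List Carrier → List Carrier
    addᴸ []       ys       = ys
    addᴸ (x ∷ xs) []       = x ∷ xs
    addᴸ (x ∷ xs) (y ∷ ys) = x + y ∷ addᴸ xs ys

    mulᴸ : List Carrier → List Carrier → List Carrier
    mulᴸ []       ys = []
    mulᴸ (x ∷ xs) ys = addᴸ (map (x *_) ys) (0# ∷ mulᴸ xs ys)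

    negᴸ : List Carrier → List Carrier
    negᴸ = map (-_)

    coeff : List Carrier → Ser
    coeff []       n       = 0#
    coeff (x ∷ xs) zero    = x
    coeff (x ∷ xs) (suc n) = coeff xs n

    coeff-add : ∀ xs ys → coeff (addᴸ xs ys) ≋ (coeff xs +ₛ coeff ys)
    coeff-add []       ys       n       = sym (+-identityˡ _)
    coeff-add (x ∷ xs) []       n       = sym (+-identityʳ _)
    coeff-add (x ∷ xs) (y ∷ ys) zero    = refl
    coeff-add (x ∷ xs) (y ∷ ys) (suc n) = coeff-add xs ys n

    coeff-scale : ∀ x ys → coeff (map (x *_) ys) ≋ (x · coeff ys)
    coeff-scale x []       n       = sym (zeroʳ x)
    coeff-scale x (y ∷ ys) zero    = refl
    coeff-scale x (y ∷ ys) (suc n) = coeff-scale x ys n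

    coeff-neg : ∀ ys → coeff (negᴸ ys) ≋ (-ₛ coeff ys)
    coeff-neg []       n       = sym (RingProps.-0#≈0# ring)
    coeff-neg (y ∷ ys) zero    = refl
    coeff-neg (y ∷ ys) (suc n) = coeff-neg ys n

    coeff-mul : ∀ xs ys → coeff (mulᴸ xs ys) ≋ (coeff xs *ₛ coeff ys)
    coeff-mul []       ys n       = sym (0*ₛ (coeff ys) n)
    coeff-mul (x ∷ xs) ys zero    = trans (coeff-add (map (x *_) ys) (0# ∷ mulᴸ xs ys) 0)
      (trans (+-identityʳ _) (coeff-scale x ys 0))
    coeff-mul (x ∷ xs) ys (suc n) = trans (coeff-add (map (x *_) ys) (0# ∷ mulᴸ xs ys) (suc n))
      (+-cong (coeff-scale x ys (suc n)) (coeff-mul xs ys n))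

    module Value {S : CommutativeRing c′ ℓ′} (f : R ⟶ S) (X : CommutativeRing.Carrier S) where
      private module S = CommutativeRing S
      open Hom {R = R} {S = S} f
      open SetoidReasoning S.setoid
      open Solver S.commutativeSemiring using (solve; _:=_; _:+_; _:*_)

      value : List Carrier → S.Carrier
      value []       = S.0#
      value (x ∷ xs) = ⟦ x ⟧ S.+ X S.* value xs

      value-add : ∀ xs ys → value (addᴸ xs ys) S.≈ value xs S.+ value ys
      value-add []       ys       = S.sym (S.+-identityˡ _)
      value-add (x ∷ xs) []       = S.sym (S.+-identityʳ _)
      value-add (x ∷ xs) (y ∷ ys) = begin
        ⟦ x + y ⟧ S.+ X S.* value (addᴸ xs ys)
          ≈⟨ S.+-cong (+-homo x y) (S.*-congˡ (value-add xs ys)) ⟩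
        (⟦ x ⟧ S.+ ⟦ y ⟧) S.+ X S.* (value xs S.+ value ys)
          ≈⟨ solve 5 (λ x y X a b → (x :+ y) :+ X :* (a :+ b) := (x :+ X :* a) :+ (y :+ X :* b))
               S.refl ⟦ x ⟧ ⟦ y ⟧ X (value xs) (value ys) ⟩
        (⟦ x ⟧ S.+ X S.* value xs) S.+ (⟦ y ⟧ S.+ X S.* value ys) ∎

      value-scale : ∀ x ys → value (map (x *_) ys) S.≈ ⟦ x ⟧ S.* value ys
      value-scale x []       = S.sym (S.zeroʳ _)
      value-scale x (y ∷ ys) = begin
        ⟦ x * y ⟧ S.+ X S.* value (map (x *_) ys)
          ≈⟨ S.+-cong (*-homo x y) (S.*-congˡ (value-scale x ys)) ⟩
        ⟦ x ⟧ S.* ⟦ y ⟧ S.+ X S.* (⟦ x ⟧ S.* value ys)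
          ≈⟨ solve 4 (λ x y X a → x :* y :+ X :* (x :* a) := x :* (y :+ X :* a))
               S.refl ⟦ x ⟧ ⟦ y ⟧ X (value ys) ⟩
        ⟦ x ⟧ S.* (⟦ y ⟧ S.+ X S.* value ys) ∎

      value-mul : ∀ xs ys → value (mulᴸ xs ys) S.≈ value xs S.* value ys
      value-mul []       ys = S.sym (S.zeroˡ _)
      value-mul (x ∷ xs) ys = begin
        value (addᴸ (map (x *_) ys) (0# ∷ mulᴸ xs ys))
          ≈⟨ value-add (map (x *_) ys) (0# ∷ mulᴸ xs ys) ⟩
        value (map (x *_) ys) S.+ (⟦ 0# ⟧ S.+ X S.* value (mulᴸ xs ys))
          ≈⟨ S.+-cong (value-scale x ys) (S.+-cong 0#-homo (S.*-congˡ (value-mul xs ys))) ⟩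
        ⟦ x ⟧ S.* value ys S.+ (S.0# S.+ X S.* (value xs S.* value ys))
          ≈⟨ S.+-congˡ (S.+-identityˡ _) ⟩
        ⟦ x ⟧ S.* value ys S.+ X S.* (value xs S.* value ys)
          ≈⟨ solve 4 (λ x X a b → x :* b :+ X :* (a :* b) := (x :+ X :* a) :* b)
               S.refl ⟦ x ⟧ X (value xs) (value ys) ⟩
        (⟦ x ⟧ S.+ X S.* value xs) S.* value ys ∎

      value-neg : ∀ ys → value (negᴸ ys) S.≈ S.- value ys
      value-neg ys = SP.+-inverseˡ-unique _ _ (go ys)
        where
        module SP = RingProps S.ring
        go : ∀ ys → value (negᴸ ys) S.+ value ys S.≈ S.0#
        go []       = S.+-identityˡ _
        go (y ∷ ys) = begin
          (⟦ - y ⟧ S.+ X S.* value (negᴸ ys)) S.+ (⟦ y ⟧ S.+ X S.* value ys)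
            ≈⟨ solve 5 (λ x y X a b → (x :+ X :* a) :+ (y :+ X :* b) := (x :+ y) :+ X :* (a :+ b))
                 S.refl ⟦ - y ⟧ ⟦ y ⟧ X (value (negᴸ ys)) (value ys) ⟩
          (⟦ - y ⟧ S.+ ⟦ y ⟧) S.+ X S.* (value (negᴸ ys) S.+ value ys)
            ≈⟨ S.+-cong (S.trans (S.+-congʳ (-‿homo y)) (S.-‿inverseˡ _)) (S.trans (S.*-congˡ (go ys)) (S.zeroʳ X)) ⟩
          S.0# S.+ S.0# ≈⟨ S.+-identityˡ _ ⟩
          S.0# ∎

      value-0 : ∀ xs → coeff xs ≋ 0ₛ → value xs S.≈ S.0#
      value-0 []       p = S.refl
      value-0 (x ∷ xs) p = S.trans
        (S.+-cong (S.trans (⟦⟧-cong (p 0)) 0#-homo) (S.trans (S.*-congˡ (value-0 xs (λ n → p (suc n)))) (S.zeroʳ X)))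
        (S.+-identityˡ _)

  module Step (m n : ℕ) (hyp : n TorsionFree ℤ[ Fin m ]) where
    private
      R = ℤ[ Fin m ]
      S = ℤ[ Fin (suc m) ]
      module S = CommutativeRing S
      module R = CommutativeRing R
    open Series R
    open Lists R
    private
      module PS = CommutativeRing powerSeries
      f : R ⟶ S
      f = eval S (λ i → var (suc i))
    open Value {S = S} f (var zero)
    open SetoidReasoning S.setoid

    norm : Expr (Fin (suc m)) → List (Expr (Fin m))
    norm (var zero)    = 𝟘 ∷ 𝟙 ∷ []
    norm (var (suc i)) = var i ∷ []
    norm 𝟘             = []
    norm 𝟙             = 𝟙 ∷ []
    norm (x ⊕ y)       = addᴸ (norm x) (norm y)
    norm (x ⊗ y)       = mulᴸ (norm x) (norm y)
    norm (⊖ x)         = negᴸ (norm x)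

    coeff-𝟙 : coeff (𝟙 ∷ []) ≋ 1ₛ
    coeff-𝟙 zero    = ~refl
    coeff-𝟙 (suc n) = ~refl

    ρ : Fin (suc m) → Ser
    ρ i = coeff (norm (var i))

    coeff-norm : ∀ x → coeff (norm x) ≋ evalAt powerSeries ρ x
    coeff-norm (var i) n = ~refl
    coeff-norm 𝟘       n = ~refl
    coeff-norm 𝟙       n = coeff-𝟙 n
    coeff-norm (x ⊕ y) n = ~trans (coeff-add (norm x) (norm y) n) (⊕-cong (coeff-norm x n) (coeff-norm y n))
    coeff-norm (x ⊗ y) n = ~trans (coeff-mul (norm x) (norm y) n) (*ₛ-cong (coeff-norm x) (coeff-norm y) n)
    coeff-norm (⊖ x)   n = ~trans (coeff-neg (norm x) n) (⊖-cong (coeff-norm x n))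

    value-norm : ∀ x → value (norm x) ~ x
    value-norm (var zero)    = begin
      𝟘 ⊕ var zero ⊗ (𝟙 ⊕ var zero ⊗ 𝟘) ≈⟨ S.+-identityˡ _ ⟩
      var zero ⊗ (𝟙 ⊕ var zero ⊗ 𝟘)     ≈⟨ S.*-congˡ (S.trans (S.+-congˡ (S.zeroʳ _)) (S.+-identityʳ _)) ⟩
      var zero ⊗ 𝟙                       ≈⟨ S.*-identityʳ _ ⟩
      var zero ∎
    value-norm (var (suc i)) = S.trans (S.+-congˡ (S.zeroʳ _)) (S.+-identityʳ _)
    value-norm 𝟘             = S.refl
    value-norm 𝟙             = S.trans (S.+-congˡ (S.zeroʳ _)) (S.+-identityʳ _)
    value-norm (x ⊕ y)       = S.trans (value-add (norm x) (norm y)) (S.+-cong (value-norm x) (value-norm y))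
    value-norm (x ⊗ y)       = S.trans (value-mul (norm x) (norm y)) (S.*-cong (value-norm x) (value-norm y))
    value-norm (⊖ x)         = S.trans (value-neg (norm x)) (S.-‿cong (value-norm x))

    open Mult PS.semiring using () renaming (_×_ to infixr 8 _×ᵖ_)
    open Mult R.semiring using () renaming (_×_ to infixr 8 _×ʳ_)

    ×ᵖ-coeff : ∀ k f i → (k ×ᵖ f) i ≡ k ×ʳ f i
    ×ᵖ-coeff zero    f i = ≡.refl
    ×ᵖ-coeff (suc k) f i = ≡.cong (f i ⊕_) (×ᵖ-coeff k f i)

    torsionFree-suc : n TorsionFree S
    torsionFree-suc x nx~0 = S.trans (S.sym (value-norm x)) (value-0 (norm x) λ i →
      R.trans (coeff-norm x i) (hyp (g i) (R.trans (R.reflexive (≡.sym (×ᵖ-coeff n g i)))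
        (R.trans (R.sym (Hom.×-homo {R = S} {S = powerSeries} (eval powerSeries ρ) n x i))
          (evalAt-~ powerSeries ρ nx~0 i)))))
      where g = evalAt powerSeries ρ x

  torsionFree-Fin : ∀ n m → suc n TorsionFree ℤ[ Fin m ]
  torsionFree-Fin n zero    = torsionFree-0 n
  torsionFree-Fin n (suc m) = Step.torsionFree-suc m (suc n) (torsionFree-Fin n m)

  bound : Expr ℕ → ℕ
  bound (var i) = suc i
  bound 𝟘       = 0
  bound 𝟙       = 0
  bound (x ⊕ y) = bound x ℕ.⊔ bound y
  bound (x ⊗ y) = bound x ℕ.⊔ bound y
  bound (⊖ x)   = bound x

  evalAt-bound : ∀ m (ρ : ℕ → Expr ℕ) → (∀ i → i ℕ.< m → ρ i ~ var i) →
                 ∀ x → bound x ℕ.≤ m → evalAt ℤ[ ℕ ] ρ x ~ x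
  evalAt-bound m ρ h (var i) p = h i p
  evalAt-bound m ρ h 𝟘       p = ~refl
  evalAt-bound m ρ h 𝟙       p = ~refl
  evalAt-bound m ρ h (x ⊕ y) p = ⊕-cong (evalAt-bound m ρ h x (ℕₚ.m⊔n≤o⇒m≤o _ _ p))
                                        (evalAt-bound m ρ h y (ℕₚ.m⊔n≤o⇒n≤o _ _ p))
  evalAt-bound m ρ h (x ⊗ y) p = ⊗-cong (evalAt-bound m ρ h x (ℕₚ.m⊔n≤o⇒m≤o _ _ p))
                                        (evalAt-bound m ρ h y (ℕₚ.m⊔n≤o⇒n≤o _ _ p))
  evalAt-bound m ρ h (⊖ x)   p = ⊖-cong (evalAt-bound m ρ h x p)

  torsionFree-ℕ : ∀ n → suc n TorsionFree ℤ[ ℕ ]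
  torsionFree-ℕ n x nx~0 = ~trans (~sym (evalAt-bound N _ back-in x ℕₚ.≤-refl))
    (~trans (~sym (hom-eval {A = ℤ[ Fin N ]} {B = ℤ[ ℕ ]} back into x))
      (evalAt-~ ℤ[ ℕ ] _ (torsionFree-Fin n N (evalAt ℤ[ Fin N ] into x)
        (~trans (~sym (Hom.×-homo {R = ℤ[ ℕ ]} {S = ℤ[ Fin N ]} (eval ℤ[ Fin N ] into) (suc n) x))
          (evalAt-~ ℤ[ Fin N ] into nx~0)))))
    where
    N = bound x
    into : ℕ → Expr (Fin N)
    into i with i ℕₚ.<? N
    ... | yes i<m = var (Fin.fromℕ< i<m)
    ... | no  _   = 𝟘
    back = eval ℤ[ ℕ ] (λ (i : Fin N) → var (Fin.toℕ i))
    back-in : ∀ i → i ℕ.< N → RingHomomorphism.⟦_⟧ back (into i) ~ var i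
    back-in i i<m with i ℕₚ.<? N
    ... | yes i<m′ = CommutativeRing.reflexive ℤ[ ℕ ] (≡.cong var (Finₚ.toℕ-fromℕ< i<m′))
    ... | no  i≮m  = contradiction i<m i≮m


prime∤! : ∀ {p} → Prime p → ∀ k → k ℕ.< p → ¬ p ∣ k !
prime∤! pr zero    k<p p∣1 = ℕₚ.<⇒≱ (ℕ.nonTrivial⇒n>1 _ ⦃ prime⇒nonTrivial pr ⦄) (∣⇒≤ p∣1)
prime∤! pr (suc k) k<p d with euclidsLemma (suc k) (k !) pr d
... | inj₁ e = ℕₚ.<⇒≱ k<p (∣⇒≤ e)
... | inj₂ e = prime∤! pr k (ℕₚ.<-trans (ℕₚ.n<1+n k) k<p) e

prime∣C : ∀ {p} → Prime (suc p) → ∀ k → k ℕ.< p → suc p ∣ suc p C suc k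
prime∣C {p} pr k k<p with euclidsLemma (suc p C suc k) (suc k ! ℕ.* (p ℕ.∸ k) !) pr
                            (≡.subst (suc p ∣_) (≡.sym e) (m∣m*n (p !)))
  where
  k≤p : suc k ℕ.≤ suc p
  k≤p = s≤s (ℕₚ.<⇒≤ k<p)
  instance _ = (suc k) ℕₚ.!* (p ℕ.∸ k) !≢0
  e : (suc p C suc k) ℕ.* (suc k ! ℕ.* (p ℕ.∸ k) !) ≡ suc p !
  e = ≡.trans (≡.cong (ℕ._* (suc k ! ℕ.* (p ℕ.∸ k) !)) (nCk≡n!/k![n-k]! k≤p))
        (DivMod.m/n*n≡m (k![n∸k]!∣n! k≤p))
... | inj₁ d = d
... | inj₂ d with euclidsLemma (suc k !) ((p ℕ.∸ k) !) pr d
...   | inj₁ d′ = contradiction d′ (prime∤! pr (suc k) (s≤s k<p))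
...   | inj₂ d′ = contradiction d′ (prime∤! pr (p ℕ.∸ k) (s≤s (ℕₚ.m∸n≤m p k)))

module Frobenius (R : CommutativeRing c ℓ) where
  open CommutativeRing R hiding (zero)
  open SetoidReasoning setoid
  open Mult semiring using (×-assoc-*; ×-assocˡ; ×-congˡ; ×-congʳ; ×-homo-1) renaming (_×_ to infixr 8 _×_)
  open Exp semiring using (_^_; ^-congˡ)
  open Sum semiring using (sum; sum-init-last; *-distribˡ-sum; sum-cong-≋)
  open Binomial commutativeSemiring using (theorem; binomialTerm)

  freshman : ∀ {p} → Prime p → ∀ x y →
             ∃ λ r → (x + y) ^ p ≈ (x ^ p + y ^ p) + (p × 1#) * (y * r)
  freshman {p = zero}  pr x y = contradiction (ℕ.nonTrivial⇒n>1 _ ⦃ prime⇒nonTrivial pr ⦄) λ ()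
  freshman {p = suc p} pr x y = sum rs , (begin
    (x + y) ^ suc p ≈⟨ theorem (suc p) x y ⟩
    t zero + sum (λ i → t (suc i)) ≈⟨ +-congˡ (sum-init-last (λ i → t (suc i))) ⟩
    t zero + (sum (λ i → t (suc (Fin.inject₁ i))) + t (suc (Fin.fromℕ p)))
      ≈⟨ +-cong first (+-cong middle last) ⟩
    y ^ suc p + ((suc p × 1#) * (y * sum rs) + x ^ suc p) ≈⟨ +-congˡ (+-comm _ _) ⟩
    y ^ suc p + (x ^ suc p + (suc p × 1#) * (y * sum rs)) ≈⟨ sym (+-assoc _ _ _) ⟩
    (y ^ suc p + x ^ suc p) + (suc p × 1#) * (y * sum rs) ≈⟨ +-congʳ (+-comm _ _) ⟩
    (x ^ suc p + y ^ suc p) + (suc p × 1#) * (y * sum rs) ∎)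
    where
    t = binomialTerm x y (suc p)
    first : t zero ≈ y ^ suc p
    first = trans (×-congˡ {x = 1# * y ^ suc p} {suc p C 0} {1} ≡.refl)
              (trans (×-homo-1 _) (*-identityˡ _))
    last : t (suc (Fin.fromℕ p)) ≈ x ^ suc p
    last = begin
      t (suc (Fin.fromℕ p)) ≡⟨ ≡.cong (λ k → (suc p C suc k) × (x ^ suc k * y ^ (p ℕ.∸ k))) (Finₚ.toℕ-fromℕ p) ⟩
      (suc p C suc p) × (x ^ suc p * y ^ (p ℕ.∸ p)) ≡⟨ ≡.cong₂ (λ m k → m × (x ^ suc p * y ^ k)) (nCn≡1 (suc p)) (ℕₚ.n∸n≡0 p) ⟩
      1 × (x ^ suc p * 1#) ≈⟨ ×-homo-1 _ ⟩
      x ^ suc p * 1# ≈⟨ *-identityʳ _ ⟩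
      x ^ suc p ∎
    quot : ∀ k → k ℕ.< p → ℕ
    quot k k<p with prime∣C pr k k<p
    ... | divides q _ = q
    quot-eq : ∀ k k<p → suc p C suc k ≡ suc p ℕ.* quot k k<p
    quot-eq k k<p with prime∣C pr k k<p
    ... | divides q e = ≡.trans e (ℕₚ.*-comm q (suc p))
    rs : Fin p → Carrier
    rs i = quot (toℕ i) (Finₚ.toℕ<n i) × (x ^ suc (toℕ i) * y ^ (p ℕ.∸ suc (toℕ i)))
    term : ∀ k (k<p : k ℕ.< p) → (suc p C suc k) × (x ^ suc k * y ^ (p ℕ.∸ k)) ≈
           (suc p × 1#) * (y * (quot k k<p × (x ^ suc k * y ^ (p ℕ.∸ suc k))))
    term k k<p = begin
      (suc p C suc k) × (x ^ suc k * y ^ (p ℕ.∸ k))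
        ≡⟨ ≡.cong₂ (λ m n → m × (x ^ suc k * y ^ n)) (quot-eq k k<p) (ℕₚ.+-∸-assoc 1 k<p) ⟩
      (suc p ℕ.* q) × (x ^ suc k * (y * b)) ≈⟨ sym (×-assocˡ _ (suc p) q) ⟩
      suc p × (q × (x ^ suc k * (y * b))) ≈⟨ ×-congʳ (suc p) (begin
         q × (x ^ suc k * (y * b)) ≈⟨ ×-congʳ q (trans (sym (*-assoc _ _ _)) (trans (*-congʳ (*-comm _ _)) (trans (*-assoc _ _ _) (*-comm _ _)))) ⟩
         q × ((x ^ suc k * b) * y) ≈⟨ sym (×-assoc-* q _ _) ⟩
         (q × (x ^ suc k * b)) * y ≈⟨ *-comm _ _ ⟩
         y * (q × (x ^ suc k * b)) ∎) ⟩
      suc p × (y * (q × (x ^ suc k * b))) ≈⟨ ×-congʳ (suc p) (sym (*-identityˡ _)) ⟩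
      suc p × (1# * (y * (q × (x ^ suc k * b)))) ≈⟨ sym (×-assoc-* (suc p) _ _) ⟩
      (suc p × 1#) * (y * (q × (x ^ suc k * b))) ∎
      where
      q = quot k k<p
      b = y ^ (p ℕ.∸ suc k)
    middle : sum (λ i → t (suc (Fin.inject₁ i))) ≈ (suc p × 1#) * (y * sum rs)
    middle = begin
      sum (λ i → t (suc (Fin.inject₁ i)))
        ≈⟨ sum-cong-≋ (λ i → trans
             (reflexive (≡.cong (λ k → (suc p C suc k) × (x ^ suc k * y ^ (p ℕ.∸ k))) (Finₚ.toℕ-inject₁ i)))
             (term (toℕ i) (Finₚ.toℕ<n i))) ⟩
      sum (λ i → (suc p × 1#) * (y * rs i)) ≈⟨ sym (*-distribˡ-sum (suc p × 1#) (λ i → y * rs i)) ⟩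
      (suc p × 1#) * sum (λ i → y * rs i) ≈⟨ *-congˡ (sym (*-distribˡ-sum y rs)) ⟩
      (suc p × 1#) * (y * sum rs) ∎


prime≥2 : ∀ {p} → Prime p → ∃ λ m → p ≡ suc (suc m)
prime≥2 {p} pr with p | ℕ.nonTrivial⇒n>1 p ⦃ prime⇒nonTrivial pr ⦄
... | suc (suc m) | _ = m , ≡.refl
... | suc zero    | s≤s ()

module Congruence {p : ℕ} (p-prime : Prime p) (R : CommutativeRing c ℓ) where
  open CommutativeRing R hiding (zero)
  open SetoidReasoning setoid
  open Mult semiring using (×-assoc-*; ×-congʳ) renaming (_×_ to infixr 8 _×_)
  open Exp semiring using (_^_; ^-congˡ; ^-congʳ; ^-assocʳ; ^-homo-*)
  open CommExp commutativeSemiring using (^-distrib-*)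
  open Solver commutativeSemiring using (solve; _:=_; _:+_; _:*_)
  open Frobenius R using (freshman)

  π : Carrier
  π = p × 1#

  ×≈π* : ∀ x → p × x ≈ π * x
  ×≈π* x = trans (×-congʳ p (sym (*-identityˡ x))) (sym (×-assoc-* p 1# x))

  infix 4 _≡_mod^_

  _≡_mod^_ : Carrier → Carrier → ℕ → Set (c ⊔ ℓ)
  x ≡ y mod^ n = ∃ λ q → x ≈ y + π ^ n * q

  ≈⇒≡ : ∀ {n x y} → x ≈ y → x ≡ y mod^ n
  ≈⇒≡ e = 0# , trans e (sym (trans (+-congˡ (zeroʳ _)) (+-identityʳ _)))

  ≡-sym : ∀ {n x y} → x ≡ y mod^ n → y ≡ x mod^ n
  ≡-sym {n} {x} {y} (q , e) = - q , (begin
    y                              ≈⟨ sym (+-identityʳ y) ⟩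
    y + 0#                         ≈⟨ +-congˡ (sym (zeroʳ (π ^ n))) ⟩
    y + π ^ n * 0#                 ≈⟨ +-congˡ (*-congˡ (sym (-‿inverseʳ q))) ⟩
    y + π ^ n * (q + - q)          ≈⟨ solve 4 (λ y P q q′ → y :+ P :* (q :+ q′) := (y :+ P :* q) :+ P :* q′) refl y (π ^ n) q (- q) ⟩
    (y + π ^ n * q) + π ^ n * - q  ≈⟨ +-congʳ (sym e) ⟩
    x + π ^ n * - q ∎)

  ≡-trans : ∀ {n x y z} → x ≡ y mod^ n → y ≡ z mod^ n → x ≡ z mod^ n
  ≡-trans {n} (q , e) (q′ , e′) = q′ + q , trans e (trans (+-congʳ e′)
    (trans (+-assoc _ _ _) (+-congˡ (sym (distribˡ _ _ _)))))

  ≡-+ : ∀ {n x x′ y y′} → x ≡ x′ mod^ n → y ≡ y′ mod^ n → (x + y) ≡ (x′ + y′) mod^ n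
  ≡-+ {n} (q , e) (q′ , e′) = q + q′ , trans (+-cong e e′)
    (solve 5 (λ x y P a b → (x :+ P :* a) :+ (y :+ P :* b) := (x :+ y) :+ P :* (a :+ b)) refl _ _ (π ^ n) q q′)

  ≡-* : ∀ {n x x′ y y′} → x ≡ x′ mod^ n → y ≡ y′ mod^ n → (x * y) ≡ (x′ * y′) mod^ n
  ≡-* {n} {x} {x′} {y} {y′} (q , e) (q′ , e′) = x′ * q′ + q * y′ + q * (π ^ n * q′) , trans (*-cong e e′)
    (solve 5 (λ x y P a b → (x :+ P :* a) :* (y :+ P :* b) := (x :* y) :+ P :* (x :* b :+ a :* y :+ a :* (P :* b)))
      refl x′ y′ (π ^ n) q q′)

  ≡-neg : ∀ {n x x′} → x ≡ x′ mod^ n → (- x) ≡ (- x′) mod^ n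
  ≡-neg {n} {x} {x′} (q , e) = - q , (begin
    - x                     ≈⟨ -‿cong e ⟩
    - (x′ + π ^ n * q)      ≈⟨ sym (RP.-‿+-comm _ _) ⟩
    - x′ + - (π ^ n * q)    ≈⟨ +-congˡ (RP.-‿distribʳ-* _ _) ⟩
    - x′ + π ^ n * - q ∎)
    where module RP = RingProps ring

  ≡-π* : ∀ {n x y} → x ≡ y mod^ n → (π * x) ≡ (π * y) mod^ (suc n)
  ≡-π* {n} (q , e) = q , trans (*-congˡ e) (trans (distribˡ _ _ _) (+-congˡ (sym (*-assoc _ _ _))))

  ≡-^p : ∀ {n x y} → x ≡ y mod^ (suc n) → (x ^ p) ≡ (y ^ p) mod^ (suc (suc n))
  ≡-^p {n} {x} {y} (q , e) with freshman p-prime y (π ^ suc n * q) | prime≥2 p-prime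
  ... | r , f | m , p≡ = P * q * q * z ^ m + q * r , (begin
    x ^ p                                       ≈⟨ ^-congˡ p e ⟩
    (y + z) ^ p                                 ≈⟨ f ⟩
    y ^ p + z ^ p + π * (z * r)                 ≈⟨ +-congʳ (+-congˡ (^-congʳ z p≡)) ⟩
    y ^ p + z * (z * z ^ m) + π * (z * r)       ≡⟨⟩
    y ^ p + π * P * q * (π * P * q * z ^ m) + π * (π * P * q * r)
      ≈⟨ solve 6 (λ Y π P q Z r → Y :+ π :* P :* q :* (π :* P :* q :* Z) :+ π :* (π :* P :* q :* r)
                   := Y :+ π :* (π :* P) :* (P :* q :* q :* Z :+ q :* r)) refl (y ^ p) π P q (z ^ m) r ⟩
    y ^ p + π * (π * P) * (P * q * q * z ^ m + q * r) ∎)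
    where
    P = π ^ n
    z = π ^ suc n * q

  ^-p^suc : ∀ x n → x ^ (p ℕ.^ suc n) ≈ (x ^ (p ℕ.^ n)) ^ p
  ^-p^suc x n = trans (^-congʳ x (ℕₚ.*-comm p (p ℕ.^ n))) (sym (^-assocʳ x (p ℕ.^ n) p))

  ^p-^ : ∀ x n → (x ^ p) ^ (p ℕ.^ n) ≈ x ^ (p ℕ.^ suc n)
  ^p-^ x n = ^-assocʳ x p (p ℕ.^ n)

  ≡-^p^ : ∀ {x y} → x ≡ y mod^ 1 → ∀ n → (x ^ (p ℕ.^ n)) ≡ (y ^ (p ℕ.^ n)) mod^ (suc n)
  ≡-^p^ {x} {y} h zero    = ≡-trans {1} (≈⇒≡ {1} (*-identityʳ x)) (≡-trans {1} h (≈⇒≡ {1} (sym (*-identityʳ y))))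
  ≡-^p^ {x} {y} h (suc n) = ≡-trans {suc (suc n)} (≈⇒≡ {suc (suc n)} (^-p^suc x n))
    (≡-trans {suc (suc n)} (≡-^p {n} (≡-^p^ h n)) (≈⇒≡ {suc (suc n)} (sym (^-p^suc y n))))

  0^p^ : ∀ n → 0# ^ (p ℕ.^ n) ≈ 0#
  0^p^ n with p ℕ.^ n | ℕₚ.m^n>0 p ⦃ prime⇒nonZero p-prime ⦄ n
  ... | suc m | _ = zeroˡ _

  1^ : ∀ n → 1# ^ n ≈ 1#
  1^ zero    = refl
  1^ (suc n) = trans (*-identityˡ _) (1^ n)

  0^p : 0# ^ p ≈ 0#
  0^p = trans (^-congʳ 0# (≡.sym (ℕₚ.*-identityʳ p))) (0^p^ 1)

module Ghost {p : ℕ} (p-prime : Prime p) (A : CommutativeRing c ℓ) where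
  open CommutativeRing A hiding (zero)
  open SetoidReasoning setoid
  open Congruence p-prime A
  open Mult semiring using (×-congʳ) renaming (_×_ to infixr 8 _×_)
  open Exp semiring using (_^_; ^-congˡ)
  open Series A using (Ser; _≋_; tail)

  -- w_n(x) = Σ_{i ≤ n} p^i x_i^(p^(n-i))
  ghost : ℕ → Ser → Carrier
  ghost zero    x = x 0
  ghost (suc n) x = x 0 ^ (p ℕ.^ suc n) + p × ghost n (tail x)

  pow : Ser → Ser
  pow x i = x i ^ p

  ghost-cong-≤ : ∀ n {x y} → (∀ i → i ℕ.≤ n → x i ≈ y i) → ghost n x ≈ ghost n y
  ghost-cong-≤ zero    h = h 0 z≤n
  ghost-cong-≤ (suc n) h = +-cong (^-congˡ (p ℕ.^ suc n) (h 0 z≤n))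
    (×-congʳ p (ghost-cong-≤ n (λ i i≤n → h (suc i) (s≤s i≤n))))

  ghost-cong : ∀ n {x y} → x ≋ y → ghost n x ≈ ghost n y
  ghost-cong n h = ghost-cong-≤ n (λ i _ → h i)

  ghost-suc : ∀ n x → ghost (suc n) x ≈ ghost n (pow x) + π ^ suc n * x (suc n)
  ghost-suc zero x = +-cong (trans (sym (^p-^ (x 0) 0)) (*-identityʳ _))
    (trans (×≈π* (x 1)) (*-congʳ (sym (*-identityʳ π))))
  ghost-suc (suc n) x = begin
    x 0 ^ (p ℕ.^ suc (suc n)) + p × ghost (suc n) (tail x)
      ≈⟨ +-cong (sym (^p-^ (x 0) (suc n))) (×-congʳ p (ghost-suc n (tail x))) ⟩
    pow x 0 ^ (p ℕ.^ suc n) + p × (g + P * x (suc (suc n)))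
      ≈⟨ +-congˡ (trans (×≈π* _) (distribˡ π _ _)) ⟩
    pow x 0 ^ (p ℕ.^ suc n) + (π * g + π * (P * x (suc (suc n))))
      ≈⟨ sym (+-assoc _ _ _) ⟩
    (pow x 0 ^ (p ℕ.^ suc n) + π * g) + π * (P * x (suc (suc n)))
      ≈⟨ +-cong (+-congˡ (sym (×≈π* g))) (sym (*-assoc π _ _)) ⟩
    (pow x 0 ^ (p ℕ.^ suc n) + p × g) + π * P * x (suc (suc n)) ∎
    where
    g = ghost n (pow (tail x))
    P = π ^ suc n

  ghost-≡ : ∀ n {x y} → (∀ i → x i ≡ y i mod^ 1) → ghost n x ≡ ghost n y mod^ (suc n)
  ghost-≡ zero    h = h 0
  ghost-≡ (suc n) {x} {y} h = ≡-+ {suc (suc n)} (≡-^p^ (h 0) (suc n))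
    (≡-trans {suc (suc n)} (≈⇒≡ {suc (suc n)} (×≈π* _))
      (≡-trans {suc (suc n)} (≡-π* {suc n} (ghost-≡ n (λ i → h (suc i))))
        (≈⇒≡ {suc (suc n)} (sym (×≈π* _)))))

  ghost-0 : ∀ n → ghost n (λ _ → 0#) ≈ 0#
  ghost-0 zero    = refl
  ghost-0 (suc n) = trans (+-cong (0^p^ (suc n)) (trans (×-congʳ p (ghost-0 n)) (trans (×≈π* 0#) (zeroʳ π))))
    (+-identityˡ 0#)

ghost-hom : ∀ {p} (p-prime : Prime p) {A : CommutativeRing c ℓ} {B : CommutativeRing c′ ℓ′} (f : A ⟶ B) n x →
            let open CommutativeRing B using (_≈_)
                open RingHomomorphism f using (⟦_⟧) in
            ⟦ Ghost.ghost p-prime A n x ⟧ ≈ Ghost.ghost p-prime B n (λ i → ⟦ x i ⟧)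
ghost-hom {p = p} p-prime {A} {B} f = go
  where
  open CommutativeRing B hiding (zero)
  open Hom {R = A} {S = B} f
  open Mult semiring using (×-congʳ)
  go : ∀ n x → ⟦ Ghost.ghost p-prime A n x ⟧ ≈ Ghost.ghost p-prime B n (λ i → ⟦ x i ⟧)
  go zero    x = refl
  go (suc n) x = trans (+-homo _ _) (+-cong (^-homo (x 0) (p ℕ.^ suc n))
    (trans (×-homo p _) (×-congʳ p (go n (λ i → x (suc i))))))

-- Every sequence of ghost components g with φ(g n) ≡ g (n+1) mod p^(n+1), where φ is the
-- endomorphism v ↦ v^p lifting Frobenius, comes from a sequence of Witt components.

module Dwork {p : ℕ} (p-prime : Prime p) (V : Set) where
  open Polynomial
  private
    F = ℤ[ V ]
  open CommutativeRing F hiding (zero)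
  open SetoidReasoning setoid
  open Congruence p-prime F
  open Frobenius F using (freshman)
  open Ghost p-prime F
  open Series F using (Ser; _≋_)
  open Exp semiring using (_^_; ^-congˡ)
  open CommExp commutativeSemiring using (^-distrib-*)

  φ : F ⟶ F
  φ = eval F (λ v → var v ^ p)

  open Hom {R = F} {S = F} φ using (⟦_⟧; ⟦⟧-cong; +-homo; *-homo; -‿homo)

  private
    freshman-≡ : ∀ x y → ((x + y) ^ p) ≡ (x ^ p + y ^ p) mod^ 1
    freshman-≡ x y with freshman p-prime x y
    ... | r , e = y * r , trans e (+-congˡ (*-congʳ (sym (*-identityʳ π))))

  φ-≡ : ∀ x → ⟦ x ⟧ ≡ (x ^ p) mod^ 1
  φ-≡ (var v) = ≈⇒≡ {1} refl
  φ-≡ 𝟘       = ≈⇒≡ {1} (sym 0^p)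
  φ-≡ 𝟙       = ≈⇒≡ {1} (sym (1^ p))
  φ-≡ (x ⊕ y) = ≡-trans {1} (≡-+ {1} (φ-≡ x) (φ-≡ y)) (≡-sym {1} (freshman-≡ x y))
  φ-≡ (x ⊗ y) = ≡-trans {1} (≡-* {1} (φ-≡ x) (φ-≡ y)) (≈⇒≡ {1} (sym (^-distrib-* x y p)))
  φ-≡ (⊖ x)   = ≡-trans {1} (≡-neg {1} (φ-≡ x)) (≡-trans {1} (≈⇒≡ {1} lhs) (≡-trans {1} shift (≈⇒≡ {1} rhs)))
    where
    -- −x^p = −x^p + (x + −x)^p ≡ −x^p + (x^p + (−x)^p) = (−x)^p
    lhs : - (x ^ p) ≈ - (x ^ p) + (x + - x) ^ p
    lhs = sym (trans (+-congˡ (trans (^-congˡ p (-‿inverseʳ x)) 0^p)) (+-identityʳ _))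
    shift : (- (x ^ p) + (x + - x) ^ p) ≡ (- (x ^ p) + (x ^ p + (- x) ^ p)) mod^ 1
    shift = ≡-+ {1} (≈⇒≡ {1} refl) (freshman-≡ x (- x))
    rhs : - (x ^ p) + (x ^ p + (- x) ^ p) ≈ (- x) ^ p
    rhs = trans (sym (+-assoc _ _ _)) (trans (+-congʳ (-‿inverseˡ _)) (+-identityˡ _))

  IsDwork : Ser → Set
  IsDwork g = ∀ n → ⟦ g n ⟧ ≡ g (suc n) mod^ (suc n)

  dwork-var : (X : ℕ → V) → IsDwork (λ n → ghost n (λ i → var (X i)))
  dwork-var X n = ≡-trans {suc n} (≈⇒≡ {suc n} (ghost-hom p-prime {A = F} {B = F} φ n x))
    (≡-sym {suc n} (x (suc n) , ghost-suc n x))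
    where
    x : Ser
    x i = var (X i)

  dwork-+ : ∀ g h → IsDwork g → IsDwork h → IsDwork (λ n → g n + h n)
  dwork-+ g h p q n = ≡-+ {suc n} (p n) (q n)

  dwork-* : ∀ g h → IsDwork g → IsDwork h → IsDwork (λ n → g n * h n)
  dwork-* g h p q n = ≡-* {suc n} (p n) (q n)

  dwork-neg : ∀ g → IsDwork g → IsDwork (λ n → - g n)
  dwork-neg g p n = ≡-neg {suc n} (p n)

  module Solve (g : Ser) (dwork : IsDwork g) where

    next : ∀ n y → ghost n y ≈ g n → ∃ λ q → g (suc n) ≈ ghost n (pow y) + π ^ suc n * q
    next n y e = ≡-trans {suc n} (≡-sym {suc n} (dwork n))
      (≡-trans {suc n} (≈⇒≡ {suc n} (trans (⟦⟧-cong (sym e)) (ghost-hom p-prime {A = F} {B = F} φ n y)))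
        (ghost-≡ n (λ i → φ-≡ (y i))))

    extend : ℕ → Ser → Carrier → Ser
    extend n y q i with i ℕₚ.≤? n
    ... | yes _ = y i
    ... | no  _ = q

    extend-≤ : ∀ n y q i → i ℕ.≤ n → extend n y q i ≡ y i
    extend-≤ n y q i i≤n with i ℕₚ.≤? n
    ... | yes _   = ≡.refl
    ... | no  i≰n = contradiction i≤n i≰n

    extend-suc : ∀ n y q → extend n y q (suc n) ≡ q
    extend-suc n y q with suc n ℕₚ.≤? n
    ... | yes n<n = contradiction n<n (ℕₚ.<-irrefl ≡.refl)
    ... | no  _   = ≡.refl

    stage : ∀ n → ∃ λ y → ghost n y ≈ g n

    digit : ℕ → Carrier
    digit n = proj₁ (next n (proj₁ (stage n)) (proj₂ (stage n)))

    stage zero    = (λ _ → g 0) , refl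
    stage (suc n) = extend n (proj₁ (stage n)) (digit n) , (begin
      ghost (suc n) y′                        ≈⟨ ghost-suc n y′ ⟩
      ghost n (pow y′) + π ^ suc n * y′ (suc n)
        ≈⟨ +-cong (ghost-cong-≤ n (λ i i≤n → ^-congˡ p (reflexive (extend-≤ n y (digit n) i i≤n))))
                  (*-congˡ (reflexive (extend-suc n y (digit n)))) ⟩
      ghost n (pow y) + π ^ suc n * digit n   ≈⟨ sym (proj₂ (next n y (proj₂ (stage n)))) ⟩
      g (suc n) ∎)
      where
      y = proj₁ (stage n)
      y′ = extend n y (digit n)

    solution : Ser
    solution n = proj₁ (stage n) n

    stage-suc : ∀ n i → i ℕ.≤ n → proj₁ (stage (suc n)) i ≡ proj₁ (stage n) i
    stage-suc n i i≤n = extend-≤ n (proj₁ (stage n)) (digit n) i i≤n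

    stage-≤ : ∀ n i → i ℕ.≤ n → solution i ≡ proj₁ (stage n) i
    stage-≤ n i i≤n with ℕₚ.m≤n⇒m<n∨m≡n i≤n
    ... | inj₂ ≡.refl = ≡.refl
    stage-≤ (suc n) i i≤n | inj₁ (s≤s i≤n′) = ≡.trans (stage-≤ n i i≤n′) (≡.sym (stage-suc n i i≤n′))

    ghost-solution : ∀ n → ghost n solution ≈ g n
    ghost-solution n = trans (ghost-cong-≤ n (λ i i≤n → reflexive (stage-≤ n i i≤n))) (proj₂ (stage n))


-- The universal polynomials giving the ring operations on p-typical Witt vectors; they are
-- characterised by the ghost components being ring homomorphisms.

module WittPolynomials {p : ℕ} (p-prime : Prime p) where
  open Polynomial

  ghostℤ : ∀ {V} → ℕ → (ℕ → Expr V) → Expr V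
  ghostℤ {V} = Ghost.ghost p-prime ℤ[ V ]

  X Y : ℕ → Expr (ℕ ⊎ ℕ)
  X i = var (inj₁ i)
  Y i = var (inj₂ i)

  private
    module D = Dwork p-prime (ℕ ⊎ ℕ)
    module D₁ = Dwork p-prime ℕ
    module S+ = D.Solve (λ n → ghostℤ n X ⊕ ghostℤ n Y)
      (D.dwork-+ (λ n → ghostℤ n X) (λ n → ghostℤ n Y) (D.dwork-var inj₁) (D.dwork-var inj₂))
    module S* = D.Solve (λ n → ghostℤ n X ⊗ ghostℤ n Y)
      (D.dwork-* (λ n → ghostℤ n X) (λ n → ghostℤ n Y) (D.dwork-var inj₁) (D.dwork-var inj₂))
    module S- = D₁.Solve (λ n → ⊖ ghostℤ n var) (D₁.dwork-neg (λ n → ghostℤ n var) (D₁.dwork-var (λ i → i)))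

  sumPoly prodPoly : ℕ → Expr (ℕ ⊎ ℕ)
  sumPoly  = S+.solution
  prodPoly = S*.solution

  negPoly : ℕ → Expr ℕ
  negPoly = S-.solution

  ghost-sumPoly : ∀ n → ghostℤ n sumPoly ~ ghostℤ n X ⊕ ghostℤ n Y
  ghost-sumPoly = S+.ghost-solution

  ghost-prodPoly : ∀ n → ghostℤ n prodPoly ~ ghostℤ n X ⊗ ghostℤ n Y
  ghost-prodPoly = S*.ghost-solution

  ghost-negPoly : ∀ n → ghostℤ n negPoly ~ ⊖ ghostℤ n var
  ghost-negPoly = S-.ghost-solution

module Witt {p : ℕ} (p-prime : Prime p) where
  open Polynomial
  open WittPolynomials p-prime

  wittRaw : CommutativeRing c ℓ → RawRing c ℓ
  wittRaw A = record
    { Carrier = ℕ → Carrier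
    ; _≈_ = λ x y → ∀ n → x n ≈ y n
    ; _+_ = λ x y n → evalAt A [ x , y ]′ (sumPoly n)
    ; _*_ = λ x y n → evalAt A [ x , y ]′ (prodPoly n)
    ; -_  = λ x n → evalAt A x (negPoly n)
    ; 0#  = λ n → 0#
    ; 1#  = one
    }
    where
    open CommutativeRing A using (Carrier; _≈_; 0#; 1#)
    one : ℕ → Carrier
    one zero    = 1#
    one (suc n) = 0#

  module _ (A : CommutativeRing c ℓ) where
    open CommutativeRing A hiding (zero)
    private module W = RawRing (wittRaw A)
    open Ghost p-prime A
    open Mult semiring using (×-congʳ)

    private
      pair-cong : {x x′ y y′ : W.Carrier} → x W.≈ x′ → y W.≈ y′ → ∀ v → [ x , y ]′ v ≈ [ x′ , y′ ]′ v
      pair-cong h k (inj₁ i) = h i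
      pair-cong h k (inj₂ i) = k i

    witt-+-cong : ∀ {x x′ y y′} → x W.≈ x′ → y W.≈ y′ → (x W.+ y) W.≈ (x′ W.+ y′)
    witt-+-cong h k n = evalAt-cong A (pair-cong h k) (sumPoly n)

    witt-*-cong : ∀ {x x′ y y′} → x W.≈ x′ → y W.≈ y′ → (x W.* y) W.≈ (x′ W.* y′)
    witt-*-cong h k n = evalAt-cong A (pair-cong h k) (prodPoly n)

    witt-neg-cong : ∀ {x x′} → x W.≈ x′ → (W.- x) W.≈ (W.- x′)
    witt-neg-cong h n = evalAt-cong A h (negPoly n)

    ghost-+ : ∀ n x y → ghost n (x W.+ y) ≈ ghost n x + ghost n y
    ghost-+ n x y = trans (sym (ghost-hom p-prime {A = ℤ[ ℕ ⊎ ℕ ]} {B = A} f n sumPoly))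
      (trans (evalAt-~ A [ x , y ]′ (ghost-sumPoly n))
        (+-cong (ghost-hom p-prime {A = ℤ[ ℕ ⊎ ℕ ]} {B = A} f n X)
                (ghost-hom p-prime {A = ℤ[ ℕ ⊎ ℕ ]} {B = A} f n Y)))
      where f = eval A [ x , y ]′

    ghost-* : ∀ n x y → ghost n (x W.* y) ≈ ghost n x * ghost n y
    ghost-* n x y = trans (sym (ghost-hom p-prime {A = ℤ[ ℕ ⊎ ℕ ]} {B = A} f n prodPoly))
      (trans (evalAt-~ A [ x , y ]′ (ghost-prodPoly n))
        (*-cong (ghost-hom p-prime {A = ℤ[ ℕ ⊎ ℕ ]} {B = A} f n X)
                (ghost-hom p-prime {A = ℤ[ ℕ ⊎ ℕ ]} {B = A} f n Y)))
      where f = eval A [ x , y ]′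

    ghost-neg : ∀ n x → ghost n (W.- x) ≈ - ghost n x
    ghost-neg n x = trans (sym (ghost-hom p-prime {A = ℤ[ ℕ ]} {B = A} f n negPoly))
      (trans (evalAt-~ A x (ghost-negPoly n))
        (-‿cong (ghost-hom p-prime {A = ℤ[ ℕ ]} {B = A} f n var)))
      where f = eval A x

    ghost-1 : ∀ n → ghost n W.1# ≈ 1#
    ghost-1 zero    = refl
    ghost-1 (suc n) = trans (+-cong (1^ (p ℕ.^ suc n))
      (trans (×-congʳ p (ghost-0 n)) (trans (×≈π* 0#) (zeroʳ π)))) (+-identityʳ 1#)
      where open Congruence p-prime A

    ghost-eval : ∀ {V} (ρ : V → W.Carrier) n e →
                 ghost n (evalRaw (wittRaw A) ρ e) ≈ evalAt A (λ v → ghost n (ρ v)) e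
    ghost-eval ρ n (var v) = refl
    ghost-eval ρ n 𝟘       = ghost-0 n
    ghost-eval ρ n 𝟙       = ghost-1 n
    ghost-eval ρ n (x ⊕ y) = trans (ghost-+ n _ _) (+-cong (ghost-eval ρ n x) (ghost-eval ρ n y))
    ghost-eval ρ n (x ⊗ y) = trans (ghost-* n _ _) (*-cong (ghost-eval ρ n x) (ghost-eval ρ n y))
    ghost-eval ρ n (⊖ x)   = trans (ghost-neg n _) (-‿cong (ghost-eval ρ n x))

    evalW-cong : ∀ {V} {ρ ρ′ : V → W.Carrier} → (∀ v → ρ v W.≈ ρ′ v) →
                 ∀ e → evalRaw (wittRaw A) ρ e W.≈ evalRaw (wittRaw A) ρ′ e
    evalW-cong h (var v)   = h v
    evalW-cong h 𝟘       n = refl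
    evalW-cong h 𝟙       n = refl
    evalW-cong h (x ⊕ y)   = witt-+-cong (evalW-cong h x) (evalW-cong h y)
    evalW-cong h (x ⊗ y)   = witt-*-cong (evalW-cong h x) (evalW-cong h y)
    evalW-cong h (⊖ x)     = witt-neg-cong (evalW-cong h x)

  module _ {A : CommutativeRing c ℓ} {B : CommutativeRing c′ ℓ′} (f : A ⟶ B) where
    private
      module A = CommutativeRing A
      module B = CommutativeRing B
      module WA = RawRing (wittRaw A)
      module WB = RawRing (wittRaw B)
    open RingHomomorphism f

    mapW : WA.Carrier → WB.Carrier
    mapW x n = ⟦ x n ⟧

    private
      pair-map : ∀ x y v → ⟦ [ x , y ]′ v ⟧ B.≈ [ mapW x , mapW y ]′ v
      pair-map x y (inj₁ i) = B.refl
      pair-map x y (inj₂ i) = B.refl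

    mapW-+ : ∀ x y → mapW (x WA.+ y) WB.≈ (mapW x WB.+ mapW y)
    mapW-+ x y n = B.trans (hom-eval {A = A} {B = B} f [ x , y ]′ (sumPoly n))
      (evalAt-cong B (pair-map x y) (sumPoly n))

    mapW-* : ∀ x y → mapW (x WA.* y) WB.≈ (mapW x WB.* mapW y)
    mapW-* x y n = B.trans (hom-eval {A = A} {B = B} f [ x , y ]′ (prodPoly n))
      (evalAt-cong B (pair-map x y) (prodPoly n))

    mapW-neg : ∀ x → mapW (WA.- x) WB.≈ (WB.- mapW x)
    mapW-neg x n = hom-eval {A = A} {B = B} f x (negPoly n)

    mapW-1 : mapW WA.1# WB.≈ WB.1#
    mapW-1 zero    = 1#-homo
    mapW-1 (suc n) = 0#-homo

    mapW-eval : ∀ {V} (ρ : V → WA.Carrier) e →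
                mapW (evalRaw (wittRaw A) ρ e) WB.≈ evalRaw (wittRaw B) (λ v → mapW (ρ v)) e
    mapW-eval ρ (var v) n = B.refl
    mapW-eval ρ 𝟘       n = 0#-homo
    mapW-eval ρ 𝟙       n = mapW-1 n
    mapW-eval ρ (x ⊕ y) n = B.trans (mapW-+ _ _ n) (witt-+-cong B (mapW-eval ρ x) (mapW-eval ρ y) n)
    mapW-eval ρ (x ⊗ y) n = B.trans (mapW-* _ _ n) (witt-*-cong B (mapW-eval ρ x) (mapW-eval ρ y) n)
    mapW-eval ρ (⊖ x)   n = B.trans (mapW-neg _ n) (witt-neg-cong B (mapW-eval ρ x) n)

  -- The ghost map is injective over a p-torsion-free ring, so ring identities hold in
  -- W(ℤ[ℕ]) and hence, by functoriality, in W(A) for every A.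

  module _ (A : CommutativeRing c ℓ) (tf : TorsionFree._TorsionFree_ p A) where
    open CommutativeRing A hiding (zero)
    open Ghost p-prime A
    open RingProps ring using (+-cancelˡ; x∙y⁻¹≈ε⇒x≈y)
    open Congruence p-prime A using (×≈π*; π)
    open Mult semiring using (×-congʳ) renaming (_×_ to infixr 8 _×_)
    open Exp semiring using (^-congˡ)

    p-cancel : ∀ x y → p × x ≈ p × y → x ≈ y
    p-cancel x y h = x∙y⁻¹≈ε⇒x≈y x y (tf (x - y) (begin
      p × (x - y)       ≈⟨ ×≈π* _ ⟩
      π * (x - y)       ≈⟨ RP.x[y-z]≈xy-xz π x y ⟩
      π * x - π * y     ≈⟨ +-congˡ (-‿cong (trans (sym (×≈π* y)) (trans (sym h) (×≈π* x)))) ⟩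
      π * x - π * x     ≈⟨ -‿inverseʳ _ ⟩
      0# ∎))
      where
      open SetoidReasoning setoid
      module RP = RingProps ring

    ghost-injective : ∀ x y → (∀ n → ghost n x ≈ ghost n y) → ∀ n → x n ≈ y n
    ghost-injective x y h zero    = h 0
    ghost-injective x y h (suc n) = ghost-injective (λ i → x (suc i)) (λ i → y (suc i))
      (λ m → p-cancel _ _ (+-cancelˡ _ _ _
        (trans (+-congʳ (^-congˡ (p ℕ.^ suc m) (sym (h 0)))) (h (suc m))))) n

  private
    gen : Fin 3 → ℕ → Expr ℕ
    gen j i = var (i ℕ.* 3 ℕ.+ toℕ j)

    interleave : {A : Set c} → (Fin 3 → ℕ → A) → ℕ → A
    interleave σ 0 = σ zero 0
    interleave σ 1 = σ (suc zero) 0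
    interleave σ 2 = σ (suc (suc zero)) 0
    interleave σ (suc (suc (suc n))) = interleave (λ j i → σ j (suc i)) n

    interleave-gen : {A : Set c} (σ : Fin 3 → ℕ → A) → ∀ i j → interleave σ (i ℕ.* 3 ℕ.+ toℕ j) ≡ σ j i
    interleave-gen σ zero zero             = ≡.refl
    interleave-gen σ zero (suc zero)       = ≡.refl
    interleave-gen σ zero (suc (suc zero)) = ≡.refl
    interleave-gen σ (suc i) j             = interleave-gen (λ j i → σ j (suc i)) i j

    torsionFree : TorsionFree._TorsionFree_ p ℤ[ ℕ ]
    torsionFree with prime≥2 p-prime
    ... | m , ≡.refl = TorsionFree.torsionFree-ℕ (suc m)

  law : (A : CommutativeRing c ℓ) → ∀ {e e′ : Expr (Fin 3)} → e ~ e′ →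
        ∀ σ → let open RawRing (wittRaw A) in evalRaw (wittRaw A) σ e ≈ evalRaw (wittRaw A) σ e′
  law A {e} {e′} r σ n = trans (sym (push e)) (trans (evalAt-~ A (interleave σ) universal) (push e′))
    where
    open CommutativeRing A
    f : ℤ[ ℕ ] ⟶ A
    f = eval A (interleave σ)
    push : ∀ e → evalAt A (interleave σ) (evalRaw (wittRaw ℤ[ ℕ ]) gen e n) ≈ evalRaw (wittRaw A) σ e n
    push e = trans (mapW-eval {A = ℤ[ ℕ ]} {B = A} f gen e n)
      (evalW-cong A (λ j i → reflexive (interleave-gen σ i j)) e n)
    universal : evalRaw (wittRaw ℤ[ ℕ ]) gen e n ~ evalRaw (wittRaw ℤ[ ℕ ]) gen e′ n
    universal = ghost-injective ℤ[ ℕ ] torsionFree _ _ (λ m →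
      ~trans (ghost-eval ℤ[ ℕ ] gen m e)
        (~trans (evalAt-~ ℤ[ ℕ ] _ r) (~sym (ghost-eval ℤ[ ℕ ] gen m e′)))) n

  W : CommutativeRing c ℓ → CommutativeRing c ℓ
  W A = CommutativeRingLaws.commutativeRing laws
    where
    open CommutativeRing A using (refl; sym; trans)
    triple : {B : Set _} → B → B → B → Fin 3 → B
    triple x y z zero             = x
    triple x y z (suc zero)       = y
    triple x y z (suc (suc zero)) = z
    a b d : Expr (Fin 3)
    a = var zero
    b = var (suc zero)
    d = var (suc (suc zero))
    laws : CommutativeRingLaws (wittRaw A)
    laws = record
      { isEquivalence = record
        { refl = λ _ → refl ; sym = λ h n → sym (h n) ; trans = λ h k n → trans (h n) (k n) }
      ; +-cong = witt-+-cong A ; *-cong = witt-*-cong A ; -‿cong = witt-neg-cong A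
      ; +-assoc     = λ x y z → law A (⊕-assoc a b d) (triple x y z)
      ; +-comm      = λ x y → law A (⊕-comm a b) (triple x y y)
      ; +-identityˡ = λ x → law A (⊕-identityˡ a) (triple x x x)
      ; -‿inverseˡ  = λ x → law A (⊖-inverseˡ a) (triple x x x)
      ; *-assoc     = λ x y z → law A (⊗-assoc a b d) (triple x y z)
      ; *-comm      = λ x y → law A (⊗-comm a b) (triple x y y)
      ; *-identityˡ = λ x → law A (⊗-identityˡ a) (triple x x x)
      ; distribʳ    = λ x y z → law A (⊗-distribʳ a b d) (triple x y z)
      }

  W-map : {A : CommutativeRing c ℓ} {B : CommutativeRing c′ ℓ′} → A ⟶ B → W A ⟶ W B
  W-map {A = A} {B} f = record
    { ⟦_⟧ = mapW {A = A} {B = B} f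
    ; isRingHomomorphism = record
      { isSemiringHomomorphism = record
        { isNearSemiringHomomorphism = record
          { +-isMonoidHomomorphism = record
            { isMagmaHomomorphism = record
              { isRelHomomorphism = record { cong = λ h n → ⟦⟧-cong (h n) }
              ; homo = mapW-+ {A = A} {B = B} f }
            ; ε-homo = λ n → 0#-homo }
          ; *-homo = mapW-* {A = A} {B = B} f }
        ; 1#-homo = mapW-1 {A = A} {B = B} f }
      ; -‿homo = mapW-neg {A = A} {B = B} f }
    }
    where open RingHomomorphism f using (⟦⟧-cong; 0#-homo)


-- for p prime and A nonzero this says that the characteristic is exactly p
_ofChar_ : CommutativeRing c ℓ → ℕ → Set ℓ
A ofChar p = p × 1# ≈ 0#
  where
  open CommutativeRing A
  open Mult semiring using () renaming (_×_ to infixr 8 _×_)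

record IsAlgebraicallyClosedField (k : CommutativeRing c ℓ) : Set (c ⊔ ℓ) where
  open CommutativeRing k
  open Sum semiring using (sum)
  open Exp semiring using (_^_)
  field
    0≉1     : ¬ 0# ≈ 1#
    inverse : ∀ x → ¬ x ≈ 0# → ∃ λ y → x * y ≈ 1#
    -- every polynomial Σ aᵢ Xⁱ of degree d + 1 has a root
    root    : ∀ d (a : Fin (suc (suc d)) → Carrier) → ¬ a (Fin.fromℕ (suc d)) ≈ 0# →
              ∃ λ x → sum (λ i → a i * x ^ toℕ i) ≈ 0#

hom-char : ∀ {p} {A : CommutativeRing c ℓ} {B : CommutativeRing c′ ℓ′} → A ⟶ B → A ofChar p → B ofChar p
hom-char {p = p} {A} {B} f char =
  trans (×-congʳ p (sym 1#-homo)) (trans (sym (×-homo p _)) (trans (⟦⟧-cong char) 0#-homo))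
  where
  open CommutativeRing B
  open Hom {R = A} {S = B} f
  open Mult semiring using (×-congʳ)

powerSeries-char : ∀ {p} {A : CommutativeRing c ℓ} → A ofChar p → Series.powerSeries A ofChar p
powerSeries-char {p = p} {A} char = λ { zero → trans (coeff p 1ₛ 0) char
                                      ; (suc n) → trans (coeff p 1ₛ (suc n)) (×0 p) }
  where
  open CommutativeRing A hiding (zero)
  open Series A
  open Mult semiring using () renaming (_×_ to infixr 8 _×_)
  open Mult (CommutativeRing.semiring powerSeries) using () renaming (_×_ to infixr 8 _×ₛ_)
  coeff : ∀ k f n → (k ×ₛ f) n ≈ k × f n
  coeff zero    f n = refl
  coeff (suc k) f n = +-congˡ (coeff k f n)
  ×0 : ∀ k → k × 0# ≈ 0#
  ×0 zero    = refl
  ×0 (suc k) = trans (+-identityˡ _) (×0 k)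

module _ {p : ℕ} (p-prime : Prime p) {A : CommutativeRing c ℓ} (char : A ofChar p) where
  open CommutativeRing A hiding (zero)
  open Exp semiring using (_^_; ^-congˡ)
  open CommExp commutativeSemiring using (^-distrib-*)

  private
    +-^p : ∀ x y → (x + y) ^ p ≈ x ^ p + y ^ p
    +-^p x y with Frobenius.freshman A p-prime x y
    ... | r , e = trans e (trans (+-congˡ (trans (*-congʳ char) (zeroˡ _))) (+-identityʳ _))

    open Congruence p-prime A using (0^p; 1^)

  frobenius : A ⟶ A
  frobenius = record
    { ⟦_⟧ = _^ p
    ; isRingHomomorphism = record
      { isSemiringHomomorphism = record
        { isNearSemiringHomomorphism = record
          { +-isMonoidHomomorphism = record
            { isMagmaHomomorphism = record
              { isRelHomomorphism = record { cong = ^-congˡ p }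
              ; homo = +-^p }
            ; ε-homo = 0^p }
          ; *-homo = λ x y → ^-distrib-* x y p }
        ; 1#-homo = 1^ p }
      ; -‿homo = λ x → RingProps.+-inverseˡ-unique ring _ _
          (trans (sym (+-^p (- x) x)) (trans (^-congˡ p (-‿inverseˡ x)) 0^p)) }
    }

Regular : (A : CommutativeRing c ℓ) → CommutativeRing.Carrier A → Set (c ⊔ ℓ)
Regular A s = ∀ x y → s * x ≈ s * y → x ≈ y
  where open CommutativeRing A

-- The localization A[1/s] at a non-zero-divisor s.

module Localization (A : CommutativeRing c ℓ) (s : CommutativeRing.Carrier A) (regular : Regular A s) where
  open CommutativeRing A hiding (zero)
  open SetoidReasoning setoid
  open Exp semiring using (_^_; ^-homo-*; ^-congʳ)
  open Solver commutativeSemiring using (solve; _:=_; _:+_; _:*_; con)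

  record Fraction : Set c where
    constructor _/s^_
    field
      numerator : Carrier
      exponent  : ℕ

  open Fraction

  record _≋_ (u v : Fraction) : Set ℓ where
    constructor cross
    field
      uncross : s ^ exponent v * numerator u ≈ s ^ exponent u * numerator v

  infix 4 _≋_
  infix 7 _/s^_

  private
    cancel : ∀ n x y → s ^ n * x ≈ s ^ n * y → x ≈ y
    cancel zero    x y e = trans (sym (*-identityˡ x)) (trans e (*-identityˡ y))
    cancel (suc n) x y e = cancel n x y (regular _ _ (trans (sym (*-assoc _ _ _)) (trans e (*-assoc _ _ _))))

    ≋-trans : ∀ {u v w} → u ≋ v → v ≋ w → u ≋ w
    ≋-trans {x /s^ m} {y /s^ n} {z /s^ k} (cross e) (cross e′) = cross (cancel n _ _ (begin
      s ^ n * (s ^ k * x) ≈⟨ swap (s ^ n) (s ^ k) x ⟩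
      s ^ k * (s ^ n * x) ≈⟨ *-congˡ e ⟩
      s ^ k * (s ^ m * y) ≈⟨ swap (s ^ k) (s ^ m) y ⟩
      s ^ m * (s ^ k * y) ≈⟨ *-congˡ e′ ⟩
      s ^ m * (s ^ n * z) ≈⟨ swap (s ^ m) (s ^ n) z ⟩
      s ^ n * (s ^ m * z) ∎))
      where
      swap : ∀ a b x → a * (b * x) ≈ b * (a * x)
      swap = solve 3 (λ a b x → a :* (b :* x) := b :* (a :* x)) refl

    ≡⇒≋ : ∀ {m n x y} → m ≡ n → x ≈ y → (x /s^ m) ≋ (y /s^ n)
    ≡⇒≋ ≡.refl e = cross (*-congˡ e)

    raw : RawRing c ℓ
    raw = record
      { Carrier = Fraction
      ; _≈_ = _≋_
      ; _+_ = λ { (x /s^ m) (y /s^ n) → (s ^ n * x + s ^ m * y) /s^ (m ℕ.+ n) }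
      ; _*_ = λ { (x /s^ m) (y /s^ n) → (x * y) /s^ (m ℕ.+ n) }
      ; -_  = λ { (x /s^ m) → (- x) /s^ m }
      ; 0#  = 0# /s^ 0
      ; 1#  = 1# /s^ 0
      }
    module L = RawRing raw

    +-cong′ : ∀ {u u′ v v′} → u ≋ u′ → v ≋ v′ → (u L.+ v) ≋ (u′ L.+ v′)
    +-cong′ {x /s^ m} {x′ /s^ m′} {y /s^ n} {y′ /s^ n′} (cross e) (cross e′) = cross (begin
      s ^ (m′ ℕ.+ n′) * (s ^ n * x + s ^ m * y)
        ≈⟨ *-congʳ (^-homo-* s m′ n′) ⟩
      s ^ m′ * s ^ n′ * (s ^ n * x + s ^ m * y)
        ≈⟨ solve 6 (λ M′ N′ N x M y → M′ :* N′ :* (N :* x :+ M :* y) := N′ :* N :* (M′ :* x) :+ M′ :* M :* (N′ :* y))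
             refl (s ^ m′) (s ^ n′) (s ^ n) x (s ^ m) y ⟩
      s ^ n′ * s ^ n * (s ^ m′ * x) + s ^ m′ * s ^ m * (s ^ n′ * y)
        ≈⟨ +-cong (*-congˡ e) (*-congˡ e′) ⟩
      s ^ n′ * s ^ n * (s ^ m * x′) + s ^ m′ * s ^ m * (s ^ n * y′)
        ≈⟨ solve 6 (λ M′ N′ N x M y → N′ :* N :* (M :* x) :+ M′ :* M :* (N :* y) := M :* N :* (N′ :* x :+ M′ :* y))
             refl (s ^ m′) (s ^ n′) (s ^ n) x′ (s ^ m) y′ ⟩
      s ^ m * s ^ n * (s ^ n′ * x′ + s ^ m′ * y′)
        ≈⟨ *-congʳ (sym (^-homo-* s m n)) ⟩
      s ^ (m ℕ.+ n) * (s ^ n′ * x′ + s ^ m′ * y′) ∎)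

    *-cong′ : ∀ {u u′ v v′} → u ≋ u′ → v ≋ v′ → (u L.* v) ≋ (u′ L.* v′)
    *-cong′ {x /s^ m} {x′ /s^ m′} {y /s^ n} {y′ /s^ n′} (cross e) (cross e′) = cross (begin
      s ^ (m′ ℕ.+ n′) * (x * y)      ≈⟨ *-congʳ (^-homo-* s m′ n′) ⟩
      s ^ m′ * s ^ n′ * (x * y)      ≈⟨ interchange _ _ _ _ ⟩
      (s ^ m′ * x) * (s ^ n′ * y)    ≈⟨ *-cong e e′ ⟩
      (s ^ m * x′) * (s ^ n * y′)    ≈⟨ interchange _ _ _ _ ⟩
      s ^ m * s ^ n * (x′ * y′)      ≈⟨ *-congʳ (sym (^-homo-* s m n)) ⟩
      s ^ (m ℕ.+ n) * (x′ * y′) ∎)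
      where
      interchange : ∀ a b x y → a * b * (x * y) ≈ (a * x) * (b * y)
      interchange = solve 4 (λ a b x y → a :* b :* (x :* y) := (a :* x) :* (b :* y)) refl

    neg-cong′ : ∀ {u u′} → u ≋ u′ → (L.- u) ≋ (L.- u′)
    neg-cong′ (cross e) = cross (trans (sym (-‿distribʳ-* _ _)) (trans (-‿cong e) (-‿distribʳ-* _ _)))
      where open RingProps ring using (-‿distribʳ-*)

    +-assoc′ : ∀ u v w → ((u L.+ v) L.+ w) ≋ (u L.+ (v L.+ w))
    +-assoc′ (x /s^ m) (y /s^ n) (z /s^ k) = ≡⇒≋ (ℕₚ.+-assoc m n k) (begin
      s ^ k * (s ^ n * x + s ^ m * y) + s ^ (m ℕ.+ n) * z
        ≈⟨ +-congˡ (*-congʳ (^-homo-* s m n)) ⟩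
      s ^ k * (s ^ n * x + s ^ m * y) + s ^ m * s ^ n * z
        ≈⟨ solve 6 (λ M N K x y z → K :* (N :* x :+ M :* y) :+ M :* N :* z := N :* K :* x :+ M :* (K :* y :+ N :* z))
             refl (s ^ m) (s ^ n) (s ^ k) x y z ⟩
      s ^ n * s ^ k * x + s ^ m * (s ^ k * y + s ^ n * z)
        ≈⟨ +-congʳ (*-congʳ (sym (^-homo-* s n k))) ⟩
      s ^ (n ℕ.+ k) * x + s ^ m * (s ^ k * y + s ^ n * z) ∎)

    +-comm′ : ∀ u v → (u L.+ v) ≋ (v L.+ u)
    +-comm′ (x /s^ m) (y /s^ n) = ≡⇒≋ (ℕₚ.+-comm m n) (+-comm _ _)

    +-identityˡ′ : ∀ u → (L.0# L.+ u) ≋ u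
    +-identityˡ′ (x /s^ m) = cross (*-congˡ (trans (+-cong (zeroʳ _) (*-identityˡ x)) (+-identityˡ x)))

    inverseˡ′ : ∀ u → ((L.- u) L.+ u) ≋ L.0#
    inverseˡ′ (x /s^ m) = cross (trans (*-identityˡ _) (trans (sym (distribˡ _ _ _))
      (trans (*-congˡ (-‿inverseˡ x)) (trans (zeroʳ _) (sym (zeroʳ _))))))

    distribʳ′ : ∀ u v w → ((v L.+ w) L.* u) ≋ ((v L.* u) L.+ (w L.* u))
    distribʳ′ (x /s^ m) (y /s^ n) (z /s^ k) = cross (begin
      s ^ ((n ℕ.+ m) ℕ.+ (k ℕ.+ m)) * ((s ^ k * y + s ^ n * z) * x)
        ≈⟨ *-congʳ (trans (^-homo-* s (n ℕ.+ m) (k ℕ.+ m)) (*-cong (^-homo-* s n m) (^-homo-* s k m))) ⟩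
      s ^ n * s ^ m * (s ^ k * s ^ m) * ((s ^ k * y + s ^ n * z) * x)
        ≈⟨ solve 6 (λ M N K x y z → N :* M :* (K :* M) :* ((K :* y :+ N :* z) :* x)
                      := N :* K :* M :* (K :* M :* (y :* x) :+ N :* M :* (z :* x)))
             refl (s ^ m) (s ^ n) (s ^ k) x y z ⟩
      s ^ n * s ^ k * s ^ m * (s ^ k * s ^ m * (y * x) + s ^ n * s ^ m * (z * x))
        ≈⟨ *-cong (sym (trans (^-homo-* s (n ℕ.+ k) m) (*-congʳ (^-homo-* s n k))))
                  (+-cong (*-congʳ (sym (^-homo-* s k m))) (*-congʳ (sym (^-homo-* s n m)))) ⟩
      s ^ ((n ℕ.+ k) ℕ.+ m) * (s ^ (k ℕ.+ m) * (y * x) + s ^ (n ℕ.+ m) * (z * x)) ∎)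

  localization : CommutativeRing c ℓ
  localization = CommutativeRingLaws.commutativeRing laws
    where
    laws : CommutativeRingLaws raw
    laws = record
      { isEquivalence = record
        { refl = cross refl ; sym = λ (cross e) → cross (sym e) ; trans = ≋-trans }
      ; +-cong = +-cong′
      ; *-cong = *-cong′
      ; -‿cong = neg-cong′
      ; +-assoc = +-assoc′ ; +-comm = +-comm′ ; +-identityˡ = +-identityˡ′ ; -‿inverseˡ = inverseˡ′
      ; *-assoc = λ { (x /s^ m) (y /s^ n) (z /s^ k) → ≡⇒≋ (ℕₚ.+-assoc m n k) (*-assoc x y z) }
      ; *-comm = λ { (x /s^ m) (y /s^ n) → ≡⇒≋ (ℕₚ.+-comm m n) (*-comm x y) }
      ; *-identityˡ = λ { (x /s^ m) → cross (*-congˡ (*-identityˡ x)) }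
      ; distribʳ = distribʳ′
      }

  localize : A ⟶ localization
  localize = record
    { ⟦_⟧ = λ x → x /s^ 0
    ; isRingHomomorphism = record
      { isSemiringHomomorphism = record
        { isNearSemiringHomomorphism = record
          { +-isMonoidHomomorphism = record
            { isMagmaHomomorphism = record
              { isRelHomomorphism = record { cong = λ e → cross (*-congˡ e) }
              ; homo = λ x y → cross (*-congˡ (sym (+-cong (*-identityˡ x) (*-identityˡ y)))) }
            ; ε-homo = cross refl }
          ; *-homo = λ _ _ → cross refl }
        ; 1#-homo = cross refl }
      ; -‿homo = λ _ → cross refl }
    }

-- k((t)) = k[[t]][1/t]

module LaurentSeries (k : CommutativeRing c ℓ) where
  open CommutativeRing k hiding (zero)
  open Series k

  t : Ser
  t zero          = 0#
  t (suc zero)    = 1#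
  t (suc (suc n)) = 0#

  t*-suc : ∀ f n → (t *ₛ f) (suc n) ≈ f n
  t*-suc f n = trans (+-cong (zeroˡ _) (trans (*ₛ-cong {tail t} {1ₛ} tail-t (λ _ → refl) n) (1*ₛ f n)))
    (+-identityˡ _)
    where
    tail-t : tail t ≋ 1ₛ
    tail-t zero    = refl
    tail-t (suc n) = refl

  t-regular : ∀ f g → (t *ₛ f) ≋ (t *ₛ g) → f ≋ g
  t-regular f g h n = trans (sym (t*-suc f n)) (trans (h (suc n)) (t*-suc g n))

  open Localization powerSeries t t-regular public
    renaming (localization to laurentSeries; localize to fromPowerSeries)

record LinearMap {R : CommutativeRing c ℓ} (M : Module R m ℓm) (N : Module R m′ ℓm′) :
                 Set (c ⊔ m ⊔ ℓm ⊔ m′ ⊔ ℓm′) where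
  open ModuleMorphisms (Module.rawModule M) (Module.rawModule N)
  field
    ⟦_⟧                  : Module.Carrierᴹ M → Module.Carrierᴹ N
    isModuleHomomorphism : IsModuleHomomorphism ⟦_⟧
  open IsModuleHomomorphism isModuleHomomorphism public

module _ {R : CommutativeRing c ℓ} (M : Module R m ℓm) where
  open CommutativeRing R using (Carrier; _≈_; 0#)
  open Module M
  open MonoidSum +ᴹ-commutativeMonoid using (sum)

  record IsBasis {n : ℕ} (b : Fin n → Carrierᴹ) : Set (c ⊔ ℓ ⊔ m ⊔ ℓm) where
    field
      spanning    : ∀ x → ∃ λ (a : Fin n → Carrier) → x ≈ᴹ sum (λ i → a i *ₗ b i)
      independent : ∀ (a : Fin n → Carrier) → sum (λ i → a i *ₗ b i) ≈ᴹ 0ᴹ → ∀ i → a i ≈ 0#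

  FreeOfRank : ℕ → Set (c ⊔ ℓ ⊔ m ⊔ ℓm)
  FreeOfRank n = ∃ λ (b : Fin n → Carrierᴹ) → IsBasis b

record IsIsogeny (p : ℕ) {R : CommutativeRing c ℓ} {M : Module R m ℓm} {N : Module R m′ ℓm′}
                 (F : LinearMap M N) : Set (m ⊔ ℓm ⊔ m′ ⊔ ℓm′) where
  private
    module M = Module M
    module N = Module N
  open LinearMap F using (⟦_⟧)
  open MonoidMult M.+ᴹ-monoid using () renaming (_×_ to infixr 8 _×ᴹ_)
  open MonoidMult N.+ᴹ-monoid using () renaming (_×_ to infixr 8 _×ᴺ_)
  field
    kernel   : ∃ λ n → ∀ x → ⟦ x ⟧ N.≈ᴹ N.0ᴹ → (p ℕ.^ n) ×ᴹ x M.≈ᴹ M.0ᴹ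
    cokernel : ∃ λ n → ∀ y → ∃ λ x → ⟦ x ⟧ N.≈ᴹ (p ℕ.^ n) ×ᴺ y

-- f^* M = M ⊗_{R, f} S: formal sums of tensors modulo bilinearity and r m ⊗ s = m ⊗ f(r) s

module BaseChange {R : CommutativeRing c ℓ} {S : CommutativeRing c′ ℓ′} (f : R ⟶ S) (M : Module R m ℓm) where
  private
    module S = CommutativeRing S
    module M = Module M
  open RingHomomorphism f using (⟦_⟧)

  infixl 6 _⊕_
  infixl 7 _⊗_
  infix 4 _≋_

  data Tensor : Set (m ⊔ c′) where
    _⊗_ : M.Carrierᴹ → S.Carrier → Tensor
    𝟘   : Tensor
    _⊕_ : Tensor → Tensor → Tensor
    ⊖_  : Tensor → Tensor

  data _≋_ : Tensor → Tensor → Set (c ⊔ m ⊔ ℓm ⊔ c′ ⊔ ℓ′) where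
    ≋-refl     : ∀ {u} → u ≋ u
    ≋-sym      : ∀ {u v} → u ≋ v → v ≋ u
    ≋-trans    : ∀ {u v w} → u ≋ v → v ≋ w → u ≋ w
    ⊕-cong     : ∀ {u u′ v v′} → u ≋ u′ → v ≋ v′ → u ⊕ v ≋ u′ ⊕ v′
    ⊖-cong     : ∀ {u u′} → u ≋ u′ → ⊖ u ≋ ⊖ u′
    ⊕-assoc    : ∀ u v w → (u ⊕ v) ⊕ w ≋ u ⊕ (v ⊕ w)
    ⊕-comm     : ∀ u v → u ⊕ v ≋ v ⊕ u
    ⊕-identityˡ : ∀ u → 𝟘 ⊕ u ≋ u
    ⊖-inverseˡ : ∀ u → ⊖ u ⊕ u ≋ 𝟘
    ⊗-cong     : ∀ {x x′ s s′} → x M.≈ᴹ x′ → s S.≈ s′ → x ⊗ s ≋ x′ ⊗ s′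
    ⊗-distribʳ : ∀ x y s → (x M.+ᴹ y) ⊗ s ≋ x ⊗ s ⊕ y ⊗ s
    ⊗-distribˡ : ∀ x s s′ → x ⊗ (s S.+ s′) ≋ x ⊗ s ⊕ x ⊗ s′
    ⊗-balanced : ∀ r x s → (r M.*ₗ x) ⊗ s ≋ x ⊗ (⟦ r ⟧ S.* s)

  _∙_ : S.Carrier → Tensor → Tensor
  a ∙ (x ⊗ s) = x ⊗ (a S.* s)
  a ∙ 𝟘       = 𝟘
  a ∙ (u ⊕ v) = a ∙ u ⊕ a ∙ v
  a ∙ (⊖ u)   = ⊖ (a ∙ u)

  private
    group : AbelianGroup (m ⊔ c′) (c ⊔ m ⊔ ℓm ⊔ c′ ⊔ ℓ′)
    group = record
      { Carrier = Tensor
      ; _≈_ = _≋_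
      ; _∙_ = _⊕_
      ; ε   = 𝟘
      ; _⁻¹ = ⊖_
      ; isAbelianGroup = record
        { isGroup = record
          { isMonoid = record
            { isSemigroup = record
              { isMagma = record
                { isEquivalence = record { refl = ≋-refl ; sym = ≋-sym ; trans = ≋-trans }
                ; ∙-cong = ⊕-cong }
              ; assoc = ⊕-assoc }
            ; identity = ⊕-identityˡ , λ u → ≋-trans (⊕-comm u 𝟘) (⊕-identityˡ u) }
          ; inverse = ⊖-inverseˡ , λ u → ≋-trans (⊕-comm u (⊖ u)) (⊖-inverseˡ u)
          ; ⁻¹-cong = ⊖-cong }
        ; comm = ⊕-comm } }

    module G = AbelianGroup group
    open AbelianGroupProps group using (ε⁻¹≈ε; ⁻¹-∙-comm; identityˡ-unique)
    open CommSemigroup G.commutativeSemigroup using (interchange)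

    ⊗-0 : ∀ x → x ⊗ S.0# ≋ 𝟘
    ⊗-0 x = identityˡ-unique _ _ (≋-trans (≋-sym (⊗-distribˡ x S.0# S.0#)) (⊗-cong M.≈ᴹ-refl (S.+-identityˡ _)))

    ∙-congʳ : ∀ {a b} → a S.≈ b → ∀ u → a ∙ u ≋ b ∙ u
    ∙-congʳ e (x ⊗ s) = ⊗-cong M.≈ᴹ-refl (S.*-congʳ e)
    ∙-congʳ e 𝟘       = ≋-refl
    ∙-congʳ e (u ⊕ v) = ⊕-cong (∙-congʳ e u) (∙-congʳ e v)
    ∙-congʳ e (⊖ u)   = ⊖-cong (∙-congʳ e u)

    ∙-congˡ : ∀ a {u v} → u ≋ v → a ∙ u ≋ a ∙ v
    ∙-congˡ a ≋-refl              = ≋-refl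
    ∙-congˡ a (≋-sym e)           = ≋-sym (∙-congˡ a e)
    ∙-congˡ a (≋-trans e e′)      = ≋-trans (∙-congˡ a e) (∙-congˡ a e′)
    ∙-congˡ a (⊕-cong e e′)       = ⊕-cong (∙-congˡ a e) (∙-congˡ a e′)
    ∙-congˡ a (⊖-cong e)          = ⊖-cong (∙-congˡ a e)
    ∙-congˡ a (⊕-assoc u v w)     = ⊕-assoc _ _ _
    ∙-congˡ a (⊕-comm u v)        = ⊕-comm _ _
    ∙-congˡ a (⊕-identityˡ u)     = ⊕-identityˡ _
    ∙-congˡ a (⊖-inverseˡ u)      = ⊖-inverseˡ _
    ∙-congˡ a (⊗-cong e e′)       = ⊗-cong e (S.*-congˡ e′)
    ∙-congˡ a (⊗-distribʳ x y s)  = ⊗-distribʳ x y _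
    ∙-congˡ a (⊗-distribˡ x s s′) = ≋-trans (⊗-cong M.≈ᴹ-refl (S.distribˡ a s s′)) (⊗-distribˡ x _ _)
    ∙-congˡ a (⊗-balanced r x s)  = ≋-trans (⊗-balanced r x _) (⊗-cong M.≈ᴹ-refl
      (S.trans (S.sym (S.*-assoc _ _ _)) (S.trans (S.*-congʳ (S.*-comm _ _)) (S.*-assoc _ _ _))))

    ∙-zeroˡ : ∀ u → S.0# ∙ u ≋ 𝟘
    ∙-zeroˡ (x ⊗ s) = ≋-trans (⊗-cong M.≈ᴹ-refl (S.zeroˡ s)) (⊗-0 x)
    ∙-zeroˡ 𝟘       = ≋-refl
    ∙-zeroˡ (u ⊕ v) = ≋-trans (⊕-cong (∙-zeroˡ u) (∙-zeroˡ v)) (⊕-identityˡ 𝟘)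
    ∙-zeroˡ (⊖ u)   = ≋-trans (⊖-cong (∙-zeroˡ u)) ε⁻¹≈ε

    ∙-distribʳ : ∀ u a b → (a S.+ b) ∙ u ≋ a ∙ u ⊕ b ∙ u
    ∙-distribʳ (x ⊗ s) a b = ≋-trans (⊗-cong M.≈ᴹ-refl (S.distribʳ s a b)) (⊗-distribˡ x _ _)
    ∙-distribʳ 𝟘       a b = ≋-sym (⊕-identityˡ 𝟘)
    ∙-distribʳ (u ⊕ v) a b = ≋-trans (⊕-cong (∙-distribʳ u a b) (∙-distribʳ v a b)) (interchange _ _ _ _)
    ∙-distribʳ (⊖ u)   a b = ≋-trans (⊖-cong (∙-distribʳ u a b)) (≋-sym (⁻¹-∙-comm _ _))

    ∙-identityˡ : ∀ u → S.1# ∙ u ≋ u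
    ∙-identityˡ (x ⊗ s) = ⊗-cong M.≈ᴹ-refl (S.*-identityˡ s)
    ∙-identityˡ 𝟘       = ≋-refl
    ∙-identityˡ (u ⊕ v) = ⊕-cong (∙-identityˡ u) (∙-identityˡ v)
    ∙-identityˡ (⊖ u)   = ⊖-cong (∙-identityˡ u)

    ∙-assoc : ∀ a b u → (a S.* b) ∙ u ≋ a ∙ (b ∙ u)
    ∙-assoc a b (x ⊗ s) = ⊗-cong M.≈ᴹ-refl (S.*-assoc a b s)
    ∙-assoc a b 𝟘       = ≋-refl
    ∙-assoc a b (u ⊕ v) = ⊕-cong (∙-assoc a b u) (∙-assoc a b v)
    ∙-assoc a b (⊖ u)   = ⊖-cong (∙-assoc a b u)

    isLeftModule : IsLeftModule S.ring _≋_ _⊕_ 𝟘 ⊖_ _∙_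
    isLeftModule = record
      { isLeftSemimodule = record
        { +ᴹ-isCommutativeMonoid = G.isCommutativeMonoid
        ; isPreleftSemimodule = record
          { *ₗ-cong      = λ {a} {b} {u} {v} e e′ → ≋-trans (∙-congʳ e u) (∙-congˡ b e′)
          ; *ₗ-zeroˡ     = ∙-zeroˡ
          ; *ₗ-distribʳ  = ∙-distribʳ
          ; *ₗ-identityˡ = ∙-identityˡ
          ; *ₗ-assoc     = ∙-assoc
          ; *ₗ-zeroʳ     = λ _ → ≋-refl
          ; *ₗ-distribˡ  = λ _ _ _ → ≋-refl
          } }
      ; -ᴹ‿cong    = ⊖-cong
      ; -ᴹ‿inverse = G.inverse }

  baseChange : Module S (m ⊔ c′) (c ⊔ m ⊔ ℓm ⊔ c′ ⊔ ℓ′)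
  baseChange = record
    { isModule = IsModuleFromLeft.isModule {commutativeRing = S} (record { isLeftModule = isLeftModule }) }

  embed : M.Carrierᴹ → Tensor
  embed x = x ⊗ S.1#

Commutes : {R : CommutativeRing c ℓ} {S : CommutativeRing c′ ℓ′} → R ⟶ S → R ⟶ R → S ⟶ S → Set (c ⊔ ℓ′)
Commutes {S = S} ι σᴿ σˢ = ∀ r → σˢ.⟦ ι.⟦ r ⟧ ⟧ ≈ ι.⟦ σᴿ.⟦ r ⟧ ⟧
  where
  open CommutativeRing S using (_≈_)
  module ι = RingHomomorphism ι
  module σᴿ = RingHomomorphism σᴿ
  module σˢ = RingHomomorphism σˢ

-- For σ on R and S, compatible with ι : R → S, and F : σ^* M → M, the σ-linear map
-- x ↦ F (x ⊗ 1) on M and its σ-linear extension x ⊗ s ↦ F (x ⊗ 1) ⊗ σ(s) to M ⊗_R S.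

module SemilinearExtension
  {R : CommutativeRing c ℓ} {S : CommutativeRing c′ ℓ′} (ι : R ⟶ S) (σᴿ : R ⟶ R) (σˢ : S ⟶ S)
  (commutes : Commutes {R = R} {S = S} ι σᴿ σˢ)
  (M : Module R m ℓm) (F : LinearMap (BaseChange.baseChange {R = R} {S = R} σᴿ M) M) where
  private
    module R = CommutativeRing R
    module S = CommutativeRing S
    module M = Module M
    module F = LinearMap F
    module ι = RingHomomorphism ι
    module σᴿ = RingHomomorphism σᴿ
    module σˢ = RingHomomorphism σˢ
    module T = BaseChange {R = R} {S = R} σᴿ M
  open BaseChange {R = R} {S = S} ι M

  onModule : M.Carrierᴹ → M.Carrierᴹ
  onModule x = F.⟦ T.embed x ⟧

  private
    onModule-cong : ∀ {x y} → x M.≈ᴹ y → onModule x M.≈ᴹ onModule y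
    onModule-cong e = F.⟦⟧-cong (T.⊗-cong e R.refl)

    onModule-+ : ∀ x y → onModule (x M.+ᴹ y) M.≈ᴹ onModule x M.+ᴹ onModule y
    onModule-+ x y = M.≈ᴹ-trans (F.⟦⟧-cong (T.⊗-distribʳ x y R.1#)) (F.+ᴹ-homo _ _)

  onModule-* : ∀ r x → onModule (r M.*ₗ x) M.≈ᴹ σᴿ.⟦ r ⟧ M.*ₗ onModule x
  onModule-* r x = M.≈ᴹ-trans (F.⟦⟧-cong (T.⊗-balanced r x R.1#)) (F.*ₗ-homo σᴿ.⟦ r ⟧ (T.embed x))

  extension : Tensor → Tensor
  extension (x ⊗ s) = onModule x ⊗ σˢ.⟦ s ⟧
  extension 𝟘       = 𝟘
  extension (u ⊕ v) = extension u ⊕ extension v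
  extension (⊖ u)   = ⊖ extension u

  extension-∙ : ∀ a u → extension (a ∙ u) ≋ σˢ.⟦ a ⟧ ∙ extension u
  extension-∙ a (x ⊗ s) = ⊗-cong M.≈ᴹ-refl (σˢ.*-homo a s)
  extension-∙ a 𝟘       = ≋-refl
  extension-∙ a (u ⊕ v) = ⊕-cong (extension-∙ a u) (extension-∙ a v)
  extension-∙ a (⊖ u)   = ⊖-cong (extension-∙ a u)

  extension-cong : ∀ {u v} → u ≋ v → extension u ≋ extension v
  extension-cong ≋-refl              = ≋-refl
  extension-cong (≋-sym e)           = ≋-sym (extension-cong e)
  extension-cong (≋-trans e e′)      = ≋-trans (extension-cong e) (extension-cong e′)
  extension-cong (⊕-cong e e′)       = ⊕-cong (extension-cong e) (extension-cong e′)
  extension-cong (⊖-cong e)          = ⊖-cong (extension-cong e)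
  extension-cong (⊕-assoc u v w)     = ⊕-assoc _ _ _
  extension-cong (⊕-comm u v)        = ⊕-comm _ _
  extension-cong (⊕-identityˡ u)     = ⊕-identityˡ _
  extension-cong (⊖-inverseˡ u)      = ⊖-inverseˡ _
  extension-cong (⊗-cong e e′)       = ⊗-cong (onModule-cong e) (σˢ.⟦⟧-cong e′)
  extension-cong (⊗-distribʳ x y s)  = ≋-trans (⊗-cong (onModule-+ x y) S.refl) (⊗-distribʳ _ _ _)
  extension-cong (⊗-distribˡ x s s′) = ≋-trans (⊗-cong M.≈ᴹ-refl (σˢ.+-homo s s′)) (⊗-distribˡ _ _ _)
  extension-cong (⊗-balanced r x s)  = ≋-trans (⊗-cong (onModule-* r x) S.refl)
    (≋-trans (⊗-balanced _ _ _) (⊗-cong M.≈ᴹ-refl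
      (S.trans (S.*-congʳ (S.sym (commutes r))) (S.sym (σˢ.*-homo _ _)))))

module Setting {p : ℕ} (p-prime : Prime p) (k : CommutativeRing c ℓ) (char : k ofChar p) where

  k⟦t⟧ k⦅t⦆ : CommutativeRing c ℓ
  k⟦t⟧ = Series.powerSeries k
  k⦅t⦆ = LaurentSeries.laurentSeries k

  inclusion : k⟦t⟧ ⟶ k⦅t⦆
  inclusion = LaurentSeries.fromPowerSeries k

  char⟦⟧ : k⟦t⟧ ofChar p
  char⟦⟧ = powerSeries-char {p = p} {A = k} char

  char⦅⦆ : k⦅t⦆ ofChar p
  char⦅⦆ = hom-char {p = p} {A = k⟦t⟧} {B = k⦅t⦆} inclusion char⟦⟧

  open Witt p-prime using (W; W-map) public

  ι : W k⟦t⟧ ⟶ W k⦅t⦆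
  ι = W-map {A = k⟦t⟧} {B = k⦅t⦆} inclusion

  σ : W k⟦t⟧ ⟶ W k⟦t⟧
  σ = W-map {A = k⟦t⟧} {B = k⟦t⟧} (frobenius p-prime {A = k⟦t⟧} char⟦⟧)

  σ′ : W k⦅t⦆ ⟶ W k⦅t⦆
  σ′ = W-map {A = k⦅t⦆} {B = k⦅t⦆} (frobenius p-prime {A = k⦅t⦆} char⦅⦆)

  σ-ι : Commutes {R = W k⟦t⟧} {S = W k⦅t⦆} ι σ σ′
  σ-ι x n = CommutativeRing.sym k⦅t⦆ (Hom.^-homo {R = k⟦t⟧} {S = k⦅t⦆} inclusion (x n) p)

  σ^* : Module (W k⟦t⟧) m ℓm → Module (W k⟦t⟧) (m ⊔ c) (m ⊔ ℓm ⊔ c ⊔ ℓ)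
  σ^* M = BaseChange.baseChange {R = W k⟦t⟧} {S = W k⟦t⟧} σ M

  _⊗Wk⦅t⦆ : Module (W k⟦t⟧) m ℓm → Module (W k⦅t⦆) (m ⊔ c) (m ⊔ ℓm ⊔ c ⊔ ℓ)
  M ⊗Wk⦅t⦆ = BaseChange.baseChange {R = W k⟦t⟧} {S = W k⦅t⦆} ι M

  module _ {M : Module (W k⟦t⟧) m ℓm} where
    open Module (M ⊗Wk⦅t⦆) using () renaming (Carrierᴹ to M⊗Wk⦅t⦆)

    -- M as a submodule of M ⊗ W(k((t))); injective when M is free
    _⊗1 : Module.Carrierᴹ M → M⊗Wk⦅t⦆
    _⊗1 = BaseChange.embed {R = W k⟦t⟧} {S = W k⦅t⦆} ι M

    extend : LinearMap (σ^* M) M → M⊗Wk⦅t⦆ → M⊗Wk⦅t⦆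
    extend F = SemilinearExtension.extension {R = W k⟦t⟧} {S = W k⦅t⦆} ι σ σ′ σ-ι M F

-- M has basis e₁, e₂ and F has matrix ((α , 1) , (p⁴ , 0)), so that F is an isogeny (its determinant
-- is −p⁴) and a e₁ + p⁴ σ(a) e₂ is fixed by F if and only if a = α σ(a) + p⁴ σ²(a).  Write T = [1/t],
-- τ = [t^(p−1)], a = T C and α = τ (1 + ρ).  The equation becomes
-- C = (1 + ρ) σ(C) + p⁴ T^(p²−1) σ²(C), and it is solved by successive approximation from C = 1,
-- ρ = 0: an error y is removed up to higher order by adding δ to C and ε to ρ, where
-- δ − σ(δ) = ε + y.  For y = pⁿ T^(pʲ h) take δ = − Σ pⁿ T^(pⁱ h), summed over i < j, and
-- ε = − pⁿ T^h.  For α to be integral one needs h ≤ p − 1, and pⁿ T^h lies in W(k((t))) when pⁿ h is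
-- an integer, as pⁿ T^h = Vⁿ [t^(−pⁿ h)].  The error terms admit such h because each multiplication
-- by p⁴ makes room for more denominators in the exponents of T than are consumed.  The 0th
-- component of a is 1/t, so a is not integral.

module Submission where

open import Defs
open import Algebra.Bundles using (CommutativeMonoid; CommutativeRing)
open import Algebra.Module.Bundles using (Module)
import Algebra.Module.Construct.DirectProduct as DirectProduct
import Algebra.Module.Construct.TensorUnit as TensorUnit
open import Algebra.Morphism.Bundles using (RingHomomorphism)
import Algebra.Properties.AbelianGroup as AbelianGroupProps
import Algebra.Properties.CommutativeSemigroup as CommSemigroup
import Algebra.Properties.CommutativeSemiring.Exp as CommExp
import Algebra.Properties.Monoid.Mult as MonoidMult
import Algebra.Properties.Ring as RingProps
import Algebra.Properties.Semiring.Exp as Exp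
import Algebra.Properties.Semiring.Mult as Mult
import Algebra.Solver.Ring.NaturalCoefficients.Default as Solver
open import Data.Fin.Base using (Fin; zero; suc)
open import Data.Nat.Base as ℕ using (ℕ; zero; suc; z≤n; s≤s)
open import Data.Nat.GeneralisedArithmetic using (fold)
open import Data.Nat.Primality using (Prime)
import Data.Nat.Properties as ℕₚ
open import Data.Nat.Solver using (module +-*-Solver)
open import Data.Product.Base using (∃; _×_; _,_; proj₁; proj₂)
open import Data.Sum.Base using (inj₁; inj₂)
open import Level using (Level; _⊔_)
open import Relation.Binary.PropositionalEquality.Core as ≡ using (_≡_)
import Relation.Binary.Reasoning.Setoid as SetoidReasoning
open import Relation.Nullary.Negation.Core using (¬_)

open Polynomial using (Expr; var; ℤ[_]; eval)

-- Taking ε = -y would remove an error y at once, but integrality of α caps the exponent of T in ε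
-- at p - 1, and the first error p⁴ T^(p²-1) already exceeds it. Replacing T^(p h) by T^h at the
-- price of a σ-coboundary lowers the exponent but puts powers of p into its denominator. The
-- invariant that keeps both under control: a correction is a sum of terms pⁿ T^(pˡ h) with h ≤ p -
-- 1 and 2l ≤ n. In p⁴ T^(p²-1) σ²(δ) the exponents are at most (p - 1)(1 + p + p^(l+2)) ≤ (p - 1)
-- p^(l+3), so l grows by 3, of which splitting the error gives back 1; the factor p⁴ raises n by 4
-- = 2 (3 - 1), and this is where the exponent 4 comes from. Convergence is measured by powers of V,
-- since pⁿ T^h with fractional h need not be divisible by pⁿ.

private
  variable
    c ℓ c′ ℓ′ m ℓm : Level

-- Verschiebung and Teichmüller representatives on Witt vectors.

module WittOperators {p : ℕ} (p-prime : Prime p) (A : CommutativeRing c ℓ) where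
  open CommutativeRing A hiding (zero)
  open Ghost p-prime A
  open Congruence p-prime A
  open Mult semiring using (×-congʳ) renaming (_×_ to infixr 8 _×ₙ_)
  open Exp semiring using (_^_)

  V : (ℕ → Carrier) → ℕ → Carrier
  V x zero    = 0#
  V x (suc n) = x n

  [_] : Carrier → ℕ → Carrier
  [ a ] zero    = a
  [ a ] (suc n) = 0#

  ghost-V : ∀ n x → ghost (suc n) (V x) ≈ p ×ₙ ghost n x
  ghost-V n x = trans (+-congʳ (0^p^ (suc n))) (+-identityˡ _)

  ghost-[] : ∀ n a → ghost n [ a ] ≈ a ^ (p ℕ.^ n)
  ghost-[] zero    a = sym (*-identityʳ a)
  ghost-[] (suc n) a = trans (+-congˡ (trans (×-congʳ p (ghost-0 n)) (trans (×≈π* 0#) (zeroʳ π)))) (+-identityʳ _)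

  -- Converse of `ghost-≡`. Index 0 gives x₀ ≡ y₀ mod p, hence x₀^(p^(m+1)) ≡ y₀^(p^(m+1)) mod
  -- p^(m+2). Subtracting these leading terms leaves p times the ghost components of the shifted
  -- sequences, and one factor p cancels because there is no p-torsion.
  ghost-≡-injective : p TorsionFree.TorsionFree A →
    ∀ x y → (∀ n → ghost n x ≡ ghost n y mod^ suc n) → ∀ n → x n ≡ y n mod^ 1
  ghost-≡-injective tf x y h zero    = h 0
  ghost-≡-injective tf x y h (suc n) =
    ghost-≡-injective tf (λ i → x (suc i)) (λ i → y (suc i)) (λ m → shift m) n
    where
    cancel : ∀ a b → - a + (a + b) ≈ b
    cancel a b = trans (sym (+-assoc _ _ _)) (trans (+-congʳ (-‿inverseˡ a)) (+-identityˡ b))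
    shift : ∀ m → ghost m (λ i → x (suc i)) ≡ ghost m (λ i → y (suc i)) mod^ suc m
    shift m = q , Witt.p-cancel p-prime A tf _ _ (begin
      p ×ₙ gx                               ≈⟨ cancel _ _ ⟨
      - x₀ + (x₀ + p ×ₙ gx)                 ≈⟨ e ⟩
      - y₀ + (y₀ + p ×ₙ gy) + π * π ^ suc m * q ≈⟨ +-cong (cancel _ _) (*-assoc _ _ _) ⟩
      p ×ₙ gy + π * (π ^ suc m * q)         ≈⟨ +-congʳ (×≈π* gy) ⟩
      π * gy + π * (π ^ suc m * q)          ≈⟨ distribˡ π _ _ ⟨
      π * (gy + π ^ suc m * q)              ≈⟨ ×≈π* _ ⟨
      p ×ₙ (gy + π ^ suc m * q)             ∎)
      where
      open SetoidReasoning setoid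
      x₀ = x 0 ^ (p ℕ.^ suc m)
      y₀ = y 0 ^ (p ℕ.^ suc m)
      gx = ghost m (λ i → x (suc i))
      gy = ghost m (λ i → y (suc i))
      difference : (- x₀ + (x₀ + p ×ₙ gx)) ≡ (- y₀ + (y₀ + p ×ₙ gy)) mod^ suc (suc m)
      difference = ≡-+ {suc (suc m)} (≡-neg {suc (suc m)} (≡-^p^ (h 0) (suc m))) (h (suc m))
      q = proj₁ difference
      e = proj₂ difference

-- An identity between Witt vectors over A of characteristic p holds once the ghost components of
-- its two sides over ℤ[ℕ] are congruent modulo p^(n+1).

module Universal {p : ℕ} (p-prime : Prime p) (A : CommutativeRing c ℓ) (char : A ofChar p) where
  open CommutativeRing A hiding (zero)
  private
    Z = ℤ[ ℕ ]
    module Z = CommutativeRing Z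
    module U = WittOperators p-prime Z
    module WZ = CommutativeRing (Witt.W p-prime Z)
    module W = CommutativeRing (Witt.W p-prime A)
  open WittOperators p-prime A using (V; [_])
  open Ghost p-prime Z using (ghost; pow; ghost-suc)
  open Congruence p-prime Z using (_≡_mod^_; π; ×≈π*; ≈⇒≡; ≡-trans; ≡-π*; ≡-*)
  open Exp Z.semiring using (_^_)
  open CommExp Z.commutativeSemiring using (^-distrib-*)
  open Exp semiring using (^-congˡ) renaming (_^_ to _^ᴬ_)
  open Mult Z.semiring using (×-congʳ) renaming (_×_ to _×ᶻ_)
  open Mult W.semiring using () renaming (_×_ to _×ᵂ_)

  torsionFree : p TorsionFree.TorsionFree Z
  torsionFree with prime≥2 p-prime
  ... | m , ≡.refl = TorsionFree.torsionFree-ℕ (suc m)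

  -- Torsion-freeness is available for `ℤ[ ℕ ]`, so the variables of two generic Witt vectors share
  -- one sequence, at even and odd positions.
  interleave : {B : Set c′} → (ℕ → B) → (ℕ → B) → ℕ → B
  interleave x y 0             = x 0
  interleave x y 1             = y 0
  interleave x y (suc (suc n)) = interleave (λ i → x (suc i)) (λ i → y (suc i)) n

  interleave-even : {B : Set c′} (x y : ℕ → B) → ∀ i → interleave x y (i ℕ.* 2) ≡ x i
  interleave-even x y zero    = ≡.refl
  interleave-even x y (suc i) = interleave-even (λ i → x (suc i)) (λ i → y (suc i)) i

  interleave-odd : {B : Set c′} (x y : ℕ → B) → ∀ i → interleave x y (suc (i ℕ.* 2)) ≡ y i
  interleave-odd x y zero    = ≡.refl
  interleave-odd x y (suc i) = interleave-odd (λ i → x (suc i)) (λ i → y (suc i)) i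

  X Y : ℕ → Expr ℕ
  X i = var (i ℕ.* 2)
  Y i = var (suc (i ℕ.* 2))

  module At (x y : W.Carrier) where
    f : Z ⟶ A
    f = eval A (interleave x y)

    module M = RingHomomorphism (Witt.W-map p-prime {A = Z} {B = A} f)
    open Hom {R = Z} {S = A} f using (⟦_⟧; ⟦⟧-cong; +-homo; *-homo; 0#-homo; ×-homo)

    -- The components of `u` and `w` agree modulo p by `ghost-≡-injective`, and p becomes 0 in `A`.
    transfer : ∀ u w → (∀ n → ghost n u ≡ ghost n w mod^ suc n) → M.⟦ u ⟧ W.≈ M.⟦ w ⟧
    transfer u w h n with U.ghost-≡-injective torsionFree u w h n
    ... | q , e = trans (⟦⟧-cong e) (trans (+-homo (w n) (π ^ 1 Z.* q)) (trans (+-congˡ zero-term) (+-identityʳ _)))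
      where
      π-zero : ⟦ π ⟧ ≈ 0#
      π-zero = trans (×-homo p Z.1#) char
      zero-term : ⟦ π ^ 1 Z.* q ⟧ ≈ 0#
      zero-term = trans (*-homo (π ^ 1) q) (trans (*-congʳ (trans (*-homo π Z.1#) (trans (*-congʳ π-zero) (zeroˡ _)))) (zeroˡ _))

    M-X : M.⟦ X ⟧ W.≈ x
    M-X i = reflexive (interleave-even x y i)

    M-Y : M.⟦ Y ⟧ W.≈ y
    M-Y i = reflexive (interleave-odd x y i)

    M-V : ∀ {u w} → M.⟦ u ⟧ W.≈ w → M.⟦ U.V u ⟧ W.≈ V w
    M-V h zero    = 0#-homo
    M-V h (suc n) = h n

    M-[] : ∀ {a b} → ⟦ a ⟧ ≈ b → M.⟦ U.[ a ] ⟧ W.≈ [ b ]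
    M-[] h zero    = h
    M-[] h (suc n) = 0#-homo

    M-+ : ∀ {u w u′ w′} → M.⟦ u ⟧ W.≈ u′ → M.⟦ w ⟧ W.≈ w′ → M.⟦ u WZ.+ w ⟧ W.≈ u′ W.+ w′
    M-+ {u} {w} {u′} {w′} h k = W.trans {M.⟦ u WZ.+ w ⟧} {M.⟦ u ⟧ W.+ M.⟦ w ⟧} {u′ W.+ w′} (M.+-homo u w)
      (W.+-cong {M.⟦ u ⟧} {u′} {M.⟦ w ⟧} {w′} h k)

    M-* : ∀ {u w u′ w′} → M.⟦ u ⟧ W.≈ u′ → M.⟦ w ⟧ W.≈ w′ → M.⟦ u WZ.* w ⟧ W.≈ u′ W.* w′
    M-* {u} {w} {u′} {w′} h k = W.trans {M.⟦ u WZ.* w ⟧} {M.⟦ u ⟧ W.* M.⟦ w ⟧} {u′ W.* w′} (M.*-homo u w)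
      (W.*-cong {M.⟦ u ⟧} {u′} {M.⟦ w ⟧} {w′} h k)

    via : ∀ u w {u′ w′} → M.⟦ u ⟧ W.≈ u′ → M.⟦ w ⟧ W.≈ w′ → (∀ n → ghost n u ≡ ghost n w mod^ suc n) → u′ W.≈ w′
    via u w {u′} {w′} h k g = W.trans {u′} {M.⟦ u ⟧} {w′} (W.sym {M.⟦ u ⟧} {u′} h)
      (W.trans {M.⟦ u ⟧} {M.⟦ w ⟧} {w′} (transfer u w g) k)

  private
    ghost-+ = Witt.ghost-+ p-prime Z
    ghost-* = Witt.ghost-* p-prime Z
    ghost-1 = Witt.ghost-1 p-prime Z

  V-+ : ∀ x y → V (x W.+ y) W.≈ V x W.+ V y
  V-+ x y = via (U.V (X WZ.+ Y)) (U.V X WZ.+ U.V Y)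
    (M-V {X WZ.+ Y} {x W.+ y} (M-+ {X} {Y} {x} {y} M-X M-Y))
    (M-+ {U.V X} {U.V Y} {V x} {V y} (M-V {X} {x} M-X) (M-V {Y} {y} M-Y))
    λ n → ≈⇒≡ {suc n} (g n)
    where
    open At x y
    open SetoidReasoning Z.setoid
    g : ∀ n → ghost n (U.V (X WZ.+ Y)) Z.≈ ghost n (U.V X WZ.+ U.V Y)
    g zero    = Z.trans (Z.sym (Z.+-identityˡ Z.0#)) (Z.sym (ghost-+ 0 (U.V X) (U.V Y)))
    g (suc n) = begin
      ghost (suc n) (U.V (X WZ.+ Y))       ≈⟨ U.ghost-V n (X WZ.+ Y) ⟩
      p ×ᶻ ghost n (X WZ.+ Y)              ≈⟨ ×-congʳ p (ghost-+ n X Y) ⟩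
      p ×ᶻ (ghost n X Z.+ ghost n Y)       ≈⟨ ×≈π* _ ⟩
      π Z.* (ghost n X Z.+ ghost n Y)      ≈⟨ Z.distribˡ π _ _ ⟩
      π Z.* ghost n X Z.+ π Z.* ghost n Y  ≈⟨ Z.+-cong (Z.trans (U.ghost-V n X) (×≈π* _)) (Z.trans (U.ghost-V n Y) (×≈π* _)) ⟨
      ghost (suc n) (U.V X) Z.+ ghost (suc n) (U.V Y) ≈⟨ ghost-+ (suc n) (U.V X) (U.V Y) ⟨
      ghost (suc n) (U.V X WZ.+ U.V Y) ∎

  -- The leading summand x₀^(p^n) of the n-th ghost component belongs to [ x₀ ]; what remains is p
  -- times a ghost component of the shifted vector, hence a ghost component of its Verschiebung.
  decompose : ∀ x → x W.≈ [ x 0 ] W.+ V (λ i → x (suc i))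
  decompose x = via X (U.[ X 0 ] WZ.+ U.V (λ i → X (suc i))) M-X
    (M-+ {U.[ X 0 ]} {U.V (λ i → X (suc i))} {[ x 0 ]} {V (λ i → x (suc i))}
      (M-[] {X 0} {x 0} (M-X 0)) (M-V {λ i → X (suc i)} {λ i → x (suc i)} (λ i → M-X (suc i))))
    λ n → ≈⇒≡ {suc n} (g n)
    where
    open At x x
    g : ∀ n → ghost n X Z.≈ ghost n (U.[ X 0 ] WZ.+ U.V (λ i → X (suc i)))
    g zero    = Z.trans (Z.sym (Z.+-identityʳ _)) (Z.sym (ghost-+ 0 U.[ X 0 ] (U.V (λ i → X (suc i)))))
    g (suc n) = Z.trans (Z.+-cong (Z.sym (U.ghost-[] (suc n) (X 0))) (Z.sym (U.ghost-V n (λ i → X (suc i)))))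
      (Z.sym (ghost-+ (suc n) U.[ X 0 ] (U.V (λ i → X (suc i)))))

  []-* : ∀ a b → [ a * b ] W.≈ [ a ] W.* [ b ]
  []-* a b = via U.[ X 0 Z.* Y 0 ] (U.[ X 0 ] WZ.* U.[ Y 0 ])
    (M-[] {X 0 Z.* Y 0} {a * b} refl)
    (M-* {U.[ X 0 ]} {U.[ Y 0 ]} {[ a ]} {[ b ]} (M-[] {X 0} {a} refl) (M-[] {Y 0} {b} refl))
    λ n → ≈⇒≡ {suc n} (Z.trans (U.ghost-[] n (X 0 Z.* Y 0)) (Z.trans (^-distrib-* (X 0) (Y 0) (p ℕ.^ n))
      (Z.sym (Z.trans (ghost-* n U.[ X 0 ] U.[ Y 0 ]) (Z.*-cong (U.ghost-[] n (X 0)) (U.ghost-[] n (Y 0)))))))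
    where
    open At [ a ] [ b ]

  σ : W.Carrier → W.Carrier
  σ x n = x n ^ᴬ p

  -- This is where characteristic p enters: ghost (n + 1) y is ghost n (pow y) only modulo p^(n+1).
  V-projection : ∀ x y → V x W.* y W.≈ V (x W.* σ y)
  V-projection x y = via (U.V X WZ.* Y) (U.V (X WZ.* pow Y))
    (M-* {U.V X} {Y} {V x} {y} (M-V {X} {x} M-X) M-Y)
    (M-V {X WZ.* pow Y} {x W.* σ y} (M-* {X} {pow Y} {x} {σ y} M-X
      (λ i → trans (^-homo (Y i) p) (^-congˡ p (M-Y i)))))
    g
    where
    open At x y
    open Hom {R = Z} {S = A} f using (^-homo)
    open SetoidReasoning Z.setoid
    g : ∀ n → ghost n (U.V X WZ.* Y) ≡ ghost n (U.V (X WZ.* pow Y)) mod^ suc n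
    g zero    = ≈⇒≡ {1} (Z.trans (ghost-* 0 (U.V X) Y) (Z.zeroˡ _))
    g (suc n) = ≡-trans {suc (suc n)} (≈⇒≡ {suc (suc n)} (begin
        ghost (suc n) (U.V X WZ.* Y)                 ≈⟨ ghost-* (suc n) (U.V X) Y ⟩
        ghost (suc n) (U.V X) Z.* ghost (suc n) Y    ≈⟨ Z.*-congʳ (Z.trans (U.ghost-V n X) (×≈π* _)) ⟩
        π Z.* ghost n X Z.* ghost (suc n) Y          ≈⟨ Z.*-assoc _ _ _ ⟩
        π Z.* (ghost n X Z.* ghost (suc n) Y) ∎))
      (≡-trans {suc (suc n)}
        (≡-π* {suc n} (≡-* {suc n} {ghost n X} (≈⇒≡ {suc n} Z.refl) (Y (suc n) , ghost-suc n Y)))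
        (≈⇒≡ {suc (suc n)} (begin
          π Z.* (ghost n X Z.* ghost n (pow Y))      ≈⟨ Z.*-congˡ (ghost-* n X (pow Y)) ⟨
          π Z.* ghost n (X WZ.* pow Y)               ≈⟨ Z.trans (U.ghost-V n (X WZ.* pow Y)) (×≈π* _) ⟨
          ghost (suc n) (U.V (X WZ.* pow Y)) ∎)))

  p≈V1 : p ×ᵂ W.1# W.≈ V W.1#
  p≈V1 = via (p ×ᵂᶻ WZ.1#) (U.V WZ.1#)
    (λ n → trans (×ᴹ-homo p WZ.1# n) (×ᵂ-cong p (λ n → M.1#-homo n) n))
    (M-V {WZ.1#} {W.1#} M.1#-homo)
    g
    where
    open At W.1# W.1#
    open Mult WZ.semiring using () renaming (_×_ to _×ᵂᶻ_)
    open Hom {R = Witt.W p-prime Z} {S = Witt.W p-prime A} (Witt.W-map p-prime {A = Z} {B = A} f)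
      using () renaming (×-homo to ×ᴹ-homo)
    ×ᵂ-cong : ∀ n {x y} → x W.≈ y → n ×ᵂ x W.≈ n ×ᵂ y
    ×ᵂ-cong n = Mult.×-congʳ W.semiring n
    ghost-× : ∀ m n → ghost n (m ×ᵂᶻ WZ.1#) Z.≈ m ×ᶻ Z.1#
    ghost-× zero    n = Ghost.ghost-0 p-prime Z n
    ghost-× (suc m) n = Z.trans (ghost-+ n WZ.1# (m ×ᵂᶻ WZ.1#)) (Z.+-cong (ghost-1 n) (ghost-× m n))
    g : ∀ n → ghost n (p ×ᵂᶻ WZ.1#) ≡ ghost n (U.V WZ.1#) mod^ suc n
    -- At index 0 the ghost components are p and 0, which agree only modulo p; at all other indices
    -- both are p.
    g zero    = Z.1# , Z.trans (ghost-× p 0) (Z.sym (Z.trans (Z.+-identityˡ _)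
      (Z.trans (Z.*-identityʳ _) (Z.*-identityʳ π))))
    g (suc n) = ≈⇒≡ {suc (suc n)} (Z.trans (ghost-× p (suc n))
      (Z.sym (Z.trans (U.ghost-V n WZ.1#) (×-congʳ p (ghost-1 n)))))

-- Rings with Frobenius and Verschiebung.

-- The properties of W(A), for A of characteristic p, on which the approximation argument rests;
-- Witt components no longer appear. Separatedness and completeness refer to the filtration by Vⁿ,
-- because pⁿ T^h with fractional h is an n-fold Verschiebung but in general not a multiple of pⁿ.
record Verschiebung (p : ℕ) (R : CommutativeRing c ℓ) : Set (c ⊔ ℓ) where
  open CommutativeRing R hiding (zero)
  open Mult semiring using () renaming (_×_ to infixr 8 _×ₙ_)
  field
    frobenius-hom : R ⟶ R
    V : Carrier → Carrier
  open RingHomomorphism frobenius-hom public using ()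
    renaming (⟦_⟧ to σ; ⟦⟧-cong to σ-cong; +-homo to σ-+; *-homo to σ-*; 0#-homo to σ-0; 1#-homo to σ-1; -‿homo to σ-neg)
  field
    V-cong : ∀ {x y} → x ≈ y → V x ≈ V y
    V-+ : ∀ x y → V (x + y) ≈ V x + V y
    σ-V : ∀ x → σ (V x) ≈ V (σ x)
    V-projection : ∀ x y → V x * y ≈ V (x * σ y)
    p≈V1 : p ×ₙ 1# ≈ V 1#

    separated : ∀ x y → (∀ n → ∃ λ z → x ≈ y + fold z V n) → x ≈ y
    complete  : ∀ (x : ℕ → Carrier) → (∀ n → ∃ λ z → x (suc n) ≈ x n + fold z V (suc n)) →
                ∃ λ y → ∀ n → ∃ λ z → y ≈ x n + fold z V (suc n)

  infixr 9 V^_·_ σ^_·_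

  V^_·_ σ^_·_ : ℕ → Carrier → Carrier
  V^ n · x = fold x V n
  σ^ n · x = fold x σ n

  infix 4 _≡_modV^_

  _≡_modV^_ : Carrier → Carrier → ℕ → Set (c ⊔ ℓ)
  x ≡ y modV^ n = ∃ λ z → x ≈ y + V^ n · z

  open RingProps ring using (+-identityˡ-unique; +-inverseˡ-unique)

  V-0 : V 0# ≈ 0#
  V-0 = +-identityˡ-unique _ _ (trans (sym (V-+ 0# 0#)) (V-cong (+-identityˡ 0#)))

  V-neg : ∀ x → V (- x) ≈ - V x
  V-neg x = +-inverseˡ-unique _ _ (trans (sym (V-+ (- x) x)) (trans (V-cong (-‿inverseˡ x)) V-0))

  V^-cong : ∀ n {x y} → x ≈ y → V^ n · x ≈ V^ n · y
  V^-cong zero    e = e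
  V^-cong (suc n) e = V-cong (V^-cong n e)

  V^-+ : ∀ n x y → V^ n · (x + y) ≈ V^ n · x + V^ n · y
  V^-+ zero    x y = refl
  V^-+ (suc n) x y = trans (V-cong (V^-+ n x y)) (V-+ _ _)

  V^-0 : ∀ n → V^ n · 0# ≈ 0#
  V^-0 zero    = refl
  V^-0 (suc n) = trans (V-cong (V^-0 n)) V-0

  V^-neg : ∀ n x → V^ n · (- x) ≈ - (V^ n · x)
  V^-neg zero    x = refl
  V^-neg (suc n) x = trans (V-cong (V^-neg n x)) (V-neg _)

  V^-V^ : ∀ m n x → V^ (m ℕ.+ n) · x ≡ V^ m · V^ n · x
  V^-V^ zero    n x = ≡.refl
  V^-V^ (suc m) n x = ≡.cong V (V^-V^ m n x)

  σ-V^ : ∀ n x → σ (V^ n · x) ≈ V^ n · σ x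
  σ-V^ zero    x = refl
  σ-V^ (suc n) x = trans (σ-V _) (V-cong (σ-V^ n x))

  σ^-cong : ∀ n {x y} → x ≈ y → σ^ n · x ≈ σ^ n · y
  σ^-cong zero    e = e
  σ^-cong (suc n) e = σ-cong (σ^-cong n e)

  σ^-suc : ∀ n x → σ^ suc n · x ≡ σ^ n · σ x
  σ^-suc zero    x = ≡.refl
  σ^-suc (suc n) x = ≡.cong σ (σ^-suc n x)

  σ^-V^ : ∀ m n x → σ^ m · V^ n · x ≈ V^ n · σ^ m · x
  σ^-V^ zero    n x = refl
  σ^-V^ (suc m) n x = trans (σ-cong (σ^-V^ m n x)) (σ-V^ n _)

  V^-projection : ∀ n x y → V^ n · x * y ≈ V^ n · (x * σ^ n · y)
  V^-projection zero    x y = refl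
  V^-projection (suc n) x y = trans (V-projection _ _) (V-cong (trans (V^-projection n x (σ y))
    (V^-cong n (*-congˡ (reflexive (≡.sym (σ^-suc n y)))))))

  V^≥ : ∀ {m n} → m ℕ.≤ n → ∀ x → ∃ λ z → V^ n · x ≈ V^ m · z
  V^≥ {m} m≤n x with ℕₚ.m≤n⇒∃[o]m+o≡n m≤n
  ... | o , ≡.refl = V^ o · x , reflexive (V^-V^ m o x)

  p^≈V^1 : ∀ n → (p ℕ.^ n) ×ₙ 1# ≈ V^ n · 1#
  p^≈V^1 zero    = +-identityʳ 1#
  p^≈V^1 (suc n) = begin
    (p ℕ.* p ℕ.^ n) ×ₙ 1#         ≈⟨ Mult.×1-homo-* semiring p (p ℕ.^ n) ⟩
    (p ×ₙ 1#) * ((p ℕ.^ n) ×ₙ 1#)  ≈⟨ *-cong p≈V1 (p^≈V^1 n) ⟩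
    V 1# * V^ n · 1#             ≈⟨ V-projection 1# _ ⟩
    V (1# * σ (V^ n · 1#))       ≈⟨ V-cong (trans (*-identityˡ _) (trans (σ-V^ n 1#) (V^-cong n σ-1))) ⟩
    V (V^ n · 1#)                ∎
    where open SetoidReasoning setoid

  open Solver commutativeSemiring using (solve; _:=_; _:+_; _:*_)

  ≈⇒≡V : ∀ {n x y} → x ≈ y → x ≡ y modV^ n
  ≈⇒≡V {n} e = 0# , trans e (sym (trans (+-congˡ (V^-0 n)) (+-identityʳ _)))

  ≡V-sym : ∀ {n x y} → x ≡ y modV^ n → y ≡ x modV^ n
  ≡V-sym {n} {x} {y} (z , e) = - z , (begin
    y                              ≈⟨ +-identityʳ y ⟨
    y + 0#                         ≈⟨ +-congˡ (-‿inverseʳ _) ⟨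
    y + (V^ n · z - V^ n · z)      ≈⟨ +-assoc _ _ _ ⟨
    y + V^ n · z - V^ n · z        ≈⟨ +-cong (sym e) (sym (V^-neg n z)) ⟩
    x + V^ n · (- z) ∎)
    where open SetoidReasoning setoid

  ≡V-trans : ∀ {n x y z} → x ≡ y modV^ n → y ≡ z modV^ n → x ≡ z modV^ n
  ≡V-trans {n} (a , e) (b , e′) = b + a , trans e (trans (+-congʳ e′) (trans (+-assoc _ _ _) (+-congˡ (sym (V^-+ n b a)))))

  ≡V-weaken : ∀ {m n x y} → m ℕ.≤ n → x ≡ y modV^ n → x ≡ y modV^ m
  ≡V-weaken m≤n (z , e) with V^≥ m≤n z
  ... | z′ , e′ = z′ , trans e (+-congˡ e′)

  ≡V-+ : ∀ {n x x′ y y′} → x ≡ x′ modV^ n → y ≡ y′ modV^ n → (x + y) ≡ (x′ + y′) modV^ n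
  ≡V-+ {n} (a , e) (b , e′) = a + b , trans (+-cong e e′) (trans
    (solve 4 (λ x y a b → (x :+ a) :+ (y :+ b) := (x :+ y) :+ (a :+ b)) refl _ _ _ _) (+-congˡ (sym (V^-+ n a b))))

  -- The projection formula makes the image of Vⁿ an ideal; it is the source of the twists by σⁿ in
  -- the witness.
  ≡V-* : ∀ {n x x′ y y′} → x ≡ x′ modV^ n → y ≡ y′ modV^ n → (x * y) ≡ (x′ * y′) modV^ n
  ≡V-* {n} {x} {x′} {y} {y′} (a , e) (b , e′) = a * σ^ n · y + b * σ^ n · x′ , (begin
    x * y                                              ≈⟨ *-congʳ e ⟩
    (x′ + V^ n · a) * y                                ≈⟨ distribʳ _ _ _ ⟩
    x′ * y + V^ n · a * y                              ≈⟨ +-congʳ (trans (*-congˡ e′) (distribˡ _ _ _)) ⟩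
    x′ * y′ + x′ * V^ n · b + V^ n · a * y             ≈⟨ +-cong (+-congˡ (trans (*-comm _ _) (V^-projection n b x′))) (V^-projection n a y) ⟩
    x′ * y′ + V^ n · (b * σ^ n · x′) + V^ n · (a * σ^ n · y) ≈⟨ trans (+-assoc _ _ _) (+-congˡ (+-comm _ _)) ⟩
    x′ * y′ + (V^ n · (a * σ^ n · y) + V^ n · (b * σ^ n · x′)) ≈⟨ +-congˡ (V^-+ n _ _) ⟨
    x′ * y′ + V^ n · (a * σ^ n · y + b * σ^ n · x′) ∎)
    where open SetoidReasoning setoid

  ≡V-σ : ∀ {n x x′} → x ≡ x′ modV^ n → σ x ≡ σ x′ modV^ n
  ≡V-σ {n} (a , e) = σ a , trans (σ-cong e) (trans (σ-+ _ _) (+-congˡ (σ-V^ n a)))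

-- Monomials pⁿ T^h with fractional exponents, and their sums.

-- T H plays the role of the Teichmüller representative of t^(-H).
record IsExponential {p : ℕ} {R : CommutativeRing c ℓ} (verschiebung : Verschiebung p R)
                     (T : ℕ → CommutativeRing.Carrier R) : Set (c ⊔ ℓ) where
  open CommutativeRing R
  open Verschiebung verschiebung
  field
    T-0 : T 0 ≈ 1#
    T-+ : ∀ m n → T (m ℕ.+ n) ≈ T m * T n
    σ-T : ∀ n → σ (T n) ≈ T (p ℕ.* n)

module Monomials {p : ℕ} (R : CommutativeRing c ℓ) (verschiebung : Verschiebung p R)
  (T : ℕ → CommutativeRing.Carrier R) (exponential : IsExponential verschiebung T) where
  open CommutativeRing R hiding (zero)
  open Verschiebung verschiebung
  open IsExponential exponential
  open SetoidReasoning setoid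
  open RingProps ring using (-‿distribˡ-*; -‿distribʳ-*)

  -- This is pⁿ T^(H / pⁿ): the n-fold Verschiebung gives a meaning to an exponent with denominator
  -- pⁿ.
  mon : ℕ → ℕ → Carrier
  mon n H = V^ n · T H

  mon-cong : ∀ n {H G} → H ≡ G → mon n H ≈ mon n G
  mon-cong n e = reflexive (≡.cong (mon n) e)

  σ^-T : ∀ m n → σ^ m · T n ≈ T (p ℕ.^ m ℕ.* n)
  σ^-T zero    n = reflexive (≡.cong T (≡.sym (ℕₚ.*-identityˡ n)))
  σ^-T (suc m) n = trans (σ-cong (σ^-T m n)) (trans (σ-T _) (reflexive (≡.cong T (≡.sym (ℕₚ.*-assoc p (p ℕ.^ m) n)))))

  σ-mon : ∀ n H → σ (mon n H) ≈ mon n (p ℕ.* H)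
  σ-mon n H = trans (σ-V^ n (T H)) (V^-cong n (σ-T H))

  -- Exponents add: H / p^a + G / p^b = (p^b H + p^a G) / p^(a+b).
  mon-* : ∀ a H b G → mon a H * mon b G ≈ mon (a ℕ.+ b) (p ℕ.^ b ℕ.* H ℕ.+ p ℕ.^ a ℕ.* G)
  mon-* a H b G = begin
    V^ a · T H * V^ b · T G                  ≈⟨ V^-projection a _ _ ⟩
    V^ a · (T H * σ^ a · V^ b · T G)         ≈⟨ V^-cong a (*-congˡ (trans (σ^-V^ a b _) (V^-cong b (σ^-T a G)))) ⟩
    V^ a · (T H * V^ b · T (p ℕ.^ a ℕ.* G))  ≈⟨ V^-cong a (trans (*-comm _ _) (V^-projection b _ _)) ⟩
    V^ a · V^ b · (T (p ℕ.^ a ℕ.* G) * σ^ b · T H) ≈⟨ V^-cong a (V^-cong b (trans (*-comm _ _) (*-congʳ (σ^-T b H)))) ⟩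
    V^ a · V^ b · (T (p ℕ.^ b ℕ.* H) * T (p ℕ.^ a ℕ.* G)) ≈⟨ V^-cong a (V^-cong b (T-+ _ _)) ⟨
    V^ a · V^ b · T (p ℕ.^ b ℕ.* H ℕ.+ p ℕ.^ a ℕ.* G)    ≡⟨ V^-V^ a b _ ⟨
    mon (a ℕ.+ b) (p ℕ.^ b ℕ.* H ℕ.+ p ℕ.^ a ℕ.* G) ∎

  -- The additive group generated by the monomials that satisfy `P`. Membership is kept as a
  -- derivation, so that an additive property needs an argument only at `monomial`, while `resp`
  -- absorbs ring identities.
  data Span (P : ℕ → ℕ → Set) : Carrier → Set (c ⊔ ℓ) where
    monomial : ∀ {n H} → P n H → Span P (mon n H)
    zeroˢ    : Span P 0#
    _+ˢ_     : ∀ {x y} → Span P x → Span P y → Span P (x + y)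
    negˢ     : ∀ {x} → Span P x → Span P (- x)
    resp     : ∀ {x y} → x ≈ y → Span P x → Span P y

  infixl 6 _+ˢ_

  private
    variable
      P Q S : ℕ → ℕ → Set
      x y : Carrier

  mapˢ : (∀ {n H} → P n H → Q n H) → Span P x → Span Q x
  mapˢ f (monomial g) = monomial (f g)
  mapˢ f zeroˢ        = zeroˢ
  mapˢ f (u +ˢ v)     = mapˢ f u +ˢ mapˢ f v
  mapˢ f (negˢ u)     = negˢ (mapˢ f u)
  mapˢ f (resp e u)   = resp e (mapˢ f u)

  data Only (n H : ℕ) : ℕ → ℕ → Set where
    only : Only n H n H

  data Shifted (P : ℕ → ℕ → Set) : ℕ → ℕ → Set where
    shifted : ∀ {n H} → P n H → Shifted P n (p ℕ.* H)

  σˢ : Span P x → Span (Shifted P) (σ x)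
  σˢ (monomial {n} {H} g) = resp (sym (σ-mon n H)) (monomial (shifted g))
  σˢ zeroˢ        = resp (sym σ-0) zeroˢ
  σˢ (u +ˢ v)     = resp (sym (σ-+ _ _)) (σˢ u +ˢ σˢ v)
  σˢ (negˢ u)     = resp (sym (σ-neg _)) (negˢ (σˢ u))
  σˢ (resp e u)   = resp (σ-cong e) (σˢ u)

  _*ˢ_by_ : Span P x → Span Q y →
            (∀ {a H b G} → P a H → Q b G → S (a ℕ.+ b) (p ℕ.^ b ℕ.* H ℕ.+ p ℕ.^ a ℕ.* G)) → Span S (x * y)
  monomial {a} {H} g *ˢ monomial {b} {G} h by f = resp (sym (mon-* a H b G)) (monomial (f g h))
  u          *ˢ zeroˢ      by f = resp (sym (zeroʳ _)) zeroˢ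
  u          *ˢ (v +ˢ w)   by f = resp (sym (distribˡ _ _ _)) ((u *ˢ v by f) +ˢ (u *ˢ w by f))
  u          *ˢ negˢ v     by f = resp (-‿distribʳ-* _ _) (negˢ (u *ˢ v by f))
  u          *ˢ resp e v   by f = resp (*-congˡ e) (u *ˢ v by f)
  zeroˢ      *ˢ v          by f = resp (sym (zeroˡ _)) zeroˢ
  (u +ˢ w)   *ˢ v          by f = resp (sym (distribʳ _ _ _)) ((u *ˢ v by f) +ˢ (w *ˢ v by f))
  negˢ u     *ˢ v          by f = resp (-‿distribˡ-* _ _) (negˢ (u *ˢ v by f))
  resp e u   *ˢ v          by f = resp (*-congʳ e) (u *ˢ v by f)

  -- Each `mon n H` is an n-fold Verschiebung, so lower bounds on n become congruences modulo V^ν.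
  Span⇒V^ : ∀ {ν} → (∀ {n H} → P n H → ν ℕ.≤ n) → Span P x → ∃ λ z → x ≈ V^ ν · z
  Span⇒V^ f (monomial g) = V^≥ (f g) _
  Span⇒V^ {ν = ν} f zeroˢ = 0# , sym (V^-0 ν)
  Span⇒V^ {ν = ν} f (u +ˢ v) with Span⇒V^ f u | Span⇒V^ f v
  ... | a , e | b , e′ = a + b , trans (+-cong e e′) (sym (V^-+ ν a b))
  Span⇒V^ {ν = ν} f (negˢ u) with Span⇒V^ f u
  ... | a , e = - a , trans (-‿cong e) (sym (V^-neg ν a))
  Span⇒V^ f (resp r u) with Span⇒V^ f u
  ... | a , e = a , trans (sym r) e

-- The V-adic topology of W(A).

module WittVerschiebung {p : ℕ} (p-prime : Prime p) (A : CommutativeRing c ℓ) (char : A ofChar p) where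
  private
    module A = CommutativeRing A
  open CommutativeRing (Witt.W p-prime A) hiding (zero)
  open WittOperators p-prime A using (V; [_])
  open Universal p-prime A char using (V-+; decompose; V-projection; p≈V1)
  open SetoidReasoning setoid

  tail : Carrier → Carrier
  tail x i = x (suc i)

  tail^ : ℕ → Carrier → Carrier
  tail^ zero    x = x
  tail^ (suc n) x = tail^ n (tail x)

  V^ : ℕ → Carrier → Carrier
  V^ n x = fold x V n

  truncate : ℕ → Carrier → Carrier
  truncate zero    x i       = A.0#
  truncate (suc n) x zero    = x 0
  truncate (suc n) x (suc i) = truncate n (tail x) i

  V-cong : ∀ {x y} → x ≈ y → V x ≈ V y
  V-cong h zero    = A.refl
  V-cong h (suc n) = h n

  V^-cong : ∀ n {x y} → x ≈ y → V^ n x ≈ V^ n y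
  V^-cong zero    {x} {y} h = h
  V^-cong (suc n) {x} {y} h = V-cong {V^ n x} {V^ n y} (V^-cong n {x} {y} h)

  V^-+ : ∀ n x y → V^ n (x + y) ≈ V^ n x + V^ n y
  V^-+ zero    x y = refl {x + y}
  V^-+ (suc n) x y = trans {V^ (suc n) (x + y)} {V (V^ n x + V^ n y)} {V^ (suc n) x + V^ (suc n) y}
    (V-cong {V^ n (x + y)} {V^ n x + V^ n y} (V^-+ n x y)) (V-+ (V^ n x) (V^ n y))

  shift-+ : ∀ a x y → ([ a ] + V x) + V y ≈ [ a ] + V (x + y)
  shift-+ a x y = trans {([ a ] + V x) + V y} {[ a ] + (V x + V y)} {[ a ] + V (x + y)}
    (+-assoc [ a ] (V x) (V y))
    (+-cong {[ a ]} {[ a ]} {V x + V y} {V (x + y)} (refl {[ a ]}) (sym {V (x + y)} {V x + V y} (V-+ x y)))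

  []+V-cong : ∀ a {x y} → x ≈ y → [ a ] + V x ≈ [ a ] + V y
  []+V-cong a {x} {y} h = +-cong {[ a ]} {[ a ]} {V x} {V y} (refl {[ a ]}) (V-cong {x} {y} h)

  decompose^ : ∀ n x → x ≈ truncate n x + V^ n (tail^ n x)
  decompose^ zero    x = sym {0# + x} {x} (+-identityˡ x)
  decompose^ (suc n) x = begin
    x                                                        ≈⟨ decompose x ⟩
    [ x 0 ] + V (tail x)                                     ≈⟨ []+V-cong (x 0) {tail x} {truncate n (tail x) + w} (decompose^ n (tail x)) ⟩
    [ x 0 ] + V (truncate n (tail x) + w)                    ≈⟨ shift-+ (x 0) (truncate n (tail x)) w ⟨
    ([ x 0 ] + V (truncate n (tail x))) + V w                ≈⟨ +-cong {truncate (suc n) x} {_} {V w} {V w} (decompose (truncate (suc n) x)) (refl {V w}) ⟨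
    truncate (suc n) x + V w ∎
    where w = V^ n (tail^ n (tail x))

  -- Since [ x₀ ] + V (tail x) + V (Vⁿ z) = [ x₀ ] + V (tail x + Vⁿ z), component 0 is untouched and
  -- the others follow by recursion on the tail.
  component-+V^ : ∀ n x z i → i ℕ.< n → (x + V^ n z) i A.≈ x i
  component-+V^ (suc n) x z i i<n = A.trans (e i) (component i i<n)
    where
    y : Carrier
    y zero    = x 0
    y (suc j) = (tail x + V^ n z) j
    e : x + V^ (suc n) z ≈ y
    e = begin
      x + V (V^ n z)                       ≈⟨ +-cong {x} {_} {V (V^ n z)} {V (V^ n z)} (decompose x) (refl {V (V^ n z)}) ⟩
      ([ x 0 ] + V (tail x)) + V (V^ n z)  ≈⟨ shift-+ (x 0) (tail x) (V^ n z) ⟩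
      [ x 0 ] + V (tail x + V^ n z)        ≈⟨ decompose y ⟨
      y ∎
    component : ∀ i → i ℕ.< suc n → y i A.≈ x i
    component zero    _         = A.refl
    component (suc j) (s≤s j<n) = component-+V^ n (tail x) z j j<n

  truncate-cong : ∀ n {x y} → (∀ i → i ℕ.< n → x i A.≈ y i) → truncate n x ≈ truncate n y
  truncate-cong zero    h i       = A.refl
  truncate-cong (suc n) h zero    = h 0 (s≤s z≤n)
  truncate-cong (suc n) h (suc i) = truncate-cong n (λ j j<n → h (suc j) (s≤s j<n)) i

  V^-neg : ∀ n x → V^ n (- x) ≈ - V^ n x
  V^-neg n x = RingProps.+-inverseˡ-unique ring (V^ n (- x)) (V^ n x) (begin
    V^ n (- x) + V^ n x   ≈⟨ V^-+ n (- x) x ⟨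
    V^ n (- x + x)        ≈⟨ V^-cong n { - x + x} {0#} (-‿inverseˡ x) ⟩
    V^ n 0#               ≈⟨ V^0 n ⟩
    0# ∎)
    where
    V^0 : ∀ n → V^ n 0# ≈ 0#
    V^0 zero    = refl {0#}
    V^0 (suc n) zero    = A.refl
    V^0 (suc n) (suc i) = V^0 n i

  -- By `decompose^` each vector is its truncation plus an n-fold Verschiebung, and here the
  -- truncations coincide.
  agree⇒≡ : ∀ n x y → (∀ i → i ℕ.< n → x i A.≈ y i) → ∃ λ z → x ≈ y + V^ n z
  agree⇒≡ n x y h = - v + u , (begin
    x                                        ≈⟨ decompose^ n x ⟩
    truncate n x + V^ n u                    ≈⟨ +-congʳ {V^ n u} {truncate n x} {truncate n y} (truncate-cong n {x} {y} h) ⟩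
    truncate n y + V^ n u                    ≈⟨ +-congʳ {V^ n u} {truncate n y} {y + V^ n (- v)} back ⟩
    (y + V^ n (- v)) + V^ n u                ≈⟨ +-assoc y (V^ n (- v)) (V^ n u) ⟩
    y + (V^ n (- v) + V^ n u)                ≈⟨ +-congˡ {y} {V^ n (- v + u)} {V^ n (- v) + V^ n u} (V^-+ n (- v) u) ⟨
    y + V^ n (- v + u) ∎)
    where
    u = tail^ n x
    v = tail^ n y
    back : truncate n y ≈ y + V^ n (- v)
    back = begin
      truncate n y                               ≈⟨ +-identityʳ (truncate n y) ⟨
      truncate n y + 0#                          ≈⟨ +-congˡ {truncate n y} {V^ n v - V^ n v} {0#} (-‿inverseʳ (V^ n v)) ⟨
      truncate n y + (V^ n v - V^ n v)           ≈⟨ +-assoc (truncate n y) (V^ n v) (- V^ n v) ⟨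
      truncate n y + V^ n v - V^ n v             ≈⟨ +-cong {y} {truncate n y + V^ n v} {V^ n (- v)} { - V^ n v} (decompose^ n y) (V^-neg n v) ⟨
      y + V^ n (- v) ∎

  stable : ∀ (x : ℕ → Carrier) → (∀ n i → i ℕ.≤ n → x (suc n) i A.≈ x n i) → ∀ n i → i ℕ.≤ n → x n i A.≈ x i i
  stable x h zero    zero z≤n = A.refl
  stable x h (suc n) i i≤n with ℕₚ.m≤n⇒m<n∨m≡n i≤n
  ... | inj₂ ≡.refl = A.refl
  ... | inj₁ (s≤s i≤n′) = A.trans (h n i i≤n′) (stable x h n i i≤n′)

  separated : ∀ x y → (∀ n → ∃ λ z → x ≈ y + V^ n z) → x ≈ y
  separated x y h i = A.trans (proj₂ (h (suc i)) i) (component-+V^ (suc i) y (proj₁ (h (suc i))) i ℕₚ.≤-refl)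

  -- By `component-+V^`, component i no longer changes from x i on, so the diagonal is the limit;
  -- `agree⇒≡` turns equality of components back into a congruence.
  complete : ∀ (x : ℕ → Carrier) → (∀ n → ∃ λ z → x (suc n) ≈ x n + V^ (suc n) z) →
             ∃ λ y → ∀ n → ∃ λ z → y ≈ x n + V^ (suc n) z
  complete x h = diagonal , λ n → agree⇒≡ (suc n) diagonal (x n) (λ i i<n → A.sym (stable x step n i (ℕₚ.≤-pred i<n)))
    where
    diagonal : Carrier
    diagonal i = x i i
    step : ∀ n i → i ℕ.≤ n → x (suc n) i A.≈ x n i
    step n i i≤n = A.trans (proj₂ (h n) i) (component-+V^ (suc n) (x n) (proj₁ (h n)) i (s≤s i≤n))

  verschiebung : Verschiebung p (Witt.W p-prime A)
  verschiebung = record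
    { frobenius-hom = Witt.W-map p-prime {A = A} {B = A} (frobenius p-prime {A = A} char)
    ; V            = V
    ; V-cong       = λ {x} {y} → V-cong {x} {y}
    ; V-+          = V-+
    ; σ-V          = λ { x zero → Congruence.0^p p-prime A ; x (suc i) → A.refl }
    ; V-projection = V-projection
    ; p≈V1         = p≈V1
    ; separated    = separated
    ; complete     = complete
    }

-- Exponent estimates.

-- A pair (n , E) stands for p^n T^(E / p^n).  The factor p^l is what the exponent can be divided by
-- when the monomial is moved by σ-coboundaries.

module Exponents (p B : ℕ) (2≤p : 2 ℕ.≤ p) where

  -- Equal to p² - 1 when B = p - 1.
  N : ℕ
  N = B ℕ.* suc p

  -- The exponent E / pⁿ is at most B = p - 1, which is what multiplication by τ can make integral.
  record Remainder (ν n E : ℕ) : Set where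
    constructor remainder
    field
      level : ν ℕ.≤ n
      small : E ℕ.≤ B ℕ.* p ℕ.^ n

  -- The exponent is pˡ h with h = G / pⁿ ≤ B. The bound 2l ≤ n leaves enough powers of p in pⁿ to
  -- factor a larger power of p out of the scaled exponent of a product.
  record Correction (ν n E : ℕ) : Set where
    constructor correction
    field
      level   : ν ℕ.≤ n
      l G     : ℕ
      factors : E ≡ p ℕ.^ l ℕ.* G
      bounded : 2 ℕ.* l ℕ.≤ n
      small   : G ℕ.≤ B ℕ.* p ℕ.^ n

  -- Here l may be larger by 1 than in `Correction`: splitting an error with factor pˡ produces
  -- corrections with factors pⁱ for i < l only.
  record Error (ν n E : ℕ) : Set where
    constructor error
    field
      level   : ν ℕ.≤ n
      l G     : ℕ
      factors : E ≡ p ℕ.^ l ℕ.* G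
      bounded : 2 ℕ.* l ℕ.≤ 2 ℕ.+ n
      small   : G ℕ.≤ B ℕ.* p ℕ.^ n

  open ℕₚ.≤-Reasoning
  open +-*-Solver using (solve; _:=_; _:+_; _:*_; con)

  private
    2*≤p* : ∀ x → x ℕ.+ x ℕ.≤ p ℕ.* x
    2*≤p* x = begin
      x ℕ.+ x   ≡⟨ ≡.cong (x ℕ.+_) (ℕₚ.+-identityʳ x) ⟨
      2 ℕ.* x   ≤⟨ ℕₚ.*-monoˡ-≤ x 2≤p ⟩
      p ℕ.* x   ∎

    1≤p : 1 ℕ.≤ p
    1≤p = ℕₚ.≤-trans (s≤s z≤n) 2≤p

    1≤p^ : ∀ n → 1 ℕ.≤ p ℕ.^ n
    1≤p^ n = ℕₚ.m^n>0 p ⦃ ℕ.>-nonZero 1≤p ⦄ n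

    2l≤n⇒l≤n : ∀ {l n} → 2 ℕ.* l ℕ.≤ n → l ℕ.≤ n
    2l≤n⇒l≤n {l} h = ℕₚ.≤-trans (ℕₚ.m≤m+n l _) h

    4≤b∧2l≤b⇒2+l≤b : ∀ {l b} → 4 ℕ.≤ b → 2 ℕ.* l ℕ.≤ b → 2 ℕ.+ l ℕ.≤ b
    4≤b∧2l≤b⇒2+l≤b {l} {b} 4≤b 2l≤b = ℕₚ.*-cancelˡ-≤ 2 (begin
      2 ℕ.* (2 ℕ.+ l)  ≡⟨ ℕₚ.*-distribˡ-+ 2 2 l ⟩
      4 ℕ.+ 2 ℕ.* l    ≤⟨ ℕₚ.+-mono-≤ 4≤b 2l≤b ⟩
      b ℕ.+ b          ≡⟨ ≡.cong (b ℕ.+_) (ℕₚ.+-identityʳ b) ⟨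
      2 ℕ.* b          ∎)

  -- In true exponents, h and p^(l+1) h′ with h, h′ ≤ B add up to at most 2 B p^(l+1) ≤ B p^(l+2),
  -- so p^(l+2) is factored out. It divides the scaled exponent because b ≥ l + 2 and a ≥ 1, and a ≥
  -- 4 pays for the increase of l by 2.
  remainder*correction : ∀ {μ ν a E b F} → 4 ℕ.≤ μ → 4 ℕ.≤ ν → Remainder μ a E → Correction ν b F →
    Error (μ ℕ.+ ν) (a ℕ.+ b) (p ℕ.^ b ℕ.* E ℕ.+ p ℕ.^ a ℕ.* (p ℕ.* F))
  remainder*correction {a = zero} 4≤μ 4≤ν (remainder μ≤a _) _ with ℕₚ.≤-trans 4≤μ μ≤a
  ... | ()
  remainder*correction {a = suc a} {E} {b} 4≤μ 4≤ν (remainder μ≤a E≤) (correction ν≤b l G ≡.refl 2l≤b G≤)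
    with ℕₚ.m≤n⇒∃[o]m+o≡n (4≤b∧2l≤b⇒2+l≤b {l} (ℕₚ.≤-trans 4≤ν ν≤b) 2l≤b)
  ... | d , ≡.refl = record
    { level   = ℕₚ.+-mono-≤ μ≤a ν≤b
    ; l       = 2 ℕ.+ l
    ; G       = p ℕ.^ d ℕ.* E ℕ.+ p ℕ.^ a ℕ.* G
    ; factors = ≡.trans (≡.cong (λ x → x ℕ.* E ℕ.+ p ℕ.^ suc a ℕ.* (p ℕ.* (p ℕ.^ l ℕ.* G))) p^b)
        (solve 6 (λ p L D A E G → (p :* (p :* L)) :* D :* E :+ (p :* A) :* (p :* (L :* G))
                    := (p :* (p :* L)) :* (D :* E :+ A :* G)) ≡.refl p (p ℕ.^ l) (p ℕ.^ d) (p ℕ.^ a) E G)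
    ; bounded = begin
        2 ℕ.* (2 ℕ.+ l)      ≡⟨ ℕₚ.*-distribˡ-+ 2 2 l ⟩
        4 ℕ.+ 2 ℕ.* l        ≤⟨ ℕₚ.+-mono-≤ (ℕₚ.≤-trans 4≤μ μ≤a) 2l≤b ⟩
        suc a ℕ.+ b          ≤⟨ ℕₚ.m≤n+m _ 2 ⟩
        2 ℕ.+ (suc a ℕ.+ b)  ∎
    ; small   = begin
        p ℕ.^ d ℕ.* E ℕ.+ p ℕ.^ a ℕ.* G
          ≤⟨ ℕₚ.+-mono-≤ (ℕₚ.*-monoʳ-≤ (p ℕ.^ d) E≤) (ℕₚ.*-monoʳ-≤ (p ℕ.^ a) G≤) ⟩
        p ℕ.^ d ℕ.* (B ℕ.* p ℕ.^ suc a) ℕ.+ p ℕ.^ a ℕ.* (B ℕ.* p ℕ.^ b)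
          ≡⟨ ≡.cong (λ x → p ℕ.^ d ℕ.* (B ℕ.* p ℕ.^ suc a) ℕ.+ p ℕ.^ a ℕ.* (B ℕ.* x)) p^b ⟩
        p ℕ.^ d ℕ.* (B ℕ.* p ℕ.^ suc a) ℕ.+ p ℕ.^ a ℕ.* (B ℕ.* (p ℕ.^ (2 ℕ.+ l) ℕ.* p ℕ.^ d))
          ≡⟨ solve 5 (λ p L D A B → D :* (B :* (p :* A)) :+ A :* (B :* ((p :* (p :* L)) :* D))
                        := B :* p :* A :* D :+ B :* p :* A :* D :* (p :* L))
               ≡.refl p (p ℕ.^ l) (p ℕ.^ d) (p ℕ.^ a) B ⟩
        X ℕ.+ X ℕ.* p ℕ.^ suc l
          ≤⟨ ℕₚ.+-monoˡ-≤ _ (ℕₚ.≤-trans (ℕₚ.≤-reflexive (≡.sym (ℕₚ.*-identityʳ X))) (ℕₚ.*-monoʳ-≤ X (1≤p^ (suc l)))) ⟩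
        X ℕ.* p ℕ.^ suc l ℕ.+ X ℕ.* p ℕ.^ suc l
          ≤⟨ 2*≤p* _ ⟩
        p ℕ.* (X ℕ.* p ℕ.^ suc l)
          ≡⟨ solve 5 (λ p L D A B → p :* (B :* p :* A :* D :* (p :* L)) := B :* ((p :* A) :* ((p :* (p :* L)) :* D)))
               ≡.refl p (p ℕ.^ l) (p ℕ.^ d) (p ℕ.^ a) B ⟩
        B ℕ.* (p ℕ.^ suc a ℕ.* (p ℕ.^ (2 ℕ.+ l) ℕ.* p ℕ.^ d))
          ≡⟨ ≡.cong (λ x → B ℕ.* (p ℕ.^ suc a ℕ.* x)) p^b ⟨
        B ℕ.* (p ℕ.^ suc a ℕ.* p ℕ.^ b)
          ≡⟨ ≡.cong (B ℕ.*_) (ℕₚ.^-distribˡ-+-* p (suc a) b) ⟨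
        B ℕ.* p ℕ.^ (suc a ℕ.+ b) ∎
    }
    where
    X = B ℕ.* p ℕ.* p ℕ.^ a ℕ.* p ℕ.^ d
    p^b : p ℕ.^ (2 ℕ.+ l ℕ.+ d) ≡ p ℕ.^ (2 ℕ.+ l) ℕ.* p ℕ.^ d
    p^b = ℕₚ.^-distribˡ-+-* p (2 ℕ.+ l) d

  -- The true exponent is N + p^(l+2) h ≤ B (1 + p + p^(l+2)) ≤ B p^(l+3), so l increases by 3. The
  -- inequality 2 (3 + l) ≤ 2 + (4 + n) is what the exponent 4 of p is chosen for.
  correction-σ² : ∀ {ν n F} → Correction ν n F →
    Error (4 ℕ.+ ν) (4 ℕ.+ n) (p ℕ.^ n ℕ.* (p ℕ.^ 4 ℕ.* N) ℕ.+ p ℕ.^ 4 ℕ.* (p ℕ.* (p ℕ.* F)))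
  correction-σ² {ν} {n} (correction ν≤n l G ≡.refl 2l≤n G≤) with ℕₚ.m≤n⇒∃[o]m+o≡n (2l≤n⇒l≤n {l} 2l≤n)
  ... | e , ≡.refl = record
    { level   = ℕₚ.+-monoʳ-≤ 4 ν≤n
    ; l       = 3 ℕ.+ l
    ; G       = p ℕ.* p ℕ.^ e ℕ.* N ℕ.+ p ℕ.^ 3 ℕ.* G
    ; factors = ≡.trans (≡.cong (λ x → x ℕ.* (p ℕ.^ 4 ℕ.* N) ℕ.+ p ℕ.^ 4 ℕ.* (p ℕ.* (p ℕ.* (p ℕ.^ l ℕ.* G)))) p^n)
        (solve 5 (λ p L M N G →
             L :* M :* (p :* (p :* (p :* (p :* con 1))) :* N) :+ p :* (p :* (p :* (p :* con 1))) :* (p :* (p :* (L :* G)))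
          := p :* (p :* (p :* L)) :* (p :* M :* N :+ p :* (p :* (p :* con 1)) :* G))
          ≡.refl p (p ℕ.^ l) (p ℕ.^ e) N G)
    ; bounded = begin
        2 ℕ.* (3 ℕ.+ l)        ≡⟨ ℕₚ.*-distribˡ-+ 2 3 l ⟩
        6 ℕ.+ 2 ℕ.* l          ≤⟨ ℕₚ.+-monoʳ-≤ 6 2l≤n ⟩
        6 ℕ.+ n                ∎
    ; small   = begin
        p ℕ.* p ℕ.^ e ℕ.* N ℕ.+ p ℕ.^ 3 ℕ.* G
          ≤⟨ ℕₚ.+-monoʳ-≤ _ (ℕₚ.*-monoʳ-≤ (p ℕ.^ 3) G≤) ⟩
        p ℕ.* p ℕ.^ e ℕ.* N ℕ.+ p ℕ.^ 3 ℕ.* (B ℕ.* p ℕ.^ n)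
          ≡⟨ ≡.cong (λ x → p ℕ.* p ℕ.^ e ℕ.* N ℕ.+ p ℕ.^ 3 ℕ.* (B ℕ.* x)) p^n ⟩
        p ℕ.* p ℕ.^ e ℕ.* N ℕ.+ p ℕ.^ 3 ℕ.* (B ℕ.* (p ℕ.^ l ℕ.* p ℕ.^ e))
          ≡⟨ solve 4 (λ p L M B →
                  p :* M :* (B :* (con 1 :+ p)) :+ p :* (p :* (p :* con 1)) :* (B :* (L :* M))
               := B :* p :* M :* ((con 1 :+ p) :+ p :* p :* L)) ≡.refl p (p ℕ.^ l) (p ℕ.^ e) B ⟩
        B ℕ.* p ℕ.* p ℕ.^ e ℕ.* (suc p ℕ.+ p ℕ.* p ℕ.* p ℕ.^ l)
          ≤⟨ ℕₚ.*-monoʳ-≤ (B ℕ.* p ℕ.* p ℕ.^ e) (begin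
               suc p ℕ.+ q         ≤⟨ ℕₚ.+-monoˡ-≤ q (ℕₚ.+-monoˡ-≤ p 1≤p) ⟩
               p ℕ.+ p ℕ.+ q       ≤⟨ ℕₚ.+-monoˡ-≤ q (2*≤p* p) ⟩
               p ℕ.* p ℕ.+ q       ≡⟨ ≡.cong (ℕ._+ q) (ℕₚ.*-identityʳ (p ℕ.* p)) ⟨
               p ℕ.* p ℕ.* 1 ℕ.+ q ≤⟨ ℕₚ.+-monoˡ-≤ q (ℕₚ.*-monoʳ-≤ (p ℕ.* p) (1≤p^ l)) ⟩
               q ℕ.+ q             ≤⟨ 2*≤p* q ⟩
               p ℕ.* q             ∎) ⟩
        B ℕ.* p ℕ.* p ℕ.^ e ℕ.* (p ℕ.* q)
          ≡⟨ solve 4 (λ p L M B → B :* p :* M :* (p :* (p :* p :* L)) := B :* (p :* (p :* (p :* (p :* (L :* M))))))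
               ≡.refl p (p ℕ.^ l) (p ℕ.^ e) B ⟩
        B ℕ.* (p ℕ.* (p ℕ.* (p ℕ.* (p ℕ.* (p ℕ.^ l ℕ.* p ℕ.^ e)))))
          ≡⟨ ≡.cong (λ x → B ℕ.* (p ℕ.* (p ℕ.* (p ℕ.* (p ℕ.* x))))) p^n ⟨
        B ℕ.* p ℕ.^ (4 ℕ.+ n) ∎
    }
    where
    q = p ℕ.* p ℕ.* p ℕ.^ l
    p^n : p ℕ.^ (l ℕ.+ e) ≡ p ℕ.^ l ℕ.* p ℕ.^ e
    p^n = ℕₚ.^-distribˡ-+-* p l e

-- Successive approximation of C, ρ and α.

-- t n plays the role of the Teichmüller representative of t^n.
record IsInverse {p : ℕ} {R : CommutativeRing c ℓ} {S : CommutativeRing c′ ℓ′}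
                 (vR : Verschiebung p R) (vS : Verschiebung p S) (ι : S ⟶ R)
                 (T : ℕ → CommutativeRing.Carrier R) (t : ℕ → CommutativeRing.Carrier S) : Set (ℓ ⊔ c′) where
  private
    module ι = RingHomomorphism ι
    module vS = Verschiebung vS
  open CommutativeRing R
  open Verschiebung vR
  field
    ι-V : ∀ x → ι.⟦ vS.V x ⟧ ≈ V ι.⟦ x ⟧
    t-0 : ι.⟦ t 0 ⟧ ≈ 1#
    t-T : ∀ m n → ι.⟦ t (m ℕ.+ n) ⟧ * T n ≈ ι.⟦ t m ⟧
    σ-t : ∀ n → σ ι.⟦ t n ⟧ ≈ ι.⟦ t (p ℕ.* n) ⟧

module FixedPoint {p B : ℕ} (p≡1+B : p ≡ suc B) (2≤p : 2 ℕ.≤ p)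
  (R : CommutativeRing c ℓ) (S : CommutativeRing c′ ℓ′)
  (vR : Verschiebung p R) (vS : Verschiebung p S) (ι : S ⟶ R)
  (T : ℕ → CommutativeRing.Carrier R) (t : ℕ → CommutativeRing.Carrier S)
  (exponential : IsExponential vR T) (inverse : IsInverse vR vS ι T t) where
  private
    module S = CommutativeRing S
    module vS = Verschiebung vS
    module ι = RingHomomorphism ι
  open CommutativeRing R hiding (zero)
  open Verschiebung vR
  open IsExponential exponential
  open IsInverse inverse
  open SetoidReasoning setoid
  open RingProps ring using (-‿+-comm; -‿distribʳ-*)
  open Solver commutativeSemiring using (solve; _:=_; _:+_; _:*_; con)
  open Mult semiring using () renaming (_×_ to infixr 8 _×ₙ_)
  open Exponents p B 2≤p
  open Monomials R vR T exponential

  -- `D` is p⁴ T^(p²-1), written as a monomial and therefore with exponent scaled by p⁴.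
  τ D : Carrier
  τ = ι.⟦ t B ⟧
  D = mon 4 (p ℕ.^ 4 ℕ.* N)

  record Coboundary (ν : ℕ) (y : Carrier) : Set (c ⊔ ℓ) where
    field
      δ ε      : Carrier
      δ-span   : Span (Correction ν) δ
      ε-span   : Span (Remainder ν) ε
      equation : δ ≈ σ δ + (ε + y)

  open Coboundary renaming (equation to splitting)

  private
    -- For l = 0 the exponent is small enough to go into ε. The monomial for `suc l` is σ of the
    -- monomial `z` for `l`, and contributing -z to δ replaces σ z by z.
    monomial-coboundary : ∀ {ν n} l G → ν ℕ.≤ n → 2 ℕ.* l ℕ.≤ 2 ℕ.+ n → G ℕ.≤ B ℕ.* p ℕ.^ n →
                          Coboundary ν (mon n (p ℕ.^ l ℕ.* G))
    monomial-coboundary {ν} {n} zero G ν≤n _ G≤ = record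
      { δ = 0#
      ; ε = - mon n G
      ; δ-span = zeroˢ
      ; ε-span = negˢ (monomial (remainder ν≤n G≤))
      ; equation = sym (begin
          σ 0# + (- mon n G + mon n (G ℕ.+ 0)) ≈⟨ +-cong σ-0 (+-congˡ (mon-cong n (ℕₚ.+-identityʳ G))) ⟩
          0# + (- mon n G + mon n G)           ≈⟨ trans (+-identityˡ _) (-‿inverseˡ _) ⟩
          0# ∎)
      }
    monomial-coboundary {ν} {n} (suc l) G ν≤n 2l≤n G≤ = record
      { δ = δ u - z
      ; ε = ε u
      ; δ-span = δ-span u +ˢ negˢ (monomial (correction ν≤n l G ≡.refl 2l≤n′ G≤))
      ; ε-span = ε-span u
      ; equation = begin
          δ u - z                             ≈⟨ +-congʳ (splitting u) ⟩
          σ (δ u) + (ε u + z) - z             ≈⟨ solve 4 (λ a b c d → (a :+ (b :+ c)) :+ d := a :+ (b :+ (c :+ d))) refl _ _ _ _ ⟩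
          σ (δ u) + (ε u + (z - z))           ≈⟨ +-congˡ (+-congˡ (trans (-‿inverseʳ z) (sym (-‿inverseˡ (σ z))))) ⟩
          σ (δ u) + (ε u + (- σ z + σ z))     ≈⟨ solve 4 (λ a b c d → a :+ (b :+ (c :+ d)) := (a :+ c) :+ (b :+ d)) refl _ _ _ _ ⟩
          σ (δ u) - σ z + (ε u + σ z)         ≈⟨ +-cong (sym (trans (σ-+ _ _) (+-congˡ (σ-neg z))))
                                                  (+-congˡ (trans (σ-mon n _) (mon-cong n (≡.sym (ℕₚ.*-assoc p (p ℕ.^ l) G))))) ⟩
          σ (δ u - z) + (ε u + mon n (p ℕ.^ suc l ℕ.* G)) ∎
      }
      where
      2l≤n′ : 2 ℕ.* l ℕ.≤ n
      2l≤n′ = ℕₚ.≤-pred (ℕₚ.≤-pred (≡.subst (ℕ._≤ 2 ℕ.+ n) (ℕₚ.*-distribˡ-+ 2 1 l) 2l≤n))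
      u = monomial-coboundary l G ν≤n (ℕₚ.≤-trans 2l≤n′ (ℕₚ.m≤n+m n 2)) G≤
      z = mon n (p ℕ.^ l ℕ.* G)

  coboundary : ∀ {ν y} → Span (Error ν) y → Coboundary ν y
  coboundary {ν} (monomial {n} (error ν≤n l G ≡.refl 2l≤n G≤)) = monomial-coboundary l G ν≤n 2l≤n G≤
  coboundary zeroˢ = record
    { δ = 0# ; ε = 0# ; δ-span = zeroˢ ; ε-span = zeroˢ
    ; equation = sym (trans (+-cong σ-0 (+-identityˡ 0#)) (+-identityˡ 0#)) }
  coboundary (_+ˢ_ {x} {y} u v) = record
    { δ = δ u′ + δ v′ ; ε = ε u′ + ε v′ ; δ-span = δ-span u′ +ˢ δ-span v′ ; ε-span = ε-span u′ +ˢ ε-span v′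
    ; equation = begin
        δ u′ + δ v′                                                ≈⟨ +-cong (splitting u′) (splitting v′) ⟩
        (σ (δ u′) + (ε u′ + x)) + (σ (δ v′) + (ε v′ + y))
          ≈⟨ solve 6 (λ a b c d e f → (a :+ (b :+ c)) :+ (d :+ (e :+ f)) := (a :+ d) :+ ((b :+ e) :+ (c :+ f))) refl _ _ _ _ _ _ ⟩
        (σ (δ u′) + σ (δ v′)) + ((ε u′ + ε v′) + (x + y))          ≈⟨ +-congʳ (σ-+ _ _) ⟨
        σ (δ u′ + δ v′) + ((ε u′ + ε v′) + (x + y)) ∎ }
    where
    u′ = coboundary u
    v′ = coboundary v
  coboundary (negˢ {x} u) = record
    { δ = - δ u′ ; ε = - ε u′ ; δ-span = negˢ (δ-span u′) ; ε-span = negˢ (ε-span u′)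
    ; equation = begin
        - δ u′                             ≈⟨ -‿cong (splitting u′) ⟩
        - (σ (δ u′) + (ε u′ + x))          ≈⟨ -‿+-comm _ _ ⟨
        - σ (δ u′) - (ε u′ + x)            ≈⟨ +-cong (sym (σ-neg _)) (sym (-‿+-comm _ _)) ⟩
        σ (- δ u′) + (- ε u′ - x) ∎ }
    where u′ = coboundary u
  coboundary (resp e u) = record
    { δ = δ u′ ; ε = ε u′ ; δ-span = δ-span u′ ; ε-span = ε-span u′
    ; equation = trans (splitting u′) (+-congˡ (+-congˡ e)) }
    where u′ = coboundary u

  ι-V^ : ∀ n x → ι.⟦ vS.V^ n · x ⟧ ≈ V^ n · ι.⟦ x ⟧
  ι-V^ zero    x = refl
  ι-V^ (suc n) x = trans (ι-V _) (V-cong (ι-V^ n x))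

  σ^-t : ∀ m n → σ^ m · ι.⟦ t n ⟧ ≈ ι.⟦ t (p ℕ.^ m ℕ.* n) ⟧
  σ^-t zero    n = reflexive (≡.cong (λ n → ι.⟦ t n ⟧) (≡.sym (ℕₚ.*-identityˡ n)))
  σ^-t (suc m) n = trans (σ-cong (σ^-t m n)) (trans (σ-t _)
    (reflexive (≡.cong (λ n → ι.⟦ t n ⟧) (≡.sym (ℕₚ.*-assoc p (p ℕ.^ m) n)))))

  -- The projection formula carries τ inside Vⁿ as σⁿ(τ), the image of t (pⁿ B), and this absorbs T
  -- H because H ≤ B pⁿ. The factor V^ν is recorded so that the approximations of α converge.
  lift : ∀ {ν ε} → Span (Remainder ν) ε → ∃ λ y → τ * ε ≈ ι.⟦ vS.V^ ν · y ⟧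
  lift {ν} (monomial {n} {H} (remainder ν≤n H≤)) with vS.V^≥ ν≤n (t (B ℕ.* p ℕ.^ n ℕ.∸ H))
  ... | y , e = y , (begin
    τ * V^ n · T H                                   ≈⟨ *-comm _ _ ⟩
    V^ n · T H * τ                                   ≈⟨ V^-projection n _ _ ⟩
    V^ n · (T H * σ^ n · τ)                          ≈⟨ V^-cong n (trans (*-comm _ _) (*-congʳ (σ^-t n B))) ⟩
    V^ n · (ι.⟦ t (p ℕ.^ n ℕ.* B) ⟧ * T H)           ≡⟨ ≡.cong (λ k → V^ n · (ι.⟦ t k ⟧ * T H))
                                                          (≡.trans (ℕₚ.*-comm (p ℕ.^ n) B) (≡.sym (ℕₚ.m∸n+n≡m H≤))) ⟩
    V^ n · (ι.⟦ t (B ℕ.* p ℕ.^ n ℕ.∸ H ℕ.+ H) ⟧ * T H) ≈⟨ V^-cong n (t-T _ H) ⟩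
    V^ n · ι.⟦ t (B ℕ.* p ℕ.^ n ℕ.∸ H) ⟧             ≈⟨ ι-V^ n _ ⟨
    ι.⟦ vS.V^ n · t (B ℕ.* p ℕ.^ n ℕ.∸ H) ⟧          ≈⟨ ι.⟦⟧-cong e ⟩
    ι.⟦ vS.V^ ν · y ⟧ ∎)
  lift {ν} zeroˢ = S.0# , trans (zeroʳ τ) (sym (trans (ι.⟦⟧-cong (vS.V^-0 ν)) ι.0#-homo))
  lift {ν} (u +ˢ v) with lift u | lift v
  ... | y , e | z , e′ = y S.+ z , trans (distribˡ _ _ _) (trans (+-cong e e′)
    (sym (trans (ι.⟦⟧-cong (vS.V^-+ ν y z)) (ι.+-homo _ _))))
  lift {ν} (negˢ u) with lift u
  ... | y , e = S.- y , trans (sym (-‿distribʳ-* _ _)) (trans (-‿cong e)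
    (sym (trans (ι.⟦⟧-cong (vS.V^-neg ν y)) (ι.-‿homo _))))
  lift (resp r u) with lift u
  ... | y , e = y , trans (*-congˡ (sym r)) e

  -- The constant term 1 of C is kept apart from `C₁` because `remainder*correction` requires level
  -- at least 4 of both factors. Only the level of `err` grows with k.
  record Stage (k : ℕ) : Set (c ⊔ ℓ ⊔ c′) where
    field
      C₁ ρ err : Carrier
      α        : S.Carrier
      C₁-span  : Span (Correction 4) C₁
      ρ-span   : Span (Remainder 4) ρ
      err-span : Span (Error (4 ℕ.+ k)) err
      α-lifts  : ι.⟦ α ⟧ ≈ τ * (1# + ρ)
    C : Carrier
    C = 1# + C₁
    field
      equation : C + err ≈ (1# + ρ) * σ C + D * σ (σ C)

  Correction-weaken : ∀ {μ ν n E} → μ ℕ.≤ ν → Correction ν n E → Correction μ n E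
  Correction-weaken h (correction ν≤n l G e f g) = correction (ℕₚ.≤-trans h ν≤n) l G e f g

  Remainder-weaken : ∀ {μ ν n E} → μ ℕ.≤ ν → Remainder ν n E → Remainder μ n E
  Remainder-weaken h (remainder ν≤n f) = remainder (ℕₚ.≤-trans h ν≤n) f

  Error-weaken : ∀ {μ ν n E} → μ ℕ.≤ ν → Error ν n E → Error μ n E
  Error-weaken h (error ν≤n l G e f g) = error (ℕₚ.≤-trans h ν≤n) l G e f g

  D*σ² : ∀ {ν x} → Span (Correction ν) x → Span (Error (4 ℕ.+ ν)) (D * σ (σ x))
  D*σ² u = monomial {P = Only 4 (p ℕ.^ 4 ℕ.* N)} only *ˢ σˢ (σˢ u)
    by λ { only (shifted (shifted g)) → correction-σ² g }

  _*σ_by_,_ : ∀ {μ ν x y} → Span (Remainder μ) x → Span (Correction ν) y → 4 ℕ.≤ μ → 4 ℕ.≤ ν →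
              Span (Error (μ ℕ.+ ν)) (x * σ y)
  u *σ v by 4≤μ , 4≤ν = u *ˢ σˢ v by λ { g (shifted h) → remainder*correction 4≤μ 4≤ν g h }

  initial : Stage 0
  initial = record
    { C₁       = 0#
    ; ρ        = 0#
    ; err      = D * σ (σ 1#)
    ; α        = t B
    ; C₁-span  = zeroˢ
    ; ρ-span   = zeroˢ
    -- 1 = T 0 counts as a correction of level 0, so the initial error has level 4.
    ; err-span = D*σ² (resp T-0 (monomial {n = 0} (correction z≤n 0 0 ≡.refl z≤n z≤n)))
    ; α-lifts  = sym (trans (*-congˡ (+-identityʳ 1#)) (*-identityʳ τ))
    ; equation = +-cong 1+0≈σ[1+0] (*-congˡ (σ-cong (σ-cong (sym (+-identityʳ 1#)))))
    }
    where
    1+0≈σ[1+0] : 1# + 0# ≈ (1# + 0#) * σ (1# + 0#)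
    1+0≈σ[1+0] = trans (sym (*-identityʳ _)) (*-congˡ (sym (trans (σ-cong (+-identityʳ 1#)) σ-1)))

  module _ {k : ℕ} (s : Stage k) where
    open Stage s
    private
      b = coboundary err-span
      lifted = lift (ε-span b)

    -- The terms linear in δ and ε that are not of higher order cancel by the choice of δ and ε.
    next : Stage (suc k)
    next = record
      { C₁       = C₁ + δ b
      ; ρ        = ρ + ε b
      ; err      = ε b * σ C₁ + ρ * σ (δ b) + ε b * σ (δ b) + D * σ (σ (δ b))
      ; α        = α S.+ vS.V^ (4 ℕ.+ k) · proj₁ lifted
      ; C₁-span  = C₁-span +ˢ mapˢ (Correction-weaken 4≤4+k) (δ-span b)
      ; ρ-span   = ρ-span +ˢ mapˢ (Remainder-weaken 4≤4+k) (ε-span b)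
      -- In every product at least one factor has level 4 + k and the other at least 4, so levels
      -- reach 8 + k; the next stage asks for 5 + k.
      ; err-span = mapˢ (Error-weaken (ℕₚ.≤-trans 5+k≤8+k (ℕₚ.≤-reflexive (ℕₚ.+-comm 4 (4 ℕ.+ k))))) (ε-span b *σ C₁-span by 4≤4+k , ℕₚ.≤-refl)
                +ˢ mapˢ (Error-weaken 5+k≤8+k) (ρ-span *σ δ-span b by ℕₚ.≤-refl , 4≤4+k)
                +ˢ mapˢ (Error-weaken 5+k≤) (ε-span b *σ δ-span b by 4≤4+k , 4≤4+k)
                +ˢ mapˢ (Error-weaken 5+k≤8+k) (D*σ² (δ-span b))
      ; α-lifts  = begin
          ι.⟦ α S.+ vS.V^ (4 ℕ.+ k) · proj₁ lifted ⟧       ≈⟨ ι.+-homo _ _ ⟩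
          ι.⟦ α ⟧ + ι.⟦ vS.V^ (4 ℕ.+ k) · proj₁ lifted ⟧   ≈⟨ +-cong α-lifts (sym (proj₂ lifted)) ⟩
          τ * (1# + ρ) + τ * ε b                           ≈⟨ solve 3 (λ τ ρ ε → τ :* (con 1 :+ ρ) :+ τ :* ε := τ :* (con 1 :+ (ρ :+ ε))) refl τ ρ (ε b) ⟩
          τ * (1# + (ρ + ε b)) ∎
      ; equation = begin
          (1# + (C₁ + δ b)) + (ε b * σ C₁ + ρ * s₁ + ε b * s₁ + D * s₂)
            ≈⟨ +-congʳ (+-congˡ (+-congˡ (splitting b))) ⟩
          (1# + (C₁ + (s₁ + (ε b + err)))) + (ε b * σ C₁ + ρ * s₁ + ε b * s₁ + D * s₂)
            ≈⟨ solve 8 (λ C₁ s₁ ε err σC₁ ρ D s₂ →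
                 (con 1 :+ (C₁ :+ (s₁ :+ (ε :+ err)))) :+ (ε :* σC₁ :+ ρ :* s₁ :+ ε :* s₁ :+ D :* s₂)
                 := (con 1 :+ C₁ :+ err) :+ (s₁ :+ ε :+ ε :* σC₁ :+ ρ :* s₁ :+ ε :* s₁ :+ D :* s₂))
               refl C₁ s₁ (ε b) err (σ C₁) ρ D s₂ ⟩
          (C + err) + (s₁ + ε b + ε b * σ C₁ + ρ * s₁ + ε b * s₁ + D * s₂)
            ≈⟨ +-congʳ (trans equation (+-congʳ (*-congˡ σC))) ⟩
          ((1# + ρ) * (1# + σ C₁) + D * σ (σ C)) + (s₁ + ε b + ε b * σ C₁ + ρ * s₁ + ε b * s₁ + D * s₂)
            ≈⟨ solve 7 (λ s₁ ε σC₁ ρ D s₂ σσC →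
                 ((con 1 :+ ρ) :* (con 1 :+ σC₁) :+ D :* σσC) :+ (s₁ :+ ε :+ ε :* σC₁ :+ ρ :* s₁ :+ ε :* s₁ :+ D :* s₂)
                 := (con 1 :+ (ρ :+ ε)) :* (con 1 :+ σC₁ :+ s₁) :+ D :* (σσC :+ s₂))
               refl s₁ (ε b) (σ C₁) ρ D s₂ (σ (σ C)) ⟩
          (1# + (ρ + ε b)) * (1# + σ C₁ + s₁) + D * (σ (σ C) + s₂)
            ≈⟨ +-cong (*-congˡ (trans (+-congʳ (sym σC)) (sym σC′))) (*-congˡ (sym (trans (σ-cong σC′) (σ-+ _ _)))) ⟩
          (1# + (ρ + ε b)) * σ (1# + (C₁ + δ b)) + D * σ (σ (1# + (C₁ + δ b))) ∎
      }
      where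
      s₁ = σ (δ b)
      s₂ = σ (σ (δ b))
      σC : σ C ≈ 1# + σ C₁
      σC = trans (σ-+ _ _) (+-congʳ σ-1)
      σC′ : σ (1# + (C₁ + δ b)) ≈ σ C + σ (δ b)
      σC′ = trans (σ-cong (sym (+-assoc _ _ _))) (σ-+ _ _)
      4≤4+k : 4 ℕ.≤ 4 ℕ.+ k
      4≤4+k = ℕₚ.m≤m+n 4 k
      5+k≤8+k : 5 ℕ.+ k ℕ.≤ 8 ℕ.+ k
      5+k≤8+k = ℕₚ.m≤n+m _ 3
      5+k≤ : 5 ℕ.+ k ℕ.≤ (4 ℕ.+ k) ℕ.+ (4 ℕ.+ k)
      5+k≤ = ℕₚ.≤-trans 5+k≤8+k (ℕₚ.+-monoʳ-≤ 4 (ℕₚ.m≤n+m _ k))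

    next-C : Stage.C next ≡ C modV^ suc k
    next-C = ≡V-trans {suc k} (≈⇒≡V {suc k} (sym (+-assoc _ _ _)))
      (≡V-trans {suc k} (≡V-+ {suc k} (≈⇒≡V {suc k} {C} refl) δ≡0) (≈⇒≡V {suc k} (+-identityʳ C)))
      where
      δ≡0 : δ b ≡ 0# modV^ suc k
      δ≡0 with Span⇒V^ (λ g → ℕₚ.≤-trans (ℕₚ.m≤n+m (suc k) 3) (Correction.level g)) (δ-span b)
      ... | z , e = z , trans e (sym (+-identityˡ _))

    next-α : Stage.α next vS.≡ α modV^ suc k
    next-α = vS.≡V-weaken (ℕₚ.m≤n+m (suc k) 3) (proj₁ lifted , S.refl)

  stage : ∀ k → Stage k
  stage zero    = initial
  stage (suc k) = next (stage k)

  ι-≡V : ∀ {n x y} → x vS.≡ y modV^ n → ι.⟦ x ⟧ ≡ ι.⟦ y ⟧ modV^ n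
  ι-≡V {n} (z , e) = ι.⟦ z ⟧ , trans (ι.⟦⟧-cong e) (trans (ι.+-homo _ _) (+-congˡ (ι-V^ n z)))

  Q : Carrier
  Q = (p ℕ.^ 4) ×ₙ 1#

  D≈Q*T : D ≈ Q * T N
  D≈Q*T = sym (begin
    Q * T N                       ≈⟨ *-congʳ (p^≈V^1 4) ⟩
    V^ 4 · 1# * T N               ≈⟨ V^-projection 4 1# (T N) ⟩
    V^ 4 · (1# * σ^ 4 · T N)      ≈⟨ V^-cong 4 (trans (*-identityˡ _) (σ^-T 4 N)) ⟩
    D ∎)

  p²≡N+1 : p ℕ.* (p ℕ.* 1) ≡ 1 ℕ.+ N
  p²≡N+1 = ≡.trans (≡.cong (λ q → p ℕ.* (q ℕ.* 1)) p≡1+B) (≡.trans (≡.cong (λ q → q ℕ.* (suc B ℕ.* 1)) p≡1+B)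
    (≡.trans (+-*-Solver.solve 1 (λ B → (con′ 1 +′ B) *′ ((con′ 1 +′ B) *′ con′ 1) =′ con′ 1 +′ B *′ (con′ 1 +′ (con′ 1 +′ B))) ≡.refl B)
      (≡.cong (λ q → suc (B ℕ.* suc q)) (≡.sym p≡1+B))))
    where open +-*-Solver using () renaming (con to con′; _:+_ to _+′_; _:*_ to _*′_; _:=_ to _=′_)

  τ*Tp : τ * T (p ℕ.* 1) ≈ T 1
  τ*Tp = begin
    τ * T (p ℕ.* 1)                 ≡⟨ ≡.cong (λ n → τ * T n) (≡.trans (ℕₚ.*-identityʳ p) (≡.trans p≡1+B (ℕₚ.+-comm 1 B))) ⟩
    τ * T (B ℕ.+ 1)                 ≈⟨ *-congˡ (T-+ B 1) ⟩
    τ * (T B * T 1)                 ≈⟨ *-assoc _ _ _ ⟨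
    τ * T B * T 1                   ≈⟨ *-congʳ (trans (t-T 0 B) t-0) ⟩
    1# * T 1                        ≈⟨ *-identityˡ _ ⟩
    T 1 ∎

  module _ {k : ℕ} (s : Stage k) where
    open Stage s

    -- Multiplication by T 1 passes from the equation for C to the one for a: τ T^p = T accounts for
    -- the factor T^p of σ(a), and T · T^(p²-1) = T^(p²) for that of σ²(a). Modulo V^k the error
    -- vanishes.
    stage-equation : T 1 * C ≡ ι.⟦ α ⟧ * σ (T 1 * C) + Q * σ (σ (T 1 * C)) modV^ k
    stage-equation = ≡V-trans {k} step₁ (≈⇒≡V {k} (begin
      T 1 * (C + err)                              ≈⟨ *-congˡ equation ⟩
      T 1 * ((1# + ρ) * σ C + D * σ (σ C))         ≈⟨ *-congˡ (+-congˡ (*-congʳ D≈Q*T)) ⟩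
      T 1 * ((1# + ρ) * σ C + Q * T N * σ (σ C))
        ≈⟨ solve 6 (λ T₁ ρ₁ σC Q T σσC → T₁ :* (ρ₁ :* σC :+ Q :* T :* σσC) := ρ₁ :* (T₁ :* σC) :+ Q :* ((T₁ :* T) :* σσC))
             refl (T 1) (1# + ρ) (σ C) Q (T N) (σ (σ C)) ⟩
      (1# + ρ) * (T 1 * σ C) + Q * ((T 1 * T N) * σ (σ C))
        ≈⟨ +-cong (*-congˡ (*-congʳ (sym τ*Tp))) (*-congˡ (*-congʳ (trans (sym (T-+ 1 N)) (reflexive (≡.cong T (≡.sym p²≡N+1)))))) ⟩
      (1# + ρ) * (τ * T (p ℕ.* 1) * σ C) + Q * (T (p ℕ.* (p ℕ.* 1)) * σ (σ C))
        ≈⟨ +-cong (solve 4 (λ ρ₁ τ T σC → ρ₁ :* (τ :* T :* σC) := (τ :* ρ₁) :* (T :* σC)) refl (1# + ρ) τ (T (p ℕ.* 1)) (σ C)) refl ⟩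
      (τ * (1# + ρ)) * (T (p ℕ.* 1) * σ C) + Q * (T (p ℕ.* (p ℕ.* 1)) * σ (σ C))
        ≈⟨ +-cong (*-cong (sym α-lifts) (sym σa)) (*-congˡ (sym (trans (σ-cong σa) (trans (σ-* _ _) (*-congʳ (σ-T _)))))) ⟩
      ι.⟦ α ⟧ * σ (T 1 * C) + Q * σ (σ (T 1 * C)) ∎))
      where
      σa : σ (T 1 * C) ≈ T (p ℕ.* 1) * σ C
      σa = trans (σ-* _ _) (*-congʳ (σ-T 1))
      err≡0 : err ≡ 0# modV^ k
      err≡0 with Span⇒V^ (λ g → ℕₚ.≤-trans (ℕₚ.m≤n+m k 4) (Error.level g)) err-span
      ... | z , e = z , trans e (sym (+-identityˡ _))
      step₁ : T 1 * C ≡ T 1 * (C + err) modV^ k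
      step₁ = ≡V-* {k} (≈⇒≡V {k} {T 1} refl) (≡V-sym {k} (≡V-trans {k} (≡V-+ {k} (≈⇒≡V {k} {C} refl) err≡0)
        (≈⇒≡V {k} (+-identityʳ C))))

  -- The equation holds for the limits because it holds modulo Vⁿ at stage n for every n. Since C =
  -- 1 at stage 0, the limit is 1 modulo V; this form of a is recorded to determine its component 0.
  fixedPoint : ∃ λ α → ∃ λ a → (∃ λ z → a ≈ T 1 * (1# + V z)) × a ≈ ι.⟦ α ⟧ * σ a + Q * σ (σ a)
  fixedPoint = α , T 1 * C , (proj₁ C≡1 , *-congˡ (trans (proj₂ C≡1) (+-congʳ (+-identityʳ 1#)))) ,
    separated _ _ λ n → ≡V-trans {n} (≡V-* {n} (≈⇒≡V {n} {T 1} refl) (C≡ n))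
      (≡V-trans {n} (stage-equation (stage n))
        (≡V-sym {n} (≡V-+ {n} (≡V-* {n} (ι-≡V {n} (α≡ n)) (≡V-σ {n} (a≡ n)))
          (≡V-* {n} (≈⇒≡V {n} {Q} refl) (≡V-σ {n} (≡V-σ {n} (a≡ n)))))))
    where
    limC = complete (λ k → Stage.C (stage k)) (λ k → next-C (stage k))
    limα = vS.complete (λ k → Stage.α (stage k)) (λ k → next-α (stage k))
    C = proj₁ limC
    α = proj₁ limα
    C≡1 : C ≡ 1# + 0# modV^ 1
    C≡1 = proj₂ limC 0
    C≡ : ∀ n → C ≡ Stage.C (stage n) modV^ n
    C≡ n = ≡V-weaken (ℕₚ.n≤1+n n) (proj₂ limC n)
    α≡ : ∀ n → α vS.≡ Stage.α (stage n) modV^ n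
    α≡ n = vS.≡V-weaken (ℕₚ.n≤1+n n) (proj₂ limα n)
    a≡ : ∀ n → T 1 * C ≡ T 1 * Stage.C (stage n) modV^ n
    a≡ n = ≡V-* {n} (≈⇒≡V {n} {T 1} refl) (C≡ n)

-- The free module of rank 2, its base changes and the isogeny.

module _ (R : CommutativeRing c ℓ) where
  open CommutativeRing R hiding (zero)
  open Solver commutativeSemiring using (solve; _:=_; _:+_; _:*_; con)

  plane : Module R c ℓ
  plane = DirectProduct.⟨module⟩ TensorUnit.⟨module⟩ TensorUnit.⟨module⟩

  e₁ e₂ : Module.Carrierᴹ plane
  e₁ = 1# , 0#
  e₂ = 0# , 1#

  plane-free : FreeOfRank plane 2
  plane-free = b , record
    { spanning    = λ (x , y) → pair x y , (sym (first x y) , sym (second x y))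
    ; independent = λ a (e , e′) → λ
      { zero       → trans (sym (first (a zero) (a (suc zero)))) e
      ; (suc zero) → trans (sym (second (a zero) (a (suc zero)))) e′ }
    }
    where
    b : Fin 2 → Module.Carrierᴹ plane
    b zero       = e₁
    b (suc zero) = e₂
    pair : Carrier → Carrier → Fin 2 → Carrier
    pair x y zero       = x
    pair x y (suc zero) = y
    first : ∀ x y → x * 1# + (y * 0# + 0#) ≈ x
    first = solve 2 (λ x y → x :* con 1 :+ (y :* con 0 :+ con 0) := x) refl
    second : ∀ x y → x * 0# + (y * 1# + 0#) ≈ y
    second = solve 2 (λ x y → x :* con 0 :+ (y :* con 1 :+ con 0) := y) refl

×ᴹ≈×1*ₗ : ∀ {R : CommutativeRing c ℓ} (M : Module R m ℓm) →
          let open Module M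
              open MonoidMult +ᴹ-monoid using () renaming (_×_ to _×ᴹ_)
              open CommutativeRing R using (1#; semiring)
              open Mult semiring using () renaming (_×_ to _×ₙ_)
          in ∀ n x → n ×ᴹ x ≈ᴹ (n ×ₙ 1#) *ₗ x
×ᴹ≈×1*ₗ M zero    x = ≈ᴹ-sym (*ₗ-zeroˡ x)
  where open Module M
×ᴹ≈×1*ₗ M (suc n) x = ≈ᴹ-trans (+ᴹ-cong (≈ᴹ-sym (*ₗ-identityˡ x)) (×ᴹ≈×1*ₗ M n x)) (≈ᴹ-sym (*ₗ-distribʳ x _ _))
  where open Module M

module Coordinates {R : CommutativeRing c ℓ} {S : CommutativeRing c′ ℓ′} (f : R ⟶ S) where
  private
    module R = CommutativeRing R
    module M = Module (plane R)
  open CommutativeRing S hiding (zero)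
  open RingHomomorphism f
  open BaseChange {R = R} {S = S} f (plane R)
  private
    module T = Module baseChange
  open AbelianGroupProps T.+ᴹ-abelianGroup using () renaming (inverseˡ-unique to ⊖-unique)
  open CommSemigroup (CommutativeMonoid.commutativeSemigroup T.+ᴹ-commutativeMonoid) using ()
    renaming (interchange to ⊕-interchange)
  open RingProps ring using (-‿distribʳ-*)

  -- Tensors are formal terms modulo generated relations, so they are told apart only by maps out of
  -- them: a map φ that is linear along f induces x ⊗ s ↦ φ(x) s.
  module Functional (φ : M.Carrierᴹ → Carrier) (φ-cong : ∀ {x y} → x M.≈ᴹ y → φ x ≈ φ y)
    (φ-+ : ∀ x y → φ (x M.+ᴹ y) ≈ φ x + φ y) (φ-* : ∀ r x → φ (r M.*ₗ x) ≈ ⟦ r ⟧ * φ x) where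

    ⟪_⟫ : Tensor → Carrier
    ⟪ x ⊗ s ⟫ = φ x * s
    ⟪ 𝟘 ⟫     = 0#
    ⟪ u ⊕ v ⟫ = ⟪ u ⟫ + ⟪ v ⟫
    ⟪ ⊖ u ⟫   = - ⟪ u ⟫

    ⟪⟫-cong : ∀ {u v} → u ≋ v → ⟪ u ⟫ ≈ ⟪ v ⟫
    ⟪⟫-cong ≋-refl              = refl
    ⟪⟫-cong (≋-sym e)           = sym (⟪⟫-cong e)
    ⟪⟫-cong (≋-trans e e′)      = trans (⟪⟫-cong e) (⟪⟫-cong e′)
    ⟪⟫-cong (⊕-cong e e′)       = +-cong (⟪⟫-cong e) (⟪⟫-cong e′)
    ⟪⟫-cong (⊖-cong e)          = -‿cong (⟪⟫-cong e)
    ⟪⟫-cong (⊕-assoc u v w)     = +-assoc _ _ _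
    ⟪⟫-cong (⊕-comm u v)        = +-comm _ _
    ⟪⟫-cong (⊕-identityˡ u)     = +-identityˡ _
    ⟪⟫-cong (⊖-inverseˡ u)      = -‿inverseˡ _
    ⟪⟫-cong (⊗-cong e e′)       = *-cong (φ-cong e) e′
    ⟪⟫-cong (⊗-distribʳ x y s)  = trans (*-congʳ (φ-+ x y)) (distribʳ _ _ _)
    ⟪⟫-cong (⊗-distribˡ x s s′) = distribˡ _ _ _
    ⟪⟫-cong (⊗-balanced r x s)  = trans (*-congʳ (φ-* r x)) (trans (*-congʳ (*-comm _ _)) (*-assoc _ _ _))

    ⟪⟫-∙ : ∀ a u → ⟪ a ∙ u ⟫ ≈ a * ⟪ u ⟫
    ⟪⟫-∙ a (x ⊗ s) = trans (sym (*-assoc _ _ _)) (trans (*-congʳ (*-comm _ _)) (*-assoc _ _ _))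
    ⟪⟫-∙ a 𝟘       = sym (zeroʳ a)
    ⟪⟫-∙ a (u ⊕ v) = trans (+-cong (⟪⟫-∙ a u) (⟪⟫-∙ a v)) (sym (distribˡ _ _ _))
    ⟪⟫-∙ a (⊖ u)   = trans (-‿cong (⟪⟫-∙ a u)) (-‿distribʳ-* _ _)

  module First = Functional (λ x → ⟦ proj₁ x ⟧) (λ e → ⟦⟧-cong (proj₁ e)) (λ _ _ → +-homo _ _) (λ _ _ → *-homo _ _)
  module Second = Functional (λ x → ⟦ proj₂ x ⟧) (λ e → ⟦⟧-cong (proj₂ e)) (λ _ _ → +-homo _ _) (λ _ _ → *-homo _ _)

  open First public using () renaming (⟪_⟫ to coord₁; ⟪⟫-cong to coord₁-cong; ⟪⟫-∙ to coord₁-∙)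
  open Second public using () renaming (⟪_⟫ to coord₂; ⟪⟫-cong to coord₂-cong; ⟪⟫-∙ to coord₂-∙)

  ⊗-zeroʳ : ∀ x → x ⊗ 0# ≋ 𝟘
  -- Writing 0 as 0 · 0 exhibits x ⊗ 0 as a multiple by the scalar 0.
  ⊗-zeroʳ x = ≋-trans (⊗-cong M.≈ᴹ-refl (sym (zeroˡ 0#))) (T.*ₗ-zeroˡ (x ⊗ 0#))

  ⊗-negʳ : ∀ x s → x ⊗ (- s) ≋ ⊖ (x ⊗ s)
  ⊗-negʳ x s = ⊖-unique _ _ (≋-trans (≋-sym (⊗-distribˡ x (- s) s))
    (≋-trans (⊗-cong M.≈ᴹ-refl (-‿inverseˡ s)) (⊗-zeroʳ x)))

  expansion : ∀ u → u ≋ e₁ R ⊗ coord₁ u ⊕ e₂ R ⊗ coord₂ u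
  expansion ((x , y) ⊗ s) = ≋-trans (⊗-cong split refl)
    (≋-trans (⊗-distribʳ _ _ s) (⊕-cong (⊗-balanced x (e₁ R) s) (⊗-balanced y (e₂ R) s)))
    where
    open Solver R.commutativeSemiring using (solve; _:=_; _:+_; _:*_; con)
    split : (x , y) M.≈ᴹ (x M.*ₗ e₁ R) M.+ᴹ (y M.*ₗ e₂ R)
    split = solve 2 (λ x y → x := x :* con 1 :+ y :* con 0) R.refl x y
          , solve 2 (λ x y → y := x :* con 0 :+ y :* con 1) R.refl x y
  expansion 𝟘       = ≋-sym (≋-trans (⊕-cong (⊗-zeroʳ _) (⊗-zeroʳ _)) (⊕-identityˡ 𝟘))
  expansion (u ⊕ v) = ≋-trans (⊕-cong (expansion u) (expansion v))
    (≋-trans (⊕-interchange _ _ _ _) (⊕-cong (≋-sym (⊗-distribˡ _ _ _)) (≋-sym (⊗-distribˡ _ _ _))))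
  expansion (⊖ u)   = ≋-trans (⊖-cong (expansion u))
    (≋-sym (⊖-unique _ _ (≋-trans (⊕-interchange _ _ _ _)
      (≋-trans (⊕-cong (cancel _ _) (cancel _ _)) (⊕-identityˡ 𝟘)))))
    where
    cancel : ∀ x s → x ⊗ (- s) ⊕ x ⊗ s ≋ 𝟘
    cancel x s = ≋-trans (⊕-cong (⊗-negʳ x s) ≋-refl) (⊖-inverseˡ _)

  -- By `expansion` a tensor is recovered from its coordinates, so equations in the base change
  -- reduce to pairs of equations in `S`.
  coordinates-injective : ∀ u v → coord₁ u ≈ coord₁ v → coord₂ u ≈ coord₂ v → u ≋ v
  coordinates-injective u v h k = ≋-trans (expansion u)
    (≋-trans (⊕-cong (⊗-cong M.≈ᴹ-refl h) (⊗-cong M.≈ᴹ-refl k)) (≋-sym (expansion v)))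

module Companion (p n : ℕ) {R : CommutativeRing c ℓ} {S : CommutativeRing c′ ℓ′}
  (ι : R ⟶ S) (σᴿ : R ⟶ R) (σˢ : S ⟶ S) (commutes : Commutes {R = R} {S = S} ι σᴿ σˢ)
  (α : CommutativeRing.Carrier R) where
  private
    module R = CommutativeRing R
    module S = CommutativeRing S
    module ι = RingHomomorphism ι
    module σᴿ = RingHomomorphism σᴿ
    module σˢ = RingHomomorphism σˢ
    module M = Module (plane R)
    module B = BaseChange {R = R} {S = R} σᴿ (plane R)
    module E = BaseChange {R = R} {S = S} ι (plane R)
    module MB = Module B.baseChange
    module CB = Coordinates {R = R} {S = R} σᴿ
    module CE = Coordinates {R = R} {S = S} ι
    module Rᴹ = Mult R.semiring
    module Sᴹ = Mult S.semiring

  q : R.Carrier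
  q = (p ℕ.^ n) Rᴹ.× R.1#

  qˢ : S.Carrier
  qˢ = (p ℕ.^ n) Sᴹ.× S.1#

  matrix : B.Tensor → M.Carrierᴹ
  matrix u = α R.* CB.coord₁ u R.+ CB.coord₂ u , q R.* CB.coord₁ u

  private
    module _ where
      open CommutativeRing R
      open Solver commutativeSemiring using (solve; _:=_; _:+_; _:*_; con)
      open RingProps ring using (-‿+-comm; -‿distribʳ-*)

      matrix-cong : ∀ {u v} → u B.≋ v → matrix u M.≈ᴹ matrix v
      matrix-cong e = +-cong (*-congˡ (CB.coord₁-cong e)) (CB.coord₂-cong e) , *-congˡ (CB.coord₁-cong e)

      matrix-+ : ∀ u v → matrix (u B.⊕ v) M.≈ᴹ matrix u M.+ᴹ matrix v
      matrix-+ u v = solve 5 (λ α a b d e → α :* (a :+ b) :+ (d :+ e) := (α :* a :+ d) :+ (α :* b :+ e)) refl α _ _ _ _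
                   , distribˡ _ _ _

      matrix-0 : matrix B.𝟘 M.≈ᴹ M.0ᴹ
      matrix-0 = trans (+-identityʳ _) (zeroʳ α) , zeroʳ q

      matrix-neg : ∀ u → matrix (B.⊖ u) M.≈ᴹ M.-ᴹ matrix u
      matrix-neg u = trans (+-congʳ (sym (-‿distribʳ-* _ _))) (-‿+-comm _ _) , sym (-‿distribʳ-* _ _)

      matrix-∙ : ∀ a u → matrix (a B.∙ u) M.≈ᴹ a M.*ₗ matrix u
      matrix-∙ a u = trans (+-cong (*-congˡ (CB.coord₁-∙ a u)) (CB.coord₂-∙ a u))
                      (solve 4 (λ α a x y → α :* (a :* x) :+ a :* y := a :* (α :* x :+ y)) refl α a _ _)
                   , trans (*-congˡ (CB.coord₁-∙ a u)) (solve 3 (λ q a x → q :* (a :* x) := a :* (q :* x)) refl q a _)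

  F : LinearMap B.baseChange (plane R)
  F = record
    { ⟦_⟧ = matrix
    ; isModuleHomomorphism = record
      { isBimoduleHomomorphism = record
        { +ᴹ-isGroupHomomorphism = record
          { isMonoidHomomorphism = record
            { isMagmaHomomorphism = record
              { isRelHomomorphism = record { cong = matrix-cong }
              ; homo = matrix-+ }
            ; ε-homo = matrix-0 }
          ; ⁻¹-homo = matrix-neg }
        ; *ₗ-homo = matrix-∙
        ; *ᵣ-homo = λ a u → M.≈ᴹ-trans (matrix-∙ a u) (M.*ₗ-*ᵣ-coincident a (matrix u))
        }
      }
    }

  isogeny : IsIsogeny p F
  isogeny = record { kernel = n , kernel ; cokernel = n , cokernel }
    where
    open CommutativeRing R
    open SetoidReasoning setoid
    open Solver commutativeSemiring using (solve; _:=_; _:+_; _:*_; con)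
    open MonoidMult MB.+ᴹ-monoid using () renaming (_×_ to infixr 8 _×ᴮ_)
    open MonoidMult M.+ᴹ-monoid using () renaming (_×_ to infixr 8 _×ᴹ_)

    -- The second entry of F gives q x = 0, and then q y = q (α x + y) = 0 by the first.
    kernel : ∀ u → matrix u M.≈ᴹ M.0ᴹ → (p ℕ.^ n) ×ᴮ u B.≋ B.𝟘
    kernel u (e , e′) = B.≋-trans (×ᴹ≈×1*ₗ B.baseChange (p ℕ.^ n) u)
      (CB.coordinates-injective (q B.∙ u) B.𝟘 (trans (CB.coord₁-∙ q u) e′) (trans (CB.coord₂-∙ q u) (begin
        q * y               ≈⟨ +-identityˡ _ ⟨
        0# + q * y          ≈⟨ +-congʳ (trans (*-congˡ e′) (zeroʳ α)) ⟨
        α * (q * x) + q * y ≈⟨ solve 4 (λ α q x y → α :* (q :* x) :+ q :* y := q :* (α :* x :+ y)) refl α q x y ⟩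
        q * (α * x + y)     ≈⟨ trans (*-congˡ e) (zeroʳ q) ⟩
        0# ∎)))
      where
      x = CB.coord₁ u
      y = CB.coord₂ u

    cokernel : ∀ y → ∃ λ u → matrix u M.≈ᴹ (p ℕ.^ n) ×ᴹ y
    -- The coordinates c₁ = y and c₂ = q x - α y solve α c₁ + c₂ = q x and q c₁ = q y.
    cokernel (x , y) = e₁ R B.⊗ y B.⊕ e₂ R B.⊗ (q * x - α * y) , M.≈ᴹ-trans
      ( (begin
          α * (σᴿ.⟦ 1# ⟧ * y + σᴿ.⟦ 0# ⟧ * z) + (σᴿ.⟦ 0# ⟧ * y + σᴿ.⟦ 1# ⟧ * z)
            ≈⟨ +-cong (*-congˡ first) second ⟩
          α * y + (q * x - α * y)     ≈⟨ solve 3 (λ a b d → a :+ (b :+ d) := b :+ (a :+ d)) refl _ _ _ ⟩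
          q * x + (α * y - α * y)     ≈⟨ trans (+-congˡ (-‿inverseʳ _)) (+-identityʳ _) ⟩
          q * x ∎)
      , *-congˡ first )
      (M.≈ᴹ-sym (×ᴹ≈×1*ₗ (plane R) (p ℕ.^ n) (x , y)))
      where
      z = q * x - α * y
      first : σᴿ.⟦ 1# ⟧ * y + σᴿ.⟦ 0# ⟧ * z ≈ y
      first = trans (+-cong (*-congʳ σᴿ.1#-homo) (*-congʳ σᴿ.0#-homo))
        (solve 2 (λ y z → con 1 :* y :+ con 0 :* z := y) refl y z)
      second : σᴿ.⟦ 0# ⟧ * y + σᴿ.⟦ 1# ⟧ * z ≈ z
      second = trans (+-cong (*-congʳ σᴿ.0#-homo) (*-congʳ σᴿ.1#-homo))
        (solve 2 (λ y z → con 0 :* y :+ con 1 :* z := z) refl y z)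

  module _ (a : S.Carrier) (fixed : a S.≈ ι.⟦ α ⟧ S.* σˢ.⟦ a ⟧ S.+ qˢ S.* σˢ.⟦ σˢ.⟦ a ⟧ ⟧) where
    open CommutativeRing S
    open SetoidReasoning setoid
    open Solver commutativeSemiring using (solve; _:=_; _:+_; _:*_; con)
    open SemilinearExtension {R = R} {S = S} ι σᴿ σˢ commutes (plane R) F

    fixedVector : E.Tensor
    fixedVector = e₁ R E.⊗ a E.⊕ e₂ R E.⊗ (qˢ * σˢ.⟦ a ⟧)

    private
      coord₁-e₁ : ∀ x y → ι.⟦ R.1# ⟧ * x + ι.⟦ R.0# ⟧ * y ≈ x
      coord₁-e₁ x y = trans (+-cong (*-congʳ ι.1#-homo) (*-congʳ ι.0#-homo))
        (solve 2 (λ x y → con 1 :* x :+ con 0 :* y := x) refl x y)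

      coord₂-e₂ : ∀ x y → ι.⟦ R.0# ⟧ * x + ι.⟦ R.1# ⟧ * y ≈ y
      coord₂-e₂ x y = trans (+-cong (*-congʳ ι.0#-homo) (*-congʳ ι.1#-homo))
        (solve 2 (λ x y → con 0 :* x :+ con 1 :* y := y) refl x y)

      onModule-e₁ : onModule (e₁ R) M.≈ᴹ (α , q)
      onModule-e₁ = R.trans (R.+-cong (R.*-congˡ (R.trans (R.*-identityʳ _) σᴿ.1#-homo)) (R.trans (R.*-identityʳ _) σᴿ.0#-homo))
                      (R.trans (R.+-identityʳ _) (R.*-identityʳ α))
                  , R.trans (R.*-congˡ (R.trans (R.*-identityʳ _) σᴿ.1#-homo)) (R.*-identityʳ q)

      onModule-e₂ : onModule (e₂ R) M.≈ᴹ e₁ R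
      onModule-e₂ = R.trans (R.+-cong (R.*-congˡ (R.trans (R.*-identityʳ _) σᴿ.0#-homo)) (R.trans (R.*-identityʳ _) σᴿ.1#-homo))
                      (R.trans (R.+-congʳ (R.zeroʳ α)) (R.+-identityˡ _))
                  , R.trans (R.*-congˡ (R.trans (R.*-identityʳ _) σᴿ.0#-homo)) (R.zeroʳ q)

      ι-q : ι.⟦ q ⟧ ≈ qˢ
      ι-q = trans (Hom.×-homo {R = R} {S = S} ι (p ℕ.^ n) R.1#) (Sᴹ.×-congʳ (p ℕ.^ n) ι.1#-homo)

      σ-q : σˢ.⟦ qˢ ⟧ ≈ qˢ
      σ-q = trans (Hom.×-homo {R = S} {S = S} σˢ (p ℕ.^ n) 1#) (Sᴹ.×-congʳ (p ℕ.^ n) σˢ.1#-homo)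

    -- The second coordinates agree by the choice of q σ(a). The first ones agree by `fixed`, where
    -- σ fixes q because q is an integer multiple of 1.
    extension-fixedVector : extension fixedVector E.≋ fixedVector
    extension-fixedVector = CE.coordinates-injective (extension fixedVector) fixedVector
      (begin
        ι.⟦ proj₁ (onModule (e₁ R)) ⟧ * σˢ.⟦ a ⟧ + ι.⟦ proj₁ (onModule (e₂ R)) ⟧ * σˢ.⟦ qˢ * σˢ.⟦ a ⟧ ⟧
          ≈⟨ +-cong (*-congʳ (ι.⟦⟧-cong (proj₁ onModule-e₁))) (*-cong (trans (ι.⟦⟧-cong (proj₁ onModule-e₂)) ι.1#-homo)
               (trans (σˢ.*-homo _ _) (*-congʳ σ-q))) ⟩
        ι.⟦ α ⟧ * σˢ.⟦ a ⟧ + 1# * (qˢ * σˢ.⟦ σˢ.⟦ a ⟧ ⟧)   ≈⟨ +-congˡ (*-identityˡ _) ⟩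
        ι.⟦ α ⟧ * σˢ.⟦ a ⟧ + qˢ * σˢ.⟦ σˢ.⟦ a ⟧ ⟧          ≈⟨ fixed ⟨
        a                                                  ≈⟨ coord₁-e₁ a _ ⟨
        CE.coord₁ fixedVector ∎)
      (begin
        ι.⟦ proj₂ (onModule (e₁ R)) ⟧ * σˢ.⟦ a ⟧ + ι.⟦ proj₂ (onModule (e₂ R)) ⟧ * σˢ.⟦ qˢ * σˢ.⟦ a ⟧ ⟧
          ≈⟨ +-cong (*-congʳ (trans (ι.⟦⟧-cong (proj₂ onModule-e₁)) ι-q)) (*-congʳ (trans (ι.⟦⟧-cong (proj₂ onModule-e₂)) ι.0#-homo)) ⟩
        qˢ * σˢ.⟦ a ⟧ + 0# * σˢ.⟦ qˢ * σˢ.⟦ a ⟧ ⟧          ≈⟨ trans (+-congˡ (zeroˡ _)) (+-identityʳ _) ⟩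
        qˢ * σˢ.⟦ a ⟧                                      ≈⟨ coord₂-e₂ a _ ⟨
        CE.coord₂ fixedVector ∎)

    -- Comparison of first coordinates: a fixed vector lying in M would force a to have integral
    -- components.
    integral : ∀ x → E.embed x E.≋ fixedVector → ι.⟦ proj₁ x ⟧ ≈ a
    integral x e = trans (sym (*-identityʳ _)) (trans (CE.coord₁-cong e) (coord₁-e₁ a _))

-- Specialization to Witt vectors.

module WittFixedPoint {p : ℕ} (p-prime : Prime p)
  {A : CommutativeRing c ℓ} {B : CommutativeRing c′ ℓ′} (charA : A ofChar p) (charB : B ofChar p) (i : A ⟶ B)
  (s : CommutativeRing.Carrier A) (u : CommutativeRing.Carrier B) where
  private
    module A = CommutativeRing A
    module WB = CommutativeRing (Witt.W p-prime B)
    module TA = WittOperators p-prime A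
    module TB = WittOperators p-prime B
    module UB = Universal p-prime B charB
    ι : Witt.W p-prime A ⟶ Witt.W p-prime B
    ι = Witt.W-map p-prime {A = A} {B = B} i
    module ι = RingHomomorphism ι
    module i = Hom {R = A} {S = B} i
    open Mult WB.semiring using () renaming (_×_ to _×ᵂ_)
  open CommutativeRing B hiding (zero)
  open SetoidReasoning setoid
  open Exp A.semiring using () renaming (_^_ to _^ᴬ_)
  open Exp semiring using (_^_; ^-congˡ; ^-congʳ; ^-homo-*; ^-assocʳ)
  open CommExp commutativeSemiring using (^-distrib-*)
  open Congruence p-prime B using (0^p; 1^)

  T : ℕ → WB.Carrier
  T n = TB.[ u ^ n ]

  t : ℕ → ℕ → A.Carrier
  t n = TA.[ s ^ᴬ n ]

  []-cong : ∀ {a b} → a ≈ b → TB.[ a ] WB.≈ TB.[ b ]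
  []-cong e zero    = e
  []-cong e (suc n) = refl

  []-^p : ∀ {a b} → a ^ p ≈ b → ∀ n → TB.[ a ] n ^ p ≈ TB.[ b ] n
  []-^p e zero    = e
  []-^p e (suc n) = 0^p

  ι-[] : ∀ {a b} → i.⟦ a ⟧ ≈ b → ι.⟦ TA.[ a ] ⟧ WB.≈ TB.[ b ]
  ι-[] e zero    = e
  ι-[] e (suc n) = i.0#-homo

  ι-t : ∀ n → ι.⟦ t n ⟧ WB.≈ TB.[ i.⟦ s ⟧ ^ n ]
  ι-t n = ι-[] (i.^-homo s n)

  module _ (is*u≈1 : i.⟦ s ⟧ * u ≈ 1#) where
    T-0 : T 0 WB.≈ WB.1#
    T-0 zero    = refl
    T-0 (suc n) = refl

    t-0 : ι.⟦ t 0 ⟧ WB.≈ WB.1#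
    t-0 zero    = i.1#-homo
    t-0 (suc n) = i.0#-homo

    T-+ : ∀ m n → T (m ℕ.+ n) WB.≈ T m WB.* T n
    T-+ m n = WB.trans {T (m ℕ.+ n)} {TB.[ u ^ m * u ^ n ]} {T m WB.* T n} ([]-cong (^-homo-* u m n)) (UB.[]-* (u ^ m) (u ^ n))

    σ-T : ∀ n j → T n j ^ p ≈ T (p ℕ.* n) j
    σ-T n = []-^p (trans (^-assocʳ u n p) (^-congʳ u (ℕₚ.*-comm n p)))

    σ-t : ∀ n j → ι.⟦ t n ⟧ j ^ p ≈ ι.⟦ t (p ℕ.* n) ⟧ j
    σ-t n j = trans (^-congˡ p (ι-t n j)) (trans ([]-^p (trans (^-assocʳ i.⟦ s ⟧ n p) (^-congʳ i.⟦ s ⟧ (ℕₚ.*-comm n p))) j)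
      (sym (ι-t (p ℕ.* n) j)))

    t-T : ∀ m n → ι.⟦ t (m ℕ.+ n) ⟧ WB.* T n WB.≈ ι.⟦ t m ⟧
    t-T m n = WB.trans {ι.⟦ t (m ℕ.+ n) ⟧ WB.* T n} {TB.[ x ^ (m ℕ.+ n) * u ^ n ]} {ι.⟦ t m ⟧}
      (WB.trans {ι.⟦ t (m ℕ.+ n) ⟧ WB.* T n} {TB.[ x ^ (m ℕ.+ n) ] WB.* T n} {TB.[ x ^ (m ℕ.+ n) * u ^ n ]}
        (WB.*-cong {ι.⟦ t (m ℕ.+ n) ⟧} {TB.[ x ^ (m ℕ.+ n) ]} {T n} {T n} (ι-t (m ℕ.+ n)) (WB.refl {T n}))
        (WB.sym {TB.[ x ^ (m ℕ.+ n) * u ^ n ]} {TB.[ x ^ (m ℕ.+ n) ] WB.* T n} (UB.[]-* (x ^ (m ℕ.+ n)) (u ^ n))))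
      (WB.trans {TB.[ x ^ (m ℕ.+ n) * u ^ n ]} {TB.[ x ^ m ]} {ι.⟦ t m ⟧} ([]-cong cancel) (WB.sym {ι.⟦ t m ⟧} {TB.[ x ^ m ]} (ι-t m)))
      where
      x = i.⟦ s ⟧
      cancel : x ^ (m ℕ.+ n) * u ^ n ≈ x ^ m
      cancel = begin
        x ^ (m ℕ.+ n) * u ^ n    ≈⟨ *-congʳ (^-homo-* x m n) ⟩
        x ^ m * x ^ n * u ^ n    ≈⟨ *-assoc _ _ _ ⟩
        x ^ m * (x ^ n * u ^ n)  ≈⟨ *-congˡ (trans (sym (^-distrib-* x u n)) (trans (^-congˡ n is*u≈1) (1^ n))) ⟩
        x ^ m * 1#               ≈⟨ *-identityʳ _ ⟩
        x ^ m ∎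

    wittFixedPoint : ∃ λ α → ∃ λ a → a 0 ≈ u ×
      a WB.≈ ι.⟦ α ⟧ WB.* UB.σ a WB.+ ((p ℕ.^ 4) ×ᵂ WB.1#) WB.* UB.σ (UB.σ a)
    wittFixedPoint = α , a , a₀ , proj₂ (proj₂ (proj₂ solution))
      where
      -- This form of p also provides B = p - 1 as a successor.
      p≡2+m = proj₂ (prime≥2 p-prime)
      2≤p : 2 ℕ.≤ p
      2≤p = ≡.subst (2 ℕ.≤_) (≡.sym p≡2+m) (ℕ.s≤s (ℕ.s≤s ℕ.z≤n))
      solution = FixedPoint.fixedPoint {p = p} p≡2+m 2≤p
        (Witt.W p-prime B) (Witt.W p-prime A)
        (WittVerschiebung.verschiebung p-prime B charB) (WittVerschiebung.verschiebung p-prime A charA)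
        ι T t (record { T-0 = T-0 ; T-+ = T-+ ; σ-T = σ-T })
          (record { ι-V = λ { x zero → i.0#-homo ; x (suc n) → refl } ; t-0 = t-0 ; t-T = t-T ; σ-t = σ-t })
      α = proj₁ solution
      a = proj₁ (proj₂ solution)
      z = proj₁ (proj₁ (proj₂ (proj₂ solution)))
      a₀ : a 0 ≈ u
      a₀ = begin
        a 0                                      ≈⟨ proj₂ (proj₁ (proj₂ (proj₂ solution))) 0 ⟩
        -- Component 0 is the ghost component 0, so it is additive and multiplicative.
        (T 1 WB.* (WB.1# WB.+ TB.V z)) 0         ≈⟨ Witt.ghost-* p-prime B 0 (T 1) (WB.1# WB.+ TB.V z) ⟩
        u ^ 1 * (WB.1# WB.+ TB.V z) 0            ≈⟨ *-cong (*-identityʳ u) (Witt.ghost-+ p-prime B 0 WB.1# (TB.V z)) ⟩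
        u * (1# + 0#)                            ≈⟨ trans (*-congˡ (+-identityʳ 1#)) (*-identityʳ u) ⟩
        u ∎

proposition6p1 : ∀ {c ℓ} {p : ℕ} (p-prime : Prime p)
    (k : CommutativeRing c ℓ) (k-closed : IsAlgebraicallyClosedField k) (char : k ofChar p) →
    let open Setting p-prime k char in
    ∃ λ (M : Module (W k⟦t⟧) c ℓ) → FreeOfRank M 2 ×
    (∃ λ (F : LinearMap (σ^* M) M) → IsIsogeny p F ×
    (let open Module (M ⊗Wk⦅t⦆) in
    ∃ λ (v : Carrierᴹ) → ¬ (∃ λ x → x ⊗1 ≈ᴹ v) × extend F v ≈ᴹ v))
proposition6p1 {c} {ℓ} {p} p-prime k k-closed char =
  plane (W k⟦t⟧) , plane-free (W k⟦t⟧) , C.F , C.isogeny , C.fixedVector a fixed ,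
  (λ (x , e) → IsAlgebraicallyClosedField.0≉1 k-closed (1/t∉k⟦t⟧ (proj₁ x 0)
    (CommutativeRing.trans k⦅t⦆ (C.integral a fixed x e 0) a₀))) ,
  C.extension-fixedVector a fixed
  where
  open Setting p-prime k char
  open LaurentSeries k
  open CommutativeRing k hiding (zero)
  1/t : CommutativeRing.Carrier k⦅t⦆
  1/t = CommutativeRing.1# k⟦t⟧ /s^ 1
  t*1/t≈1 : CommutativeRing._≈_ k⦅t⦆ (CommutativeRing._*_ k⦅t⦆ (RingHomomorphism.⟦_⟧ inclusion t) 1/t) (CommutativeRing.1# k⦅t⦆)
  t*1/t≈1 = cross (CommutativeRing.trans k⟦t⟧ (CommutativeRing.*-identityˡ k⟦t⟧ _)
    (CommutativeRing.sym k⟦t⟧ (CommutativeRing.*-identityʳ k⟦t⟧ _)))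
  solution = WittFixedPoint.wittFixedPoint p-prime {A = k⟦t⟧} {B = k⦅t⦆} char⟦⟧ char⦅⦆ inclusion t 1/t t*1/t≈1
  α = proj₁ solution
  a = proj₁ (proj₂ solution)
  a₀ = proj₁ (proj₂ (proj₂ solution))
  fixed = proj₂ (proj₂ (proj₂ solution))
  module C = Companion p 4 {R = W k⟦t⟧} {S = W k⦅t⦆} ι σ σ′ σ-ι α
  -- Cross-multiplied, the equation reads t f = 1, and the constant coefficients of its two sides
  -- are 0 and 1.
  1/t∉k⟦t⟧ : ∀ f → CommutativeRing._≈_ k⦅t⦆ (RingHomomorphism.⟦_⟧ inclusion f) 1/t → 0# ≈ 1#
  1/t∉k⟦t⟧ f (cross e) = trans (sym (zeroˡ (f 0))) (trans (*-congʳ (sym (zeroˡ 1#))) (trans (e 0) (*-identityˡ 1#)))
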